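{- Let $p\geq 7$ be a prime and $d\geq 3$ an integer. Then $\eta(\mathbb{Z}_p^d)\leq \frac{p^d-p}{p^2-p}(3p-7)+4$.
   Context: $\mathbb{Z}_p=\mathbb{Z}/p\mathbb{Z}$. For a finite abelian group $G$ and a positive integer $n$, a zero-sum subsequence of length $\ell$ of a sequence $g_1,\dots,g_k$ in $G$ is a choice of $\ell\ge1$ distinct indices $i_1<\dots<i_\ell$ with $g_{i_1}+\dots+g_{i_\ell}=0$. $\mathfrak{s}_{\leq n}(G)$ is the least integer $k$ such that every sequence of length $k$ in $G$ contains a zero-sum subsequence of length at most $n$, and $\eta(G)=\mathfrak{s}_{\leq \exp(G)}(G)$. -}

module Defs where

open import Data.Nat using (ℕ; zero; suc; _+_; _≤_; _<_)
open import Data.Nat.Divisibility using (_∣_)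
open import Data.Fin using (Fin; toℕ)
open import Data.Fin.Subset using (Subset; ∣_∣)
open import Data.Vec using ([]; _∷_)
open import Data.Bool using (true; false)
open import Data.Product using (Σ; _×_)
open import Relation.Nullary using (¬_)

-- The group Z_p^d: a vector of d residues mod p (coordinatewise addition mod p).
ℤₚ^ : ℕ → ℕ → Set
ℤₚ^ p d = Fin d → Fin p

Seq : ℕ → ℕ → ℕ → Set
Seq p d k = Fin k → ℤₚ^ p d

sumOver : ∀ {k} → Subset k → (Fin k → ℕ) → ℕ
sumOver {zero}  []            f = 0
sumOver {suc k} (true  ∷ S)   f = f Fin.zero + sumOver S (λ i → f (Fin.suc i))
sumOver {suc k} (false ∷ S)   f = sumOver S (λ i → f (Fin.suc i))

IsZeroSum : ∀ {p d k} → Seq p d k → Subset k → Set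
IsZeroSum {p} {d} s S = (j : Fin d) → p ∣ sumOver S (λ i → toℕ (s i j))

HasShortZeroSum : ∀ {p d k} → ℕ → Seq p d k → Set
HasShortZeroSum {k = k} n s =
  Σ (Subset k) λ S → (1 ≤ ∣ S ∣) × (∣ S ∣ ≤ n) × IsZeroSum s S

AllHaveShortZeroSum : ℕ → ℕ → ℕ → ℕ → Set
AllHaveShortZeroSum p d n k = (s : Seq p d k) → HasShortZeroSum n s

IsSmallDavenport≤ : ℕ → ℕ → ℕ → ℕ → Set
IsSmallDavenport≤ p d n m =
  AllHaveShortZeroSum p d n m × ((k : ℕ) → k < m → ¬ AllHaveShortZeroSum p d n k)

-- m = η(Z_p^d) = s_{≤ exp(G)}(Z_p^d), with exp(Z_p^d) = p for d ≥ 1.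
IsEta : ℕ → ℕ → ℕ → Set
IsEta p d m = IsSmallDavenport≤ p d p m

{-# OPTIONS --safe #-}

-- Let N = (p^(d-1) - 1)/(p - 1) and suppose that a sequence of length N(3p - 7) + 4 has no short zero-sum
-- subsequence. Since η(ℤ_p²) ≤ 3p - 2, a pigeonhole over the N planes through a line shows that no line
-- through 0 contains 5 terms, while some line contains at least 3; a second pigeonhole then yields a plane
-- with at least 3p - 3 terms, at most 4 on each line. Such plane sequences do not exist:
--
-- * With g(t) = ∏_{0<c<p} (t - c), the alternating sum of a product F of such factors over all subsequences
--   is an iterated difference of a polynomial, and it vanishes when the degree of F is less than the length.
--   This gives the bound on η(ℤ_p²), and from 3p - 3 terms a zero-sum subsequence U of length 2p - 1, no
--   proper part of which has sum zero.
-- * For four terms of U, the alternating sum over the other terms is a polynomial function f of degree at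
--   most 3 with f(0) ≠ 0 that vanishes at the sum of every proper non-empty part of the four. Eliminating
--   its coefficients leaves a conic and a cubic equation between the determinants of the four terms.
-- * Solving these, three of the four points lie on an affine line L and the fourth on L or on its parallel
--   through 0, or the slopes m_ij = [i,j] / (P_i P_j (P_i - P_j)), with P_i = [m,i] for the fourth point m,
--   satisfy m₁₂ + m₁₃ + m₂₃ = 0. The last case cannot hold for all quadruples out of five points, so all of U
--   lies on some L and its parallel through 0, and summing modulo p contradicts the bound 4. For p = 7 there
--   may be only four distinct terms, and the solutions of the two equations are enumerated.
module Submission where

open import Defs
open import Data.Bool using (Bool; true; false; _∧_; _∨_; not; T)
open import Data.Empty using (⊥; ⊥-elim)
open import Data.Fin as Fin using (Fin; toℕ; zero; suc; fromℕ<; funToFin; finToFun; punchIn; punchOut)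
import Data.Fin.Properties as Finₚ
open import Data.Fin.Subset using (Subset; ∣_∣)
open import Data.Fin.Subset.Properties using (anySubset?)
open import Data.Integer as ℤ using (ℤ; +_; -[1+_]; _+_; _*_; _-_; -_)
open import Data.Integer.DivMod using (_%ℕ_; _/ℕ_; n%ℕd<d; a≡a%ℕn+[a/ℕn]*n)
open import Data.Integer.Divisibility.Signed using (_∣_; divides; _∣?_; ∣⇒∣ᵤ; ∣ᵤ⇒∣; ∣m∣n⇒∣m+n; ∣m∣n⇒∣m-n; ∣m⇒∣-m; ∣n⇒∣m*n)
import Data.Integer.Properties as ℤₚ
open import Data.Integer.Tactic.RingSolver using (solve-∀)
open import Data.List using (List; []; _∷_; _++_; length; take; drop; map; filter; tabulate)
open import Data.List.Membership.Propositional using (_∈_; lose) renaming (find to find-any)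
open import Data.List.Membership.Propositional.Properties using (∈-∃++; ∈-++⁺ˡ)
import Data.List.Properties as Listₚ
open import Data.List.Relation.Binary.Permutation.Propositional using (_↭_; ↭-refl; ↭-sym; ↭-trans; prep; swap; ↭-reflexive)
open import Data.List.Relation.Binary.Permutation.Propositional.Properties using (shift; ++⁺ʳ; ++⁺ˡ; ++-comm; ↭-length; shifts; ∈-resp-↭; All-resp-↭; ↭-map-inv; filter-↭)
open import Data.List.Relation.Unary.All as All using (All; []; _∷_)
import Data.List.Relation.Unary.All.Properties as Allₚ
open import Data.List.Relation.Unary.Any using (here; there; Any; any?)
open import Data.Nat as ℕ using (ℕ; zero; suc; _≡ᵇ_; _≤_; _<_; s≤s; z≤n; s≤s⁻¹; _≤?_; _<?_; _∸_; _^_; pred)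
open import Data.Nat.Coprimality using (Coprime; coprime-Bézout)
open import Data.Nat.Divisibility using (n∣m⇒m%n≡0)
import Data.Nat.Divisibility as ℕᵈ
open import Data.Nat.GCD using (module Bézout)
open import Data.Nat.Primality using (Prime; euclidsLemma; prime⇒nonZero; prime⇒nonTrivial; prime⇒irreducible; prime?)
open import Data.Nat.Properties using (*-cancelˡ-<; *-distribʳ-+; *-monoʳ-≤; *-monoˡ-≤; *-zeroʳ; +-cancelʳ-≡; +-cancelʳ-≤; +-cancelˡ-<; +-cancelˡ-≡; +-cancelˡ-≤; +-comm; +-identityʳ; +-mono-≤; +-monoʳ-≤; +-monoˡ-<; +-monoˡ-≤; +-suc; 0≢1+n; <-trans; <-≤-trans; <⇒≢; <⇒≤; <⇒≱; m*n≢0; m+[n∸m]≡n; m+n∸m≡n; m+n∸n≡m; m^n>0; m∸n+n≡m; m≤m+n; m≤n+m; m≤n⇒m<n∨m≡n; m≤n⇒m⊓n≡m; n<1+n; n≤1+n; suc-injective; suc-pred; ≡ᵇ⇒≡; ≤-<-trans; ≤-antisym; ≤-refl; ≤-reflexive; ≤-trans; ≤∧≢⇒<; ≮⇒≥; ≰⇒>)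
open import Data.Nat.Tactic.RingSolver using () renaming (solve-∀ to solveℕ)
open import Data.Product using (∃; _×_; _,_; proj₁; proj₂; ∃₂)
open import Data.Sum using (_⊎_; inj₁; inj₂; [_,_]′)
open import Data.Unit using (⊤; tt)
import Data.Vec as Vec
open import Function using (id)
open import Relation.Binary.PropositionalEquality using (_≡_; refl; sym; trans; cong; cong₂; subst)
open import Relation.Nullary using (¬_; Dec; yes; no; _×-dec_; contradiction)
open import Relation.Nullary.Decidable using (from-no)
open import Relation.Unary using (Decidable)

-- The bound 3p - 3 for planes fails in general: p - 1 copies each of (1,0), (0,1) and (1,1) have no
-- short zero-sum subsequence. These terms crowd on three lines, which is why lines have to be
-- bounded first. Using 3p - 3 instead of 3p - 2 lowers the factor of N by one: three terms of a
-- line lie in all N planes through it, and among 3 + N(3p - 7) + 1 terms one of these planes gets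
-- more than 3p - 7 further ones, hence at least 3p - 3 in all. Four is the first informative number
-- of terms of U. For two, f is affine and only shows that parallel terms are congruent; for three,
-- f is quadratic and eliminating its coefficients gives an identity; for four, ten coefficients
-- face fifteen prescribed values. Congruences are kept as divisibility of integers, so that each
-- elimination is an identity over the integers. The multipliers 2, 6 and 12 replace the
-- denominators of a Taylor expansion, and common factors are cancelled afterwards by primality.

data Poly (n : ℕ) : Set where
  var : Fin n → Poly n
  con : ℤ → Poly n
  _⊞_ _⊟_ _⊠_ : Poly n → Poly n → Poly n

infixl 6 _⊞_ _⊟_
infixl 7 _⊠_

⟦_⟧ : ∀ {n} → Poly n → (Fin n → ℤ) → ℤ
⟦ var i ⟧ ρ = ρ i
⟦ con k ⟧ ρ = k
⟦ a ⊞ b ⟧ ρ = ⟦ a ⟧ ρ + ⟦ b ⟧ ρ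
⟦ a ⊟ b ⟧ ρ = ⟦ a ⟧ ρ - ⟦ b ⟧ ρ
⟦ a ⊠ b ⟧ ρ = ⟦ a ⟧ ρ * ⟦ b ⟧ ρ

-- Arithmetic modulo p on integer representatives

module Residues (p : ℕ) (pr : Prime p) where

  instance
    p≢0 : ℕ.NonZero p
    p≢0 = prime⇒nonZero pr

  Null : ℤ → Set
  Null a = + p ∣ a

  null? : ∀ a → Dec (Null a)
  null? a = + p ∣? a

  null-0 : Null (+ 0)
  null-0 = divides (+ 0) refl

  null-+ : ∀ {a b} → Null a → Null b → Null (a + b)
  null-+ = ∣m∣n⇒∣m+n

  null-- : ∀ {a b} → Null a → Null b → Null (a - b)
  null-- = ∣m∣n⇒∣m-n

  null-neg : ∀ {a} → Null a → Null (- a)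
  null-neg = ∣m⇒∣-m

  null-* : ∀ k {a} → Null a → Null (k * a)
  null-* = ∣n⇒∣m*n

  null-≡ : ∀ {a b} → a ≡ b → Null b → Null a
  null-≡ eq = subst Null (sym eq)

  null-p : Null (+ p)
  null-p = divides (+ 1) (sym (ℤₚ.*-identityˡ (+ p)))

  null-product : ∀ a b → Null (a * b) → Null a ⊎ Null b
  null-product a b h with euclidsLemma ℤ.∣ a ∣ ℤ.∣ b ∣ pr (subst (p ℕᵈ.∣_) (ℤₚ.abs-* a b) (∣⇒∣ᵤ h))
  ... | inj₁ x = inj₁ (∣ᵤ⇒∣ x)
  ... | inj₂ y = inj₂ (∣ᵤ⇒∣ y)

  null-cancelˡ : ∀ a b → ¬ Null a → Null (a * b) → Null b
  null-cancelˡ a b na h with null-product a b h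
  ... | inj₁ x = ⊥-elim (na x)
  ... | inj₂ y = y

  ¬null-* : ∀ {a b} → ¬ Null a → ¬ Null b → ¬ Null (a * b)
  ¬null-* {a} {b} na nb h with null-product a b h
  ... | inj₁ x = na x
  ... | inj₂ y = nb y

  ¬null-small : ∀ k → 1 ≤ k → k < p → ¬ Null (+ k)
  ¬null-small (suc k) _ k<p h = <⇒≱ k<p (ℕᵈ.∣⇒≤ (∣⇒∣ᵤ h))

  coprime-p : ∀ n → ¬ (p ℕᵈ.∣ n) → Coprime p n
  coprime-p n h (d∣p , d∣n) with prime⇒irreducible pr d∣p
  ... | inj₁ d≡1 = d≡1
  ... | inj₂ refl = ⊥-elim (h d∣n)

  private
    eq⁺ : ∀ y q → + (1 ℕ.+ y ℕ.* q) ≡ + 1 + + y * + q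
    eq⁺ y q = trans (ℤₚ.pos-+ 1 (y ℕ.* q)) (cong (λ z → + 1 + z) (ℤₚ.pos-* y q))

    inverse-ℕ : ∀ n → ¬ (p ℕᵈ.∣ n) → ∃ λ b → Null (+ n * b - + 1)
    inverse-ℕ n h with coprime-Bézout (coprime-p n h)
    ... | Bézout.+- x y eq = - + y , divides (- + x) (lem (trans (sym (eq⁺ y n)) (trans (cong +_ eq) (ℤₚ.pos-* x p))))
      where
      lem : + 1 + + y * + n ≡ + x * + p → + n * (- + y) - + 1 ≡ - + x * + p
      lem e = trans (l1 (+ n) (+ y)) (trans (cong -_ e) (l2 (+ x) (+ p)))
        where
        l1 : ∀ n y → n * (- y) - + 1 ≡ - (+ 1 + y * n)
        l1 = solve-∀
        l2 : ∀ x q → - (x * q) ≡ - x * q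
        l2 = solve-∀
    ... | Bézout.-+ x y eq = + y , divides (+ x) (lem (trans (sym (eq⁺ x p)) (trans (cong +_ eq) (ℤₚ.pos-* y n))))
      where
      lem : + 1 + + x * + p ≡ + y * + n → + n * + y - + 1 ≡ + x * + p
      lem e = trans (l1 (+ n) (+ y)) (trans (cong (_- + 1) (sym e)) (l2 (+ x) (+ p)))
        where
        l1 : ∀ n y → n * y - + 1 ≡ y * n - + 1
        l1 = solve-∀
        l2 : ∀ x q → + 1 + x * q - + 1 ≡ x * q
        l2 = solve-∀

  inverse : ∀ a → ¬ Null a → ∃ λ b → Null (a * b - + 1)
  inverse (+ n) h = inverse-ℕ n (λ d → h (∣ᵤ⇒∣ d))
  inverse -[1+ n ] h with inverse-ℕ (suc n) (λ d → h (∣ᵤ⇒∣ d))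
  ... | b , e = - b , null-≡ (lem (+ suc n) b) e
    where
    lem : ∀ m b → (- m) * (- b) - + 1 ≡ m * b - + 1
    lem = solve-∀

  opaque
    divide : ∀ a b → ¬ Null a → ∃ λ x → Null (a * x - b)
    divide a b h with inverse a h
    ... | i , e = i * b , null-≡ (lem a b i) (null-* b e)
      where
      lem : ∀ a b i → a * (i * b) - b ≡ b * (a * i - + 1)
      lem = solve-∀

  residue-null : ∀ a → Null (a - + (a %ℕ p))
  residue-null a = divides (a /ℕ p) (trans (cong (_- + (a %ℕ p)) (a≡a%ℕn+[a/ℕn]*n a p)) (lem (+ (a %ℕ p)) ((a /ℕ p) * + p)))
    where
    lem : ∀ r q → r + q - r ≡ q
    lem = solve-∀

  -- Replacing values by congruent ones in expressions as large as `conicᵖ` would need a long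
  -- calculation each time; on reflected syntax it is one induction, and `evalMod7` can evaluate the
  -- same expressions.
  ⟦⟧-cong : ∀ {n} (e : Poly n) {ρ σ : Fin n → ℤ} → (∀ i → Null (ρ i - σ i)) → Null (⟦ e ⟧ ρ - ⟦ e ⟧ σ)
  ⟦⟧-cong (var i) h = h i
  ⟦⟧-cong (con k) h = null-≡ (ℤₚ.+-inverseʳ k) null-0
  ⟦⟧-cong (a ⊞ b) {ρ} {σ} h = null-≡ (lem (⟦ a ⟧ ρ) (⟦ b ⟧ ρ) (⟦ a ⟧ σ) (⟦ b ⟧ σ)) (null-+ (⟦⟧-cong a h) (⟦⟧-cong b h))
    where
    lem : ∀ x y z w → (x + y) - (z + w) ≡ (x - z) + (y - w)
    lem = solve-∀
  ⟦⟧-cong (a ⊟ b) {ρ} {σ} h = null-≡ (lem (⟦ a ⟧ ρ) (⟦ b ⟧ ρ) (⟦ a ⟧ σ) (⟦ b ⟧ σ)) (null-- (⟦⟧-cong a h) (⟦⟧-cong b h))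
    where
    lem : ∀ x y z w → (x - y) - (z - w) ≡ (x - z) - (y - w)
    lem = solve-∀
  ⟦⟧-cong (a ⊠ b) {ρ} {σ} h = null-≡ (lem (⟦ a ⟧ ρ) (⟦ b ⟧ ρ) (⟦ a ⟧ σ) (⟦ b ⟧ σ)) (null-+ (null-* (⟦ b ⟧ ρ) (⟦⟧-cong a h)) (null-* (⟦ a ⟧ σ) (⟦⟧-cong b h)))
    where
    lem : ∀ x y z w → (x * y) - (z * w) ≡ y * (x - z) + z * (y - w)
    lem = solve-∀

  ⟦⟧-null : ∀ {n} (e : Poly n) {ρ σ : Fin n → ℤ} → (∀ i → Null (ρ i - σ i)) → Null (⟦ e ⟧ σ) → Null (⟦ e ⟧ ρ)
  ⟦⟧-null e {ρ} {σ} h z = null-≡ (lem (⟦ e ⟧ ρ) (⟦ e ⟧ σ)) (null-+ (⟦⟧-cong e h) z)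
    where
    lem : ∀ x y → x ≡ (x - y) + y
    lem = solve-∀

-- Degree by iterated differences, and alternating sums over subsequences

record Lattice : Set₁ where
  infixl 6 _⊕_
  field
    A      : Set
    _⊕_    : A → A → A
    ε      : A
    assoc  : ∀ x y z → (x ⊕ y) ⊕ z ≡ x ⊕ (y ⊕ z)
    comm   : ∀ x y → x ⊕ y ≡ y ⊕ x
    idʳ    : ∀ x → x ⊕ ε ≡ x

module Differences (L : Lattice) where
  open Lattice L

  Δ : A → (A → ℤ) → A → ℤ
  Δ h f x = f (x ⊕ h) - f x

  -- Deg< n f says that every n-fold difference of f vanishes, i.e. that f has degree less than n.
  data Deg< : ℕ → (A → ℤ) → Set where
    zero : ∀ {f} → (∀ x → f x ≡ + 0) → Deg< 0 f
    step : ∀ {n f} → (∀ h → Deg< n (Δ h f)) → Deg< (suc n) f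

  deg-vanish : ∀ {f} → Deg< 0 f → ∀ x → f x ≡ + 0
  deg-vanish (zero z) = z

  deg-Δ : ∀ {n f} → Deg< (suc n) f → ∀ h → Deg< n (Δ h f)
  deg-Δ (step d) = d

  deg-ext : ∀ {n f g} → (∀ x → f x ≡ g x) → Deg< n f → Deg< n g
  deg-ext e (zero z) = zero λ x → trans (sym (e x)) (z x)
  deg-ext e (step d) = step λ h → deg-ext (λ x → cong₂ _-_ (e (x ⊕ h)) (e x)) (d h)

  deg-0 : ∀ n {f} → (∀ x → f x ≡ + 0) → Deg< n f
  deg-0 zero    z = zero z
  deg-0 (suc n) z = step λ h → deg-0 n (λ x → cong₂ _-_ (z (x ⊕ h)) (z x))

  deg-≤ : ∀ {m n f} → m ≤ n → Deg< m f → Deg< n f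
  deg-≤ {n = n} z≤n (zero z) = deg-0 n z
  deg-≤ (s≤s m≤n) (step d) = step λ h → deg-≤ m≤n (d h)

  deg-+ : ∀ {n f g} → Deg< n f → Deg< n g → Deg< n (λ x → f x + g x)
  deg-+ (zero z) (zero z′) = zero λ x → cong₂ _+_ (z x) (z′ x)
  deg-+ {f = f} {g} (step d) (step d′) =
    step λ h → deg-ext (λ x → lem (f (x ⊕ h)) (f x) (g (x ⊕ h)) (g x)) (deg-+ (d h) (d′ h))
    where
    lem : ∀ a b c d → (a - b) + (c - d) ≡ (a + c) - (b + d)
    lem = solve-∀

  deg-neg : ∀ {n f} → Deg< n f → Deg< n (λ x → - f x)
  deg-neg (zero z) = zero λ x → cong -_ (z x)
  deg-neg {f = f} (step d) = step λ h → deg-ext (λ x → lem (f (x ⊕ h)) (f x)) (deg-neg (d h))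
    where
    lem : ∀ a b → - (a - b) ≡ - a - - b
    lem = solve-∀

  deg-shift : ∀ {n f} a → Deg< n f → Deg< n (λ x → f (x ⊕ a))
  deg-shift a (zero z) = zero λ x → z (x ⊕ a)
  deg-shift {f = f} a (step d) = step λ h → deg-ext (λ x → cong (λ y → f y - f (x ⊕ a)) (lem h x)) (deg-shift a (d h))
    where
    lem : ∀ h x → (x ⊕ a) ⊕ h ≡ (x ⊕ h) ⊕ a
    lem h x = trans (assoc x a h) (trans (cong (x ⊕_) (comm a h)) (sym (assoc x h a)))

  -- Leibniz rule: Δ h (f g) is (Δ h f) times the shift of g, plus f times (Δ h g). Each summand
  -- lowers one of the two degrees, and the difference of a factor of degree 0 vanishes.
  deg-* : ∀ m n {f g} → Deg< (suc m) f → Deg< (suc n) g → Deg< (suc (m ℕ.+ n)) (λ x → f x * g x)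
  deg-* m n {f} {g} df dg =
    step λ h → deg-ext (λ x → lem (f (x ⊕ h)) (f x) (g (x ⊕ h)) (g x)) (deg-+ (left m df h) (right n dg h))
    where
    lem : ∀ a b c d → (a - b) * c + b * (c - d) ≡ a * c - b * d
    lem = solve-∀
    left : ∀ m → Deg< (suc m) f → ∀ h → Deg< (m ℕ.+ n) (λ x → Δ h f x * g (x ⊕ h))
    left zero    df h = deg-0 n (λ x → cong (_* g (x ⊕ h)) (deg-vanish (deg-Δ df h) x))
    left (suc m) df h = deg-* m n (deg-Δ df h) (deg-shift h dg)
    right : ∀ n → Deg< (suc n) g → ∀ h → Deg< (m ℕ.+ n) (λ x → f x * Δ h g x)
    right zero    dg h = deg-0 (m ℕ.+ 0) (λ x → trans (cong (f x *_) (deg-vanish (deg-Δ dg h) x)) (ℤₚ.*-zeroʳ (f x)))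
    right (suc n) dg h = subst (λ k → Deg< k (λ x → f x * Δ h g x)) (sym (+-suc m n)) (deg-* m n df (deg-Δ dg h))

  Additive : (A → ℤ) → Set
  Additive π = ∀ x y → π (x ⊕ y) ≡ π x + π y

  deg-linear : ∀ π c → Additive π → Deg< 2 (λ x → π x - c)
  deg-linear π c add = step λ h → step λ k → zero λ x → trans
    (cong₂ _-_ (cong₂ (λ u v → (u - c) - (v - c)) (trans (add (x ⊕ k) h) (cong (_+ π h) (add x k))) (add x k))
               (cong (λ u → (u - c) - (π x - c)) (add x h)))
    (lem (π x) (π k) (π h) c)
    where
    lem : ∀ x k h c → ((x + k + h) - c - (x + k - c)) - ((x + h) - c - (x - c)) ≡ + 0
    lem = solve-∀

  deg-1 : Deg< 1 (λ _ → + 1)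
  deg-1 = step λ h → zero λ x → refl

  module Sums {X : Set} (w : X → A) where

    ∑ : List X → A
    ∑ []       = ε
    ∑ (x ∷ xs) = w x ⊕ ∑ xs

    ∑-++ : ∀ xs ys → ∑ (xs ++ ys) ≡ ∑ xs ⊕ ∑ ys
    ∑-++ []       ys = trans (sym (idʳ _)) (comm _ _)
    ∑-++ (x ∷ xs) ys = trans (cong (w x ⊕_) (∑-++ xs ys)) (sym (assoc _ _ _))

    ∑-↭ : ∀ {xs ys} → xs ↭ ys → ∑ xs ≡ ∑ ys
    ∑-↭ _↭_.refl        = refl
    ∑-↭ (prep x r)      = cong (w x ⊕_) (∑-↭ r)
    ∑-↭ (swap x y r) = trans (sym (assoc _ _ _)) (trans (cong₂ _⊕_ (comm _ _) (∑-↭ r)) (assoc _ _ _))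
    ∑-↭ (_↭_.trans r s) = trans (∑-↭ r) (∑-↭ s)

    -- The sum of (-1)^|B| F (y + ∑ B) over all subsequences B of T. Written recursively, each term
    -- x of T applies the negated difference in direction `w x`, so it costs one degree.
    altSum : (A → ℤ) → List X → A → ℤ
    altSum F []      y = F y
    altSum F (x ∷ T) y = altSum F T y - altSum F T (y ⊕ w x)

    altSum-deg : ∀ n T {F} → Deg< (length T ℕ.+ n) F → Deg< n (altSum F T)
    altSum-deg n []      d = d
    altSum-deg n (x ∷ T) {F} d =
      deg-ext (λ y → lem (altSum F T (y ⊕ w x)) (altSum F T y))
        (deg-neg (deg-Δ (altSum-deg (suc n) T (subst (λ k → Deg< k F) (sym (+-suc (length T) n)) d)) (w x)))
      where
      lem : ∀ a b → - (a - b) ≡ b - a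
      lem = solve-∀

    module _ (p : ℕ) (pr : Prime p) where
      open Residues p pr

      -- A vanishing alternating sum cannot have a single non-vanishing term.
      find : ∀ F T y → Null (altSum F T y) ⊎ ∃₂ λ B R → T ↭ B ++ R × ¬ Null (F (y ⊕ ∑ B))
      find F []      y with null? (F y)
      ... | yes z = inj₁ z
      ... | no nz = inj₂ ([] , [] , ↭-refl , λ z → nz (subst (λ v → Null (F v)) (idʳ y) z))
      find F (x ∷ T) y with find F T y | find F T (y ⊕ w x)
      ... | inj₂ (B , R , r , nz) | _ = inj₂ (B , x ∷ R , ↭-trans (prep x r) (↭-sym (shift x B R)) , nz)
      ... | inj₁ _ | inj₂ (B , R , r , nz) = inj₂ (x ∷ B , R , prep x r , λ z → nz (subst (λ v → Null (F v)) (sym (assoc _ _ _)) z))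
      ... | inj₁ z | inj₁ z′ = inj₁ (null-- z z′)

      -- The empty subsequence always contributes F y, so it is set apart: when F detects zero sums,
      -- any other non-zero contribution is a non-empty zero-sum subsequence.
      find⁺ : ∀ F T y → Null (altSum F T y - F y) ⊎ ∃₂ λ b B → ∃ λ R → T ↭ (b ∷ B) ++ R × ¬ Null (F (y ⊕ ∑ (b ∷ B)))
      find⁺ F []      y = inj₁ (null-≡ (ℤₚ.+-inverseʳ (F y)) null-0)
      find⁺ F (x ∷ T) y with find⁺ F T y | find F T (y ⊕ w x)
      ... | inj₂ (b , B , R , r , nz) | _ = inj₂ (b , B , x ∷ R , ↭-trans (prep x r) (↭-sym (shift x (b ∷ B) R)) , nz)
      ... | inj₁ _ | inj₂ (B , R , r , nz) = inj₂ (x , B , R , prep x r , λ z → nz (subst (λ v → Null (F v)) (sym (assoc _ _ _)) z))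
      ... | inj₁ z | inj₁ z′ = inj₁ (null-≡ (lem (altSum F T y) (altSum F T (y ⊕ w x)) (F y)) (null-- z z′))
        where
        lem : ∀ a b c → (a - b) - c ≡ (a - c) - b
        lem = solve-∀

-- The polynomial that detects multiples of p

falling : ℕ → ℤ → ℤ
falling zero    v = + 1
falling (suc k) v = (v - + suc k) * falling k v

module Falling (p : ℕ) (pr : Prime p) where
  open Residues p pr

  falling-null : ∀ k c {v} → 1 ≤ c → c ≤ k → Null (v - + c) → Null (falling k v)
  falling-null zero    (suc c) _ () h
  falling-null (suc k) c {v} 1≤c c≤k h with c ℕ.≟ suc k
  ... | yes refl = null-≡ (ℤₚ.*-comm (v - + suc k) (falling k v)) (null-* (falling k v) h)
  ... | no  c≢ = null-* (v - + suc k) (falling-null k c 1≤c (s≤s⁻¹ (≤∧≢⇒< c≤k c≢)) h)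

  falling-¬null : ∀ k {v} → k < p → Null v → ¬ Null (falling k v)
  falling-¬null zero    1<p zv = ¬null-small 1 ≤-refl (ℕ.nonTrivial⇒n>1 p)
    where instance _ = prime⇒nonTrivial pr
  falling-¬null (suc k) {v} k<p zv = ¬null-* (λ z → ¬null-small (suc k) (s≤s z≤n) k<p (null-≡ (lem v (+ suc k)) (null-- zv z)))
                                             (falling-¬null k (<-trans (n<1+n k) k<p) zv)
    where
    lem : ∀ v k → k ≡ v - (v - k)
    lem = solve-∀

  -- Congruent to v^(p-1) - 1. As a product of linear factors its degree p - 1 comes directly from
  -- `deg-*`.
  indicator : ℤ → ℤ
  indicator = falling (pred p)

  indicator-null : ∀ v → ¬ Null v → Null (indicator v)
  indicator-null v nv with v %ℕ p | n%ℕd<d v p | residue-null v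
  ... | zero  | _   | z = ⊥-elim (nv (null-≡ (sym (ℤₚ.+-identityʳ v)) z))
  ... | suc c | c<p | z = falling-null (pred p) (suc c) (s≤s z≤n) (s≤s⁻¹ (subst (suc c <_) (sym (suc-pred p)) c<p)) z

  indicator-¬null : ∀ v → Null v → ¬ Null (indicator v)
  indicator-¬null v = falling-¬null (pred p) (≤-reflexive (suc-pred p))

  module _ (L : Lattice) where
    open Lattice L
    open Differences L

    deg-falling : ∀ k π → Additive π → Deg< (suc k) (λ x → falling k (π x))
    deg-falling zero    π add = deg-1
    deg-falling (suc k) π add = deg-* 1 k (deg-linear π (+ suc k) add) (deg-falling k π add)

-- Zero-sum subsequences in the plane

Pt : Set
Pt = ℤ × ℤ

plane : Lattice
plane = record
  { A = Pt
  ; _⊕_ = λ { (a , b) (c , d) → a + c , b + d }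
  ; ε = + 0 , + 0
  ; assoc = λ { (a , b) (c , d) (e , f) → cong₂ _,_ (ℤₚ.+-assoc a c e) (ℤₚ.+-assoc b d f) }
  ; comm = λ { (a , b) (c , d) → cong₂ _,_ (ℤₚ.+-comm a c) (ℤₚ.+-comm b d) }
  ; idʳ = λ { (a , b) → cong₂ _,_ (ℤₚ.+-identityʳ a) (ℤₚ.+-identityʳ b) }
  }

-- The third coordinate records the length of a subsequence.
graded : Lattice
graded = record
  { A = Pt × ℤ
  ; _⊕_ = λ { (a , b) (c , d) → a P.⊕ c , b + d }
  ; ε = P.ε , + 0
  ; assoc = λ { (a , b) (c , d) (e , f) → cong₂ _,_ (P.assoc a c e) (ℤₚ.+-assoc b d f) }
  ; comm = λ { (a , b) (c , d) → cong₂ _,_ (P.comm a c) (ℤₚ.+-comm b d) }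
  ; idʳ = λ { (a , b) → cong₂ _,_ (P.idʳ a) (ℤₚ.+-identityʳ b) }
  }
  where module P = Lattice plane

open Lattice plane using (_⊕_; ε) renaming (assoc to ⊕-assoc; comm to ⊕-comm; idʳ to ⊕-idʳ) public
open Differences plane public
open Sums {Pt} id public

⊕-idˡ : ∀ v → ε ⊕ v ≡ v
⊕-idˡ v = trans (⊕-comm ε v) (⊕-idʳ v)

⊑-trans : ∀ {X : Set} {L M : List X} R N K → L ↭ M ++ R → M ↭ N ++ K → L ↭ N ++ (K ++ R)
⊑-trans R N K r s = ↭-trans r (↭-trans (++⁺ʳ R s) (↭-reflexive (Listₚ.++-assoc N K R)))

module PlaneSums (p : ℕ) (pr : Prime p) where
  open Residues p pr
  open Falling p pr

  ZeroSum : List Pt → Set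
  ZeroSum B = Null (proj₁ (∑ B)) × Null (proj₂ (∑ B))

  Short : List Pt → Set
  Short T = ∃₂ λ B R → T ↭ B ++ R × 1 ≤ length B × length B ≤ p × ZeroSum B

  short-⊑ : ∀ {T B R} → T ↭ B ++ R → Short B → Short T
  short-⊑ {T} {B} {R} r (C , R′ , r′ , h) =
    C , R′ ++ R , ⊑-trans R C R′ r r′ , h

  zeroSum-↭ : ∀ {B C} → B ↭ C → ZeroSum B → ZeroSum C
  zeroSum-↭ r = subst (λ v → Null (proj₁ v) × Null (proj₂ v)) (∑-↭ r)

  zeroSum-drop : ∀ B R → ZeroSum (B ++ R) → ZeroSum B → ZeroSum R
  zeroSum-drop B R (z , z′) (y , y′) =
    null-≡ (lem (proj₁ (∑ B)) (proj₁ (∑ R))) (null-- (subst Null (cong proj₁ (∑-++ B R)) z) y) ,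
    null-≡ (lem (proj₂ (∑ B)) (proj₂ (∑ R))) (null-- (subst Null (cong proj₂ (∑-++ B R)) z′) y′)
    where
    lem : ∀ a b → b ≡ a + b - a
    lem = solve-∀

  halve : ∀ m n → m ℕ.+ n ≤ 2 ℕ.* p → m ≤ p ⊎ n ≤ p
  halve m n h with m ≤? p
  ... | yes m≤p = inj₁ m≤p
  ... | no m≰p = inj₂ (<⇒≤ (+-cancelˡ-< p n p (<-≤-trans (+-monoˡ-< n (≰⇒> m≰p))
                     (≤-trans h (≤-reflexive (cong (p ℕ.+_) (+-identityʳ p)))))))

  -- The complement of B also has sum zero, and of at most 2p terms one of the two parts has at most
  -- p.
  short-split : ∀ {T} B R → T ↭ B ++ R → ZeroSum T → ZeroSum B → 1 ≤ length B → 1 ≤ length R → length T ≤ 2 ℕ.* p → Short T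
  short-split {T} B R r zT zB 1≤B 1≤R h
    with halve (length B) (length R) (≤-trans (≤-reflexive (sym (trans (↭-length r) (Listₚ.length-++ B)))) h)
  ... | inj₁ B≤p = B , R , r , 1≤B , B≤p , zB
  ... | inj₂ R≤p = R , B , ↭-trans r (++-comm B R) , 1≤R , R≤p , zeroSum-drop B R (zeroSum-↭ r zT) zB

  F₂ : Pt → ℤ
  F₂ v = indicator (proj₁ v) * indicator (proj₂ v)

  F₂-¬null : ∀ {v} → ¬ Null (F₂ v) → Null (proj₁ v) × Null (proj₂ v)
  F₂-¬null {a , b} h with null? a | null? b
  ... | yes za | yes zb = za , zb
  ... | no  na | _      = ⊥-elim (h (null-≡ (ℤₚ.*-comm (indicator a) (indicator b)) (null-* (indicator b) (indicator-null a na))))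
  ... | yes _  | no  nb = ⊥-elim (h (null-* (indicator a) (indicator-null b nb)))

  ¬null-F₂ : ∀ {v} → Null (proj₁ v) → Null (proj₂ v) → ¬ Null (F₂ v)
  ¬null-F₂ {a , b} za zb = ¬null-* (indicator-¬null a za) (indicator-¬null b zb)

  private
    q = pred p
    1+q : suc q ≡ p
    1+q = suc-pred p

  F₂-deg : ∀ n → suc n ≡ 2 ℕ.* p → Deg< n F₂
  F₂-deg n e = subst (λ k → Deg< k F₂) (suc-injective (trans lem (sym e)))
    (deg-* q q (deg-falling plane q proj₁ (λ _ _ → refl)) (deg-falling plane q proj₂ (λ _ _ → refl)))
    where
    lem : suc (suc (q ℕ.+ q)) ≡ 2 ℕ.* p
    lem = trans (cong suc (sym (+-suc q q))) (trans (cong₂ ℕ._+_ 1+q 1+q) (cong (p ℕ.+_) (sym (+-identityʳ p))))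

  open Differences graded using () renaming (Deg< to Deg₃<; deg-* to deg₃-*; deg-vanish to deg₃-vanish; deg-Δ to deg₃-Δ)
  private
    module G = Differences.Sums graded {Pt} (λ x → x , + 1)

  ∑-graded : ∀ B → G.∑ B ≡ (∑ B , + length B)
  ∑-graded []      = refl
  ∑-graded (x ∷ B) = cong (λ v → (x ⊕ proj₁ v) , (+ 1 + proj₂ v)) (∑-graded B)

  F₃ : Pt × ℤ → ℤ
  F₃ (v , l) = F₂ v * indicator l

  F₃-¬null : ∀ {v l} → ¬ Null (F₃ (v , l)) → (Null (proj₁ v) × Null (proj₂ v)) × Null l
  F₃-¬null {v} {l} h with null? l
  ... | no nl = ⊥-elim (h (null-* (F₂ v) (indicator-null l nl)))
  ... | yes zl with null? (F₂ v)
  ...   | yes z = ⊥-elim (h (null-≡ (ℤₚ.*-comm (F₂ v) (indicator l)) (null-* (indicator l) z)))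
  ...   | no nz = F₂-¬null nz , zl

  F₃-deg : ∀ n → 2 ℕ.+ n ≡ 3 ℕ.* p → Deg₃< n F₃
  F₃-deg n e = subst (λ k → Deg₃< k F₃) (suc-injective (suc-injective (trans lem (sym e))))
    (deg₃-* (q ℕ.+ q) q
      (deg₃-* q q (deg-falling graded q (λ x → proj₁ (proj₁ x)) (λ _ _ → refl)) (deg-falling graded q (λ x → proj₂ (proj₁ x)) (λ _ _ → refl)))
      (deg-falling graded q proj₂ (λ _ _ → refl)))
    where
    lem : suc (suc (suc ((q ℕ.+ q) ℕ.+ q))) ≡ 3 ℕ.* p
    lem = trans (arith q) (cong (3 ℕ.*_) 1+q)
      where
      arith : ∀ q → suc (suc (suc ((q ℕ.+ q) ℕ.+ q))) ≡ 3 ℕ.* suc q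
      arith = solveℕ

  -- The upper bound 2p - 1 for the Davenport constant of ℤ_p²: `F₂` has degree 2p - 2, less than
  -- the number of terms, so the alternating sum is 0 and the empty subsequence cannot be its only
  -- non-zero contribution.
  zeroSum-exists : ∀ T → 2 ℕ.* p ≤ suc (length T) → ∃₂ λ b B → ∃ λ R → T ↭ (b ∷ B) ++ R × ZeroSum (b ∷ B)
  zeroSum-exists T h with find⁺ p pr F₂ T ε
  ... | inj₂ (b , B , R , r , nz) = b , B , R , r , F₂-¬null (λ z → nz (subst (λ v → Null (F₂ v)) (sym (⊕-idˡ (∑ (b ∷ B)))) z))
  ... | inj₁ z = ⊥-elim (¬null-F₂ null-0 null-0 (null-≡ (lem (altSum F₂ T ε) (F₂ ε)) (null-- (null-≡ (deg-vanish vanish ε) null-0) z)))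
    where
    lem : ∀ a b → b ≡ a - (a - b)
    lem = solve-∀
    vanish : Deg< 0 (altSum F₂ T)
    vanish = altSum-deg 0 T (deg-≤ (≤-trans (s≤s⁻¹ (≤-trans (≤-reflexive e) h)) (m≤m+n _ 0)) (F₂-deg (pred (2 ℕ.* p)) e))
      where
      instance _ = m*n≢0 2 p
      e : suc (pred (2 ℕ.* p)) ≡ 2 ℕ.* p
      e = suc-pred (2 ℕ.* p)

  -- Without one of its terms B still has 2p - 1, enough for `zeroSum-exists`. The part found misses
  -- that term, so its complement is non-empty.
  short-2p : ∀ B → ZeroSum B → length B ≡ 2 ℕ.* p → Short B
  short-2p []      z e = ⊥-elim (0≢1+n (trans e (cong (2 ℕ.*_) (sym 1+q))))
  short-2p (b ∷ B) z e with zeroSum-exists B (≤-reflexive (sym e))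
  ... | c , C , R , r , zC = short-split (c ∷ C) (b ∷ R) (↭-trans (prep b r) (↭-sym (shift b (c ∷ C) R))) z zC (s≤s z≤n) (s≤s z≤n) (≤-reflexive e)

  multiples : ∀ n → Null (+ n) → 1 ≤ n → n < 3 ℕ.* p → n ≡ p ⊎ n ≡ 2 ℕ.* p
  multiples n z 1≤n n<3p with ∣⇒∣ᵤ z
  ... | ℕᵈ.divides zero e = ⊥-elim (<⇒≢ 1≤n (sym e))
  ... | ℕᵈ.divides (suc zero) e = inj₁ (trans e (+-identityʳ p))
  ... | ℕᵈ.divides (suc (suc zero)) e = inj₂ e
  ... | ℕᵈ.divides (suc (suc (suc k))) e = ⊥-elim (<⇒≱ n<3p (≤-trans (*-monoˡ-≤ p (m≤m+n 3 k)) (≤-reflexive (sym e))))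

  private
    1≤p : 1 ≤ p
    1≤p = ≤-trans (s≤s z≤n) (≤-reflexive 1+q)

    short-multiple : ∀ {T} b B R → T ↭ (b ∷ B) ++ R → length T < 3 ℕ.* p → ZeroSum (b ∷ B) → Null (+ length (b ∷ B)) → Short T
    short-multiple {T} b B R r h zB zl with multiples (length (b ∷ B)) zl (s≤s z≤n)
      (≤-<-trans (≤-trans (m≤m+n _ (length R)) (≤-reflexive (sym (trans (↭-length r) (Listₚ.length-++ (b ∷ B)))))) h)
    ... | inj₁ e = b ∷ B , R , r , s≤s z≤n , ≤-reflexive e , zB
    ... | inj₂ e = short-⊑ r (short-2p (b ∷ B) zB e)

    F₃0 : ¬ Null (F₃ (ε , + 0))
    F₃0 = ¬null-* (¬null-F₂ null-0 null-0) (indicator-¬null (+ 0) null-0)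

    graded-zeroSum : ∀ B l → ¬ Null (F₃ (Lattice._⊕_ graded (ε , l) (G.∑ B))) → ZeroSum B × Null (l + + length B)
    graded-zeroSum B l nz = F₃-¬null (λ z → nz (subst (λ v → Null (F₃ v)) (sym lem) z))
      where
      lem : Lattice._⊕_ graded (ε , l) (G.∑ B) ≡ (∑ B , l + + length B)
      lem = trans (cong (Lattice._⊕_ graded (ε , l)) (∑-graded B)) (cong (_, l + + length B) (⊕-idˡ (∑ B)))

    -- The coordinate that counts terms lets `F₃`, of degree 3p - 3, detect subsequences whose sum
    -- is zero and whose length is divisible by p. Below 3p this length is p, or 2p, and then
    -- `short-2p` cuts the subsequence.
    η-exact : ∀ T → 2 ℕ.+ length T ≡ 3 ℕ.* p → Short T
    η-exact T e with G.find⁺ p pr F₃ T (ε , + 0)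
    ... | inj₂ (b , B , R , r , nz) with graded-zeroSum (b ∷ B) (+ 0) nz
    ...   | zB , zl = short-multiple b B R r (≤-trans (n≤1+n _) (≤-reflexive e)) zB zl
    η-exact T e | inj₁ z = ⊥-elim (F₃0 (null-≡ (lem (G.altSum F₃ T (ε , + 0)) (F₃ (ε , + 0))) (null-- (null-≡ (deg₃-vanish vanish (ε , + 0)) null-0) z)))
      where
      lem : ∀ a b → b ≡ a - (a - b)
      lem = solve-∀
      vanish : Deg₃< 0 (G.altSum F₃ T)
      vanish = G.altSum-deg 0 T (F₃-deg (length T ℕ.+ 0) (trans (cong (2 ℕ.+_) (+-identityʳ (length T))) e))

  take-⊑ : ∀ n (T : List Pt) → T ↭ take n T ++ drop n T
  take-⊑ n T = ↭-reflexive (sym (Listₚ.take++drop≡id n T))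

  η-plane : ∀ T → 3 ℕ.* p ≤ 2 ℕ.+ length T → Short T
  η-plane T h = short-⊑ (take-⊑ n T) (η-exact (take n T) (trans (cong (2 ℕ.+_) (trans (Listₚ.length-take n T) (m≤n⇒m⊓n≡m n≤T))) 2+n))
    where
    n = 3 ℕ.* p ∸ 2
    2+n : 2 ℕ.+ n ≡ 3 ℕ.* p
    2+n = m+[n∸m]≡n (≤-trans (≤-trans (n≤1+n 2) (≤-reflexive refl)) (*-monoʳ-≤ 3 1≤p))
    n≤T : n ≤ length T
    n≤T = +-cancelˡ-≤ 2 n (length T) (≤-trans (≤-reflexive 2+n) h)

  -- With one element less, the alternating sum is constant, and comparing its values at (0,0) and (0,1)
  -- produces a zero-sum subsequence of length -1 modulo p.
  long-zeroSum : ∀ T → 3 ℕ.+ length T ≡ 3 ℕ.* p → ¬ Short T → ∃₂ λ U R → T ↭ U ++ R × suc (length U) ≡ 2 ℕ.* p × ZeroSum U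
  long-zeroSum T e ns with G.find⁺ p pr F₃ T (ε , + 0) | G.find p pr F₃ T (ε , + 1)
  ... | inj₂ (b , B , R , r , nz) | _ with graded-zeroSum (b ∷ B) (+ 0) nz
  ...   | zB , zl = ⊥-elim (ns (short-multiple b B R r (≤-trans (m≤n+m _ 2) (≤-reflexive e)) zB zl))
  long-zeroSum T e ns | inj₁ z | inj₁ z′ = ⊥-elim (F₃0 (null-≡ (lem (G.altSum F₃ T (ε , + 1)) (G.altSum F₃ T (ε , + 0)) (F₃ (ε , + 0)))
      (null-- (null-- z′ (null-≡ (deg₃-vanish (deg₃-Δ vanish (ε , + 1)) (ε , + 0)) null-0)) z)))
    where
    lem : ∀ a b c → c ≡ (a - (a - b)) - (b - c)
    lem = solve-∀
    vanish : Deg₃< 1 (G.altSum F₃ T)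
    vanish = G.altSum-deg 1 T (F₃-deg (length T ℕ.+ 1) (trans (cong (2 ℕ.+_) (+-comm (length T) 1)) e))
  long-zeroSum T e ns | inj₁ z | inj₂ (B , R , r , nz) with graded-zeroSum B (+ 1) nz
  ... | zB , zl with multiples (suc (length B)) zl (s≤s z≤n)
                     (≤-trans (s≤s (s≤s (≤-trans (m≤m+n _ (length R)) (≤-reflexive (sym (trans (↭-length r) (Listₚ.length-++ B)))))))
                         (≤-trans (n≤1+n _) (≤-reflexive e)))
  ...   | inj₂ l≡ = B , R , r , l≡ , zB
  ...   | inj₁ l≡ = ⊥-elim (ns (B , R , r , 1≤B , ≤-trans (n≤1+n _) (≤-reflexive l≡) , zB))
    where
    1≤B : 1 ≤ length B
    1≤B = s≤s⁻¹ (≤-trans (ℕ.nonTrivial⇒n>1 p) (≤-reflexive (sym l≡)))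
      where instance _ = prime⇒nonTrivial pr

-- Determinants and additive functions on the plane

infixl 6 _⊖_
_⊖_ : Pt → Pt → Pt
(a , b) ⊖ (c , d) = a - c , b - d

opaque
  -- Opaque, so that later identities treat determinants as atoms instead of expanding them into
  -- coordinates.
  det : Pt → Pt → ℤ
  det (a , b) (c , d) = a * d - b * c

additive-multiple : (h : ℤ → ℤ) → (∀ a b → h (a + b) ≡ h a + h b) → ∀ a → h a ≡ a * h (+ 1)
additive-multiple h add = go
  where
  h0 : h (+ 0) ≡ + 0
  h0 = trans (lem (h (+ 0))) (trans (cong (_- h (+ 0)) (sym (add (+ 0) (+ 0)))) (ℤₚ.+-inverseʳ (h (+ 0))))
    where
    lem : ∀ x → x ≡ x + x - x
    lem = solve-∀
  nat : ∀ n → h (+ n) ≡ + n * h (+ 1)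
  nat zero    = h0
  nat (suc n) = trans (add (+ 1) (+ n)) (trans (cong (λ u → h (+ 1) + u) (nat n)) (lem (h (+ 1)) (+ n)))
    where
    lem : ∀ x n → x + n * x ≡ (+ 1 + n) * x
    lem = solve-∀
  go : ∀ a → h a ≡ a * h (+ 1)
  go (+ n) = nat n
  go -[1+ n ] = trans (lem (h -[1+ n ]) (h (+ suc n)) (trans (sym (add -[1+ n ] (+ suc n))) (trans (cong h (ℤₚ.+-inverseˡ (+ suc n))) h0)))
                (trans (cong -_ (nat (suc n))) (lem₂ (+ suc n) (h (+ 1))))
    where
    lem : ∀ x y → x + y ≡ + 0 → x ≡ - y
    lem x y e = trans (l x y) (trans (cong (_- y) e) (ℤₚ.+-identityˡ (- y)))
      where
      l : ∀ x y → x ≡ x + y - y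
      l = solve-∀
    lem₂ : ∀ n x → - (n * x) ≡ (- n) * x
    lem₂ = solve-∀

additive-coordinates : ∀ {g} → Additive g → ∀ a b → g (a , b) ≡ a * g (+ 1 , + 0) + b * g (+ 0 , + 1)
additive-coordinates {g} add a b =
  trans (cong g (cong₂ _,_ (sym (ℤₚ.+-identityʳ a)) (sym (ℤₚ.+-identityˡ b))))
    (trans (add (a , + 0) (+ 0 , b))
      (cong₂ _+_ (additive-multiple (λ a → g (a , + 0)) (λ a a′ → add (a , + 0) (a′ , + 0)) a)
                 (additive-multiple (λ b → g (+ 0 , b)) (λ b b′ → add (+ 0 , b) (+ 0 , b′)) b)))

record Relation₃ (k l m : ℤ) (x y z : Pt) : Set where
  constructor relation
  field
    first  : k * proj₁ x + l * proj₁ y + m * proj₁ z ≡ + 0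
    second : k * proj₂ x + l * proj₂ y + m * proj₂ z ≡ + 0

additive-relation : ∀ {g k l m x y z} → Additive g → Relation₃ k l m x y z → k * g x + l * g y + m * g z ≡ + 0
additive-relation {g} {k} {l} {m} {x} {y} {z} add (relation e e′) =
  trans (cong₂ _+_ (cong₂ _+_ (cong (k *_) (c x)) (cong (l *_) (c y))) (cong (m *_) (c z)))
    (trans (lem k l m (proj₁ x) (proj₂ x) (proj₁ y) (proj₂ y) (proj₁ z) (proj₂ z) G H)
      (trans (cong₂ (λ u v → u * G + v * H) e e′) (lem₂ G H)))
  where
  G = g (+ 1 , + 0)
  H = g (+ 0 , + 1)
  c : ∀ x → g x ≡ proj₁ x * G + proj₂ x * H
  c (a , b) = additive-coordinates add a b
  lem : ∀ k l m x x′ y y′ z z′ G H → k * (x * G + x′ * H) + l * (y * G + y′ * H) + m * (z * G + z′ * H)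
        ≡ (k * x + l * y + m * z) * G + (k * x′ + l * y′ + m * z′) * H
  lem = solve-∀
  lem₂ : ∀ G H → + 0 * G + + 0 * H ≡ + 0
  lem₂ = solve-∀

opaque
  unfolding det

  det-coordinates : ∀ x y → det x y ≡ proj₁ x * proj₂ y - proj₂ x * proj₁ y
  det-coordinates x y = refl

  cramer : ∀ x y z → Relation₃ (det y z) (det z x) (det x y) x y z
  cramer (a , b) (c , d) (e , f) = relation (l a b c d e f) (l′ a b c d e f)
    where
    l : ∀ a b c d e f → (c * f - d * e) * a + (e * b - f * a) * c + (a * d - b * c) * e ≡ + 0
    l = solve-∀
    l′ : ∀ a b c d e f → (c * f - d * e) * b + (e * b - f * a) * d + (a * d - b * c) * f ≡ + 0
    l′ = solve-∀

  cramer′ : ∀ x y m → Relation₃ (det x y) (- det m y) (det m x) m x y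
  cramer′ (a , b) (c , d) (e , f) = relation (l a b c d e f) (l′ a b c d e f)
    where
    l : ∀ a b c d e f → (a * d - b * c) * e + - (e * d - f * c) * a + (e * b - f * a) * c ≡ + 0
    l = solve-∀
    l′ : ∀ a b c d e f → (a * d - b * c) * f + - (e * d - f * c) * b + (e * b - f * a) * d ≡ + 0
    l′ = solve-∀

  det-anti : ∀ x y → det y x ≡ - det x y
  det-anti (a , b) (c , d) = lem a b c d
    where
    lem : ∀ a b c d → c * b - d * a ≡ - (a * d - b * c)
    lem = solve-∀

  det-⊕ : ∀ n x y → det n (x ⊕ y) ≡ det n x + det n y
  det-⊕ (a , b) (c , d) (e , f) = lem a b c d e f
    where
    lem : ∀ a b c d e f → a * (d + f) - b * (c + e) ≡ (a * d - b * c) + (a * f - b * e)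
    lem = solve-∀

  det-ε : ∀ n → det n ε ≡ + 0
  det-ε (a , b) = lem a b
    where
    lem : ∀ a b → a * + 0 - b * + 0 ≡ + 0
    lem = solve-∀

  plücker-identity : ∀ a b c d → det a b * det c d ≡ det a c * det b d - det a d * det b c
  plücker-identity (a , a′) (b , b′) (c , c′) (d , d′) = lem a a′ b b′ c c′ d d′
    where
    lem : ∀ a a′ b b′ c c′ d d′ → (a * b′ - a′ * b) * (c * d′ - c′ * d) ≡ (a * c′ - a′ * c) * (b * d′ - b′ * d) - (a * d′ - a′ * d) * (b * c′ - b′ * c)
    lem = solve-∀

  plücker-sum : ∀ m a b c → det m a * det b c + det m b * det c a + det m c * det a b ≡ + 0
  plücker-sum (m , m′) (a , a′) (b , b′) (c , c′) = lem m m′ a a′ b b′ c c′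
    where
    lem : ∀ m m′ a a′ b b′ c c′ → (m * a′ - m′ * a) * (b * c′ - b′ * c) + (m * b′ - m′ * b) * (c * a′ - c′ * a) + (m * c′ - m′ * c) * (a * b′ - a′ * b) ≡ + 0
    lem = solve-∀

  det-⊖ˡ : ∀ x y z → det (x ⊖ y) z ≡ det x z - det y z
  det-⊖ˡ (a , b) (c , d) (e , f) = lem a b c d e f
    where
    lem : ∀ a b c d e f → (a - c) * f - (b - d) * e ≡ (a * f - b * e) - (c * f - d * e)
    lem = solve-∀

  det-self : ∀ x → det x x ≡ + 0
  det-self (a , b) = lem a b
    where
    lem : ∀ a b → a * b - b * a ≡ + 0
    lem = solve-∀

-- Functions of degree at most 1 and at most 3

module Affine {f : Pt → ℤ} (deg : Deg< 2 f) where

  affine : Additive (λ x → f x - f ε)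
  affine x y = lem (f (x ⊕ y)) (f x) (f y) (f ε) (subst (λ v → (f (x ⊕ y) - f x) - (f v - f ε) ≡ + 0) (⊕-idˡ y)
                 (subst (λ v → (f (v ⊕ y) - f v) - (f (ε ⊕ y) - f ε) ≡ + 0) (⊕-idˡ x) (deg-vanish (deg-Δ (deg-Δ deg y) x) ε)))
    where
    lem : ∀ a b c d → (a - b) - (c - d) ≡ + 0 → a - d ≡ (b - d) + (c - d)
    lem a b c d e = trans (l a b c d) (trans (cong (_+ ((b - d) + (c - d))) e) (ℤₚ.+-identityˡ _))
      where
      l : ∀ a b c d → a - d ≡ ((a - b) - (c - d)) + ((b - d) + (c - d))
      l = solve-∀

module Cubic {f : Pt → ℤ} (deg : Deg< 4 f) where

  L : Pt → ℤ
  L x = f x - f ε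

  Q : Pt → Pt → ℤ
  Q x y = f (x ⊕ y) - f x - f y + f ε

  Φ : Pt → Pt → Pt → ℤ
  Φ x y z = f ((x ⊕ y) ⊕ z) - f (x ⊕ y) - f (x ⊕ z) - f (y ⊕ z) + f x + f y + f z - f ε

  Q-sym : ∀ x y → Q x y ≡ Q y x
  Q-sym x y = trans (cong (λ v → f v - f x - f y + f ε) (⊕-comm x y)) (lem (f (y ⊕ x)) (f x) (f y) (f ε))
    where
    lem : ∀ a b c d → a - b - c + d ≡ a - c - b + d
    lem = solve-∀

  Φ-sym₁₂ : ∀ x y z → Φ x y z ≡ Φ y x z
  Φ-sym₁₂ x y z = trans (cong (λ v → f (v ⊕ z) - f v - f (x ⊕ z) - f (y ⊕ z) + f x + f y + f z - f ε) (⊕-comm x y))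
      (lem (f ((y ⊕ x) ⊕ z)) (f (y ⊕ x)) (f (x ⊕ z)) (f (y ⊕ z)) (f x) (f y) (f z) (f ε))
    where
    lem : ∀ a b c d e g h i → a - b - c - d + e + g + h - i ≡ a - b - d - c + g + e + h - i
    lem = solve-∀

  Φ-sym₂₃ : ∀ x y z → Φ x y z ≡ Φ x z y
  Φ-sym₂₃ x y z = trans (cong₂ (λ u v → f u - f (x ⊕ y) - f (x ⊕ z) - f v + f x + f y + f z - f ε)
      (trans (⊕-assoc x y z) (trans (cong (x ⊕_) (⊕-comm y z)) (sym (⊕-assoc x z y)))) (⊕-comm y z))
      (lem (f ((x ⊕ z) ⊕ y)) (f (x ⊕ y)) (f (x ⊕ z)) (f (z ⊕ y)) (f x) (f y) (f z) (f ε))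
    where
    lem : ∀ a b c d e g h i → a - b - c - d + e + g + h - i ≡ a - c - b - d + e + h + g - i
    lem = solve-∀

  -- `Φ x y z` is the second difference of f in the directions y and z, taken at x minus its value
  -- at `ε`. Since f has degree at most 3, this second difference is affine in x.
  Φ-additive : ∀ y z → Additive (λ x → Φ x y z)
  Φ-additive y z x w = trans (as-difference (x ⊕ w))
    (trans (Affine.affine (deg-Δ (deg-Δ deg z) y) x w) (cong₂ _+_ (sym (as-difference x)) (sym (as-difference w))))
    where
    lem : ∀ a b c d e g h i → a - b - c - d + e + g + h - i ≡ ((a - b) - (c - e)) - ((d - g) - (h - i))
    lem = solve-∀
    as-difference : ∀ x → Φ x y z ≡ Δ y (Δ z f) x - Δ y (Δ z f) ε
    as-difference x = trans (lem (f ((x ⊕ y) ⊕ z)) (f (x ⊕ y)) (f (x ⊕ z)) (f (y ⊕ z)) (f x) (f y) (f z) (f ε))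
      (cong₂ (λ u v → Δ y (Δ z f) x - ((f (u ⊕ z) - f u) - (f v - f ε))) (sym (⊕-idˡ y)) (sym (⊕-idˡ z)))

  Q-add : ∀ x w y → Q (x ⊕ w) y ≡ Q x y + Q w y + Φ x w y
  Q-add x w y = lem (f ((x ⊕ w) ⊕ y)) (f (x ⊕ w)) (f (x ⊕ y)) (f (w ⊕ y)) (f x) (f w) (f y) (f ε)
    where
    lem : ∀ a b c d e g h i → a - b - h + i ≡ (c - e - h + i) + (d - g - h + i) + (a - b - c - d + e + g + h - i)
    lem = solve-∀

  L-add : ∀ x w → L (x ⊕ w) ≡ L x + L w + Q x w
  L-add x w = lem (f (x ⊕ w)) (f x) (f w) (f ε)
    where
    lem : ∀ a b c d → a - d ≡ (b - d) + (c - d) + (a - b - c + d)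
    lem = solve-∀

  Φ-add₂ : ∀ x y y′ z → Φ x (y ⊕ y′) z ≡ Φ x y z + Φ x y′ z
  Φ-add₂ x y y′ z = trans (Φ-sym₁₂ x (y ⊕ y′) z) (trans (Φ-additive x z y y′) (cong₂ _+_ (Φ-sym₁₂ y x z) (Φ-sym₁₂ y′ x z)))

  Φ-add₃ : ∀ x y z z′ → Φ x y (z ⊕ z′) ≡ Φ x y z + Φ x y z′
  Φ-add₃ x y z z′ = trans (Φ-sym₂₃ x y (z ⊕ z′)) (trans (Φ-add₂ x z z′ y) (cong₂ _+_ (Φ-sym₂₃ x z y) (Φ-sym₂₃ x z′ y)))

  Φ-square : ∀ x w y → Φ (x ⊕ w) (x ⊕ w) y ≡ Φ x x y + + 2 * Φ x w y + Φ w w y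
  Φ-square x w y = trans (Φ-additive (x ⊕ w) y x w)
    (trans (cong₂ _+_ (Φ-add₂ x x w y) (trans (Φ-add₂ w x w y) (cong (_+ Φ w w y) (Φ-sym₁₂ w x y)))) (lem (Φ x x y) (Φ x w y) (Φ w w y)))
    where
    lem : ∀ a b c → a + b + (b + c) ≡ a + + 2 * b + c
    lem = solve-∀

  -- The homogeneous parts of degree 2 and 1, up to the factors 2 and 12.
  β : Pt → Pt → ℤ
  β y x = + 2 * Q x y - Φ x x y - Φ x y y

  α : Pt → ℤ
  α x = + 12 * L x - + 6 * Q x x + + 4 * Φ x x x

  -- `Q` fails to be additive by `Φ x w y`, and `Φ x x y` fails by twice that amount; the factor 2
  -- makes the defects cancel.
  β-additive : ∀ y → Additive (β y)
  β-additive y x w = trans (cong₂ _-_ (cong₂ (λ u v → + 2 * u - v) (Q-add x w y) (Φ-square x w y)) (Φ-additive y y x w))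
    (lem (Q x y) (Q w y) (Φ x w y) (Φ x x y) (Φ w w y) (Φ x y y) (Φ w y y))
    where
    lem : ∀ a b c d e g h → + 2 * (a + b + c) - (d + + 2 * c + e) - (g + h) ≡ (+ 2 * a - d - g) + (+ 2 * b - e - h)
    lem = solve-∀

  α-additive : Additive α
  α-additive x w = trans (cong₂ _+_ (cong₂ (λ u v → + 12 * u - + 6 * v) (L-add x w) quad) (cong (+ 4 *_) cube))
    (lem (L x) (L w) (Q x w) (Q x x) (Q w w) (Φ x x w) (Φ x w w) (Φ x x x) (Φ w w w))
    where
    quad : Q (x ⊕ w) (x ⊕ w) ≡ (Q x x + Q x w + Φ x x w) + (Q x w + Q w w + Φ x w w) + (Φ x x w + Φ x w w)
    quad = trans (Q-add x w (x ⊕ w)) (cong₂ _+_ (cong₂ _+_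
      (trans (Q-sym x (x ⊕ w)) (trans (Q-add x w x) (cong₂ _+_ (cong (λ u → Q x x + u) (Q-sym w x)) (Φ-sym₂₃ x w x))))
      (trans (Q-sym w (x ⊕ w)) (Q-add x w w)))
      (trans (Φ-add₃ x w x w) (cong (_+ Φ x w w) (Φ-sym₂₃ x w x))))
    cube : Φ (x ⊕ w) (x ⊕ w) (x ⊕ w) ≡ (Φ x x x + Φ x x w) + + 2 * (Φ x x w + Φ x w w) + (Φ x w w + Φ w w w)
    cube = trans (Φ-square x w (x ⊕ w)) (cong₂ _+_ (cong₂ (λ u v → u + + 2 * v) (Φ-add₃ x x x w)
      (trans (Φ-add₃ x w x w) (cong (_+ Φ x w w) (Φ-sym₂₃ x w x))))
      (trans (Φ-add₃ w w x w) (cong (_+ Φ w w w) (trans (Φ-sym₂₃ w w x) (Φ-sym₁₂ w x w)))))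
    lem : ∀ l l′ q q′ q″ a b c d → + 12 * (l + l′ + q) - + 6 * ((q′ + q + a) + (q + q″ + b) + (a + b)) + + 4 * ((c + a) + + 2 * (a + b) + (b + d))
          ≡ (+ 12 * l - + 6 * q′ + + 4 * c) + (+ 12 * l′ - + 6 * q″ + + 4 * d)
    lem = solve-∀

  Φ-relation : ∀ {k l m x y z} → Relation₃ k l m x y z → ∀ v w → k * Φ x v w + l * Φ y v w + m * Φ z v w ≡ + 0
  Φ-relation r v w = additive-relation (Φ-additive v w) r

  -- `α`, `β` and `Φ` are additive, hence respect the relation. They are added with multiplicities
  -- that cancel `Q` at equal arguments and `Φ` at exactly two equal arguments, whose values are
  -- unknown; besides the diagonal of `Φ` only known values remain.
  cubic-relation : ∀ {k l m x y z} → Relation₃ k l m x y z →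
    k * Φ x x x + l * Φ y y y + m * Φ z z z
      ≡ - (+ 12 * (k * L x + l * L y + m * L z)
           + + 6 * (k * (Q x y + Q x z) + l * (Q x y + Q y z) + m * (Q x z + Q y z))
           + + 3 * ((k + l + m) * Φ x y z))
  cubic-relation {k} {l} {m} {x} {y} {z} r =
    trans (lem k l m (L x) (L y) (L z) (Q x x) (Q y y) (Q z z) (Q x y) (Q x z) (Q y z)
             (Φ x x x) (Φ y y y) (Φ z z z) (Φ x x y) (Φ x y y) (Φ x x z) (Φ x z z) (Φ y y z) (Φ y z z) (Φ x y z))
      (trans (cong₂ _+_ (cong₂ _+_ (cong₂ (λ a b → a + + 3 * b) ra (cong₂ _+_ (cong₂ _+_ rβx rβy) rβz))
                                    (cong (+ 3 *_) (cong₂ _+_ (cong₂ _+_ rxx ryy) rzz)))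
                        (cong₂ (λ a b → + 3 * a - b) (cong₂ _+_ (cong₂ _+_ rxy rxz) ryz) refl))
        (trans (ℤₚ.+-identityˡ _) (ℤₚ.+-identityˡ _)))
    where
    ra = additive-relation α-additive r
    rβx : k * (+ 2 * Q x x - Φ x x x - Φ x x x) + l * (+ 2 * Q x y - Φ x y y - Φ x x y) + m * (+ 2 * Q x z - Φ x z z - Φ x x z) ≡ + 0
    rβx = trans (cong₂ (λ u v → k * β x x + l * u + m * v) (e y) (e z)) (additive-relation (β-additive x) r)
      where
      e : ∀ w → + 2 * Q x w - Φ x w w - Φ x x w ≡ β x w
      e w = cong₂ _-_ (cong₂ (λ u v → + 2 * u - v) (Q-sym x w) (trans (Φ-sym₁₂ x w w) (Φ-sym₂₃ w x w))) (trans (Φ-sym₂₃ x x w) (Φ-sym₁₂ x w x))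
    rβy : k * (+ 2 * Q x y - Φ x x y - Φ x y y) + l * (+ 2 * Q y y - Φ y y y - Φ y y y) + m * (+ 2 * Q y z - Φ y z z - Φ y y z) ≡ + 0
    rβy = trans (cong (λ u → k * β y x + l * β y y + m * u) e) (additive-relation (β-additive y) r)
      where
      e : + 2 * Q y z - Φ y z z - Φ y y z ≡ β y z
      e = cong₂ _-_ (cong₂ (λ u v → + 2 * u - v) (Q-sym y z) (trans (Φ-sym₁₂ y z z) (Φ-sym₂₃ z y z))) (trans (Φ-sym₂₃ y y z) (Φ-sym₁₂ y z y))
    rβz : k * (+ 2 * Q x z - Φ x x z - Φ x z z) + l * (+ 2 * Q y z - Φ y y z - Φ y z z) + m * (+ 2 * Q z z - Φ z z z - Φ z z z) ≡ + 0
    rβz = additive-relation (β-additive z) r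
    rxx : k * Φ x x x + l * Φ x x y + m * Φ x x z ≡ + 0
    rxx = trans (cong₂ (λ u v → k * Φ x x x + l * u + m * v) (trans (Φ-sym₂₃ x x y) (Φ-sym₁₂ x y x)) (trans (Φ-sym₂₃ x x z) (Φ-sym₁₂ x z x))) (Φ-relation r x x)
    ryy : k * Φ x y y + l * Φ y y y + m * Φ y y z ≡ + 0
    ryy = trans (cong (λ v → k * Φ x y y + l * Φ y y y + m * v) (trans (Φ-sym₂₃ y y z) (Φ-sym₁₂ y z y))) (Φ-relation r y y)
    rzz : k * Φ x z z + l * Φ y z z + m * Φ z z z ≡ + 0
    rzz = Φ-relation r z z
    rxy : k * Φ x x y + l * Φ x y y + m * Φ x y z ≡ + 0
    rxy = trans (cong₂ (λ u v → k * Φ x x y + l * u + m * v) (Φ-sym₁₂ x y y) (trans (Φ-sym₂₃ x y z) (Φ-sym₁₂ x z y) )) (Φ-relation r x y)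
    rxz : k * Φ x x z + l * Φ x y z + m * Φ x z z ≡ + 0
    rxz = trans (cong₂ (λ u v → k * Φ x x z + l * u + m * v) (Φ-sym₁₂ x y z) (Φ-sym₁₂ x z z)) (Φ-relation r x z)
    ryz : k * Φ x y z + l * Φ y y z + m * Φ y z z ≡ + 0
    ryz = trans (cong (λ v → k * Φ x y z + l * Φ y y z + m * v) (Φ-sym₁₂ y z z)) (Φ-relation r y z)
    lem : ∀ k l m Lx Ly Lz Qxx Qyy Qzz Qxy Qxz Qyz a b c xxy xyy xxz xzz yyz yzz xyz →
      k * a + l * b + m * c ≡
        (k * (+ 12 * Lx - + 6 * Qxx + + 4 * a) + l * (+ 12 * Ly - + 6 * Qyy + + 4 * b) + m * (+ 12 * Lz - + 6 * Qzz + + 4 * c)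
         + + 3 * ((k * (+ 2 * Qxx - a - a) + l * (+ 2 * Qxy - xyy - xxy) + m * (+ 2 * Qxz - xzz - xxz))
                + (k * (+ 2 * Qxy - xxy - xyy) + l * (+ 2 * Qyy - b - b) + m * (+ 2 * Qyz - yzz - yyz))
                + (k * (+ 2 * Qxz - xxz - xzz) + l * (+ 2 * Qyz - yyz - yzz) + m * (+ 2 * Qzz - c - c)))
         + + 3 * ((k * a + l * xxy + m * xxz) + (k * xyy + l * b + m * yyz) + (k * xzz + l * yzz + m * c)))
        + (+ 3 * ((k * xxy + l * xyy + m * xyz) + (k * xxz + l * xyz + m * xzz) + (k * xyz + l * yyz + m * yzz))
           - (+ 12 * (k * Lx + l * Ly + m * Lz) + + 6 * (k * (Qxy + Qxz) + l * (Qxy + Qyz) + m * (Qxz + Qyz)) + + 3 * ((k + l + m) * xyz)))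
    lem = solve-∀

-- For four points m, x₁, x₂, x₃ the equations below are written in P i = [m , x i] and V i = [x j , x k],
-- with i, j, k in cyclic order.
opaque
  conic : (P₁ P₂ P₃ V₁ V₂ V₃ : ℤ) → ℤ
  conic P₁ P₂ P₃ V₁ V₂ V₃ =
    P₁ * P₂ * P₃ * (V₁ + V₂ + V₃)
    - (P₁ * (P₂ - P₃) * V₁ * (V₁ + (P₂ - P₃)) + P₂ * (P₃ - P₁) * V₂ * (V₂ + (P₃ - P₁)) + P₃ * (P₁ - P₂) * V₃ * (V₃ + (P₁ - P₂)))

  cubic : (P₁ P₂ P₃ V₁ V₂ V₃ : ℤ) → ℤ
  cubic P₁ P₂ P₃ V₁ V₂ V₃ =
    + 3 * (V₃ + (P₁ - P₂)) * V₁ * V₂ * P₃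
    - (P₃ * (P₂ * (P₂ - P₃) * V₂ - P₁ * (P₃ - P₁) * V₁)
       - V₂ * (V₃ * P₃ * (V₃ + P₁) - V₂ * P₂ * (V₂ - P₁))
       + V₁ * (V₁ * P₁ * (V₁ + P₂) - V₃ * P₃ * (V₃ - P₂)))

opaque
  unfolding conic cubic

  -- Weighted by P₁, P₂, P₃, the three `diagonal` equations have the coefficients P₁P₂P₃ V i at the
  -- diagonal values A, B, C of `Φ`, so `star` for a, b, c removes all of them at once.
  conic-combination : ∀ P₁ P₂ P₃ V₁ V₂ V₃ A B C κ → κ * conic P₁ P₂ P₃ V₁ V₂ V₃
    ≡ (P₁ * (V₁ * P₂ * P₃ * A - κ * (V₃ * P₃ * (V₃ + P₁) - V₂ * P₂ * (V₂ - P₁)))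
       + P₂ * (V₂ * P₃ * P₁ * B - κ * (V₁ * P₁ * (V₁ + P₂) - V₃ * P₃ * (V₃ - P₂)))
       + P₃ * (V₃ * P₁ * P₂ * C - κ * (V₂ * P₂ * (V₂ + P₃) - V₁ * P₁ * (V₁ - P₃))))
      - P₁ * P₂ * P₃ * (V₁ * A + V₂ * B + V₃ * C - + 3 * κ * (V₁ + V₂ + V₃))
  conic-combination = lem
    where
    lem : ∀ P₁ P₂ P₃ V₁ V₂ V₃ A B C κ →
      κ * (P₁ * P₂ * P₃ * (V₁ + V₂ + V₃)
        - (P₁ * (P₂ - P₃) * V₁ * (V₁ + (P₂ - P₃)) + P₂ * (P₃ - P₁) * V₂ * (V₂ + (P₃ - P₁)) + P₃ * (P₁ - P₂) * V₃ * (V₃ + (P₁ - P₂))))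
      ≡ (P₁ * (V₁ * P₂ * P₃ * A - κ * (V₃ * P₃ * (V₃ + P₁) - V₂ * P₂ * (V₂ - P₁)))
         + P₂ * (V₂ * P₃ * P₁ * B - κ * (V₁ * P₁ * (V₁ + P₂) - V₃ * P₃ * (V₃ - P₂)))
         + P₃ * (V₃ * P₁ * P₂ * C - κ * (V₂ * P₂ * (V₂ + P₃) - V₁ * P₁ * (V₁ - P₃))))
        - P₁ * P₂ * P₃ * (V₁ * A + V₂ * B + V₃ * C - + 3 * κ * (V₁ + V₂ + V₃))
    lem = solve-∀

  -- The same idea with the relation between m, a, b: here V₁V₂P₃ is the common factor, and M is the
  -- diagonal value at m supplied by `apex`.
  cubic-combination : ∀ P₁ P₂ P₃ V₁ V₂ V₃ A B M κ → κ * cubic P₁ P₂ P₃ V₁ V₂ V₃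
    ≡ (P₃ * (V₁ * V₂ * V₃ * M - κ * (P₂ * (P₂ - P₃) * V₂ - P₁ * (P₃ - P₁) * V₁))
       - V₂ * (V₁ * P₂ * P₃ * A - κ * (V₃ * P₃ * (V₃ + P₁) - V₂ * P₂ * (V₂ - P₁)))
       + V₁ * (V₂ * P₃ * P₁ * B - κ * (V₁ * P₁ * (V₁ + P₂) - V₃ * P₃ * (V₃ - P₂))))
      - V₁ * V₂ * P₃ * (V₃ * M + - P₂ * A + P₁ * B - + 3 * κ * (V₃ + - P₂ + P₁))
  cubic-combination = lem
    where
    lem : ∀ P₁ P₂ P₃ V₁ V₂ V₃ A B M κ →
      κ * (+ 3 * (V₃ + (P₁ - P₂)) * V₁ * V₂ * P₃
        - (P₃ * (P₂ * (P₂ - P₃) * V₂ - P₁ * (P₃ - P₁) * V₁)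
           - V₂ * (V₃ * P₃ * (V₃ + P₁) - V₂ * P₂ * (V₂ - P₁))
           + V₁ * (V₁ * P₁ * (V₁ + P₂) - V₃ * P₃ * (V₃ - P₂))))
      ≡ (P₃ * (V₁ * V₂ * V₃ * M - κ * (P₂ * (P₂ - P₃) * V₂ - P₁ * (P₃ - P₁) * V₁))
         - V₂ * (V₁ * P₂ * P₃ * A - κ * (V₃ * P₃ * (V₃ + P₁) - V₂ * P₂ * (V₂ - P₁)))
         + V₁ * (V₂ * P₃ * P₁ * B - κ * (V₁ * P₁ * (V₁ + P₂) - V₃ * P₃ * (V₃ - P₂))))
        - V₁ * V₂ * P₃ * (V₃ * M + - P₂ * A + P₁ * B - + 3 * κ * (V₃ + - P₂ + P₁))
    lem = solve-∀

-- The conic and the cubic equation of four terms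

module Quadruple (p : ℕ) (pr : Prime p) {f : Pt → ℤ} (deg : Deg< 4 f) (κ : ℤ) (κ≢0 : ¬ Residues.Null p pr κ) where
  open Residues p pr
  open Cubic deg

  module _ (value : Null (f ε - κ)) where

    L-value : ∀ {x} → Null (f x) → Null (L x + κ)
    L-value {x} z = null-≡ (lem (f x) (f ε) κ) (null-- z value)
      where
      lem : ∀ a b k → a - b + k ≡ a - (b - k)
      lem = solve-∀

    Q-value : ∀ {x y} → Null (f x) → Null (f y) → Null (f (x ⊕ y)) → Null (Q x y - κ)
    Q-value {x} {y} zx zy z = null-≡ (lem (f (x ⊕ y)) (f x) (f y) (f ε) κ) (null-+ (null-- (null-- z zx) zy) value)
      where
      lem : ∀ a b c d k → a - b - c + d - k ≡ a - b - c + (d - k)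
      lem = solve-∀

    Φ-value : ∀ {x y z} → Null (f x) → Null (f y) → Null (f z) → Null (f (x ⊕ y)) → Null (f (x ⊕ z)) → Null (f (y ⊕ z)) → Null (f ((x ⊕ y) ⊕ z)) → Null (Φ x y z + κ)
    Φ-value {x} {y} {z} zx zy zz zxy zxz zyz z0 =
      null-≡ (lem (f ((x ⊕ y) ⊕ z)) (f (x ⊕ y)) (f (x ⊕ z)) (f (y ⊕ z)) (f x) (f y) (f z) (f ε) κ)
        (null-- (null-+ (null-+ (null-+ (null-- (null-- (null-- z0 zxy) zxz) zyz) zx) zy) zz) value)
      where
      lem : ∀ a b c d e g h i k → a - b - c - d + e + g + h - i + k ≡ a - b - c - d + e + g + h - (i - k)
      lem = solve-∀

    -- On the right of `cubic-relation`, modulo p, `L` is -κ, `Q` is κ and `Φ` is -κ, and - (- 12 +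
    -- 12 - 3) = 3.
    star : ∀ {k l m x y z} → Relation₃ k l m x y z → Null (f x) → Null (f y) → Null (f z) →
      Null (f (x ⊕ y)) → Null (f (x ⊕ z)) → Null (f (y ⊕ z)) → Null (Φ x y z + κ) →
      Null (k * Φ x x x + l * Φ y y y + m * Φ z z z - + 3 * κ * (k + l + m))
    star {k} {l} {m} {x} {y} {z} r zx zy zz zxy zxz zyz zΦ =
      null-≡ (trans (cong (λ u → u - + 3 * κ * (k + l + m)) (cubic-relation r))
                    (lem k l m (L x) (L y) (L z) (Q x y) (Q x z) (Q y z) (Φ x y z) κ))
        (null-neg (null-+ (null-+ (null-* (+ 12) (null-+ (null-+ (null-* k (L-value zx)) (null-* l (L-value zy))) (null-* m (L-value zz))))
                         (null-* (+ 6) (null-+ (null-+ (null-* k (null-+ (Q-value zx zy zxy) (Q-value zx zz zxz)))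
                             (null-* l (null-+ (Q-value zx zy zxy) (Q-value zy zz zyz))))
                                               (null-* m (null-+ (Q-value zx zz zxz) (Q-value zy zz zyz))))))
                 (null-* (+ 3) (null-* (k + l + m) zΦ))))
      where
      lem : ∀ k l m Lx Ly Lz q r s t κ →
        - (+ 12 * (k * Lx + l * Ly + m * Lz) + + 6 * (k * (q + r) + l * (q + s) + m * (r + s)) + + 3 * ((k + l + m) * t)) - + 3 * κ * (k + l + m)
        ≡ - (+ 12 * (k * (Lx + κ) + l * (Ly + κ) + m * (Lz + κ)) + + 6 *
            (k * ((q - κ) + (r - κ)) + l * ((q - κ) + (s - κ)) + m * ((r - κ) + (s - κ))) + + 3 * ((k + l + m) * (t + κ)))
      lem = solve-∀

  -- At three distinct points `Φ` is -κ. From such values, additivity along the relation between m,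
  -- c, a gives `Φ a a b`, and along the one between m, a, b it gives `Φ a a c`; the relation
  -- between a, b, c then reaches `Φ a a a`.
  diagonal : ∀ a b c m → Null (Φ a b c + κ) → Null (Φ a b m + κ) → Null (Φ a c m + κ) →
    Null (det b c * det m b * det m c * Φ a a a
          - κ * (det a b * det m c * (det a b + det m a) - det c a * det m b * (det c a - det m a)))
  diagonal a b c m zabc zabm zacm =
    null-≡ (trans (lem (det b c) (det c a) (det a b) (det m a) (det m b) (det m c) (Φ a a a) (Φ a a b) (Φ a a c) (Φ a b c) (Φ a b m) (Φ a c m) κ)
              (cong₂ _+_ (cong₂ (λ u v → det m b * det m c * u - det m b * det c a * v) e₀ e₂) (cong (λ u → det m c * det a b * u + rest) e₃)))
      (null-≡ (tidy (det m b) (det m c) (det c a) (det a b) rest)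
      (null-- (null-- (null-- (null-* (det m b * det c a * det c a) zabm) (null-* (det m b * det c a * det m a) zabc))
                      (null-* (det m c * det a b * det a b) zacm)) (null-* (det m c * det a b * det m a) zabc)))
    where
    rest = det m b * det c a * det c a * (Φ a b m + κ) - det m b * det c a * det m a * (Φ a b c + κ)
           - det m c * det a b * det a b * (Φ a c m + κ) - det m c * det a b * det m a * (Φ a b c + κ)
    e₀ : det b c * Φ a a a + det c a * Φ a a b + det a b * Φ a a c ≡ + 0
    e₀ = trans (cong₂ (λ u v → det b c * Φ a a a + det c a * u + det a b * v) (s b) (s c)) (Φ-relation (cramer a b c) a a)
      where
      s : ∀ b → Φ a a b ≡ Φ b a a
      s b = trans (Φ-sym₂₃ a a b) (Φ-sym₁₂ a b a)
    e₂ : det c a * Φ a b m + - det m a * Φ a b c + det m c * Φ a a b ≡ + 0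
    e₂ = trans (cong₂ (λ u v → det c a * u + - det m a * v + det m c * Φ a a b) (trans (Φ-sym₂₃ a b m) (Φ-sym₁₂ a m b)) (trans (Φ-sym₂₃ a b c) (Φ-sym₁₂ a c b)))
           (Φ-relation (cramer′ c a m) a b)
    e₃ : det a b * Φ a c m + - det m b * Φ a a c + det m a * Φ a b c ≡ + 0
    e₃ = trans (cong₂ (λ u v → det a b * u + - det m b * Φ a a c + det m a * v) (trans (Φ-sym₂₃ a c m) (Φ-sym₁₂ a m c)) (Φ-sym₁₂ a b c))
           (Φ-relation (cramer′ a b m) a c)
    lem : ∀ V₁ V₂ V₃ P₁ P₂ P₃ A X Y T S R κ →
      V₁ * P₂ * P₃ * A - κ * (V₃ * P₃ * (V₃ + P₁) - V₂ * P₂ * (V₂ - P₁))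
      ≡ (P₂ * P₃ * (V₁ * A + V₂ * X + V₃ * Y) - P₂ * V₂ * (V₂ * S + - P₁ * T + P₃ * X))
        + (P₃ * V₃ * (V₃ * R + - P₂ * Y + P₁ * T)
           + (P₂ * V₂ * V₂ * (S + κ) - P₂ * V₂ * P₁ * (T + κ) - P₃ * V₃ * V₃ * (R + κ) - P₃ * V₃ * P₁ * (T + κ)))
    lem = solve-∀
    tidy : ∀ P₂ P₃ V₂ V₃ r → (P₂ * P₃ * + 0 - P₂ * V₂ * + 0) + (P₃ * V₃ * + 0 + r) ≡ r
    tidy = solve-∀

  apex : ∀ a b c m → Null (Φ a b m + κ) → Null (Φ a c m + κ) → Null (Φ b c m + κ) →
    Null (det b c * det c a * det a b * Φ m m m - κ * (det m b * (det m b - det m c) * det c a - det m a * (det m c - det m a) * det b c))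
  apex a b c m zabm zacm zbcm =
    null-≡ (trans (lem (det b c) (det c a) (det a b) (det m a) (det m b) (det m c) (Φ m m m) (Φ m m a) (Φ m m b) (Φ a b m) (Φ a c m) (Φ b c m) κ)
             (cong₂ _+_ (cong₂ (λ u v → det b c * det c a * u + det c a * det m b * v) e₃ e₁) (cong (λ u → - (det b c * det m a) * u + rest) e₂)))
      (null-≡ (tidy (det b c) (det c a) (det m b) (det m a) rest)
        (null-+ (null-- (null-* (det c a * det m b * det m c) zabm) (null-* (det c a * det m b * det m b) zacm))
                (null-- (null-* (det b c * det m a * det m c) zabm) (null-* (det b c * det m a * det m a) zbcm))))
    where
    rest = (det c a * det m b * det m c * (Φ a b m + κ) - det c a * det m b * det m b * (Φ a c m + κ))
         + (det b c * det m a * det m c * (Φ a b m + κ) - det b c * det m a * det m a * (Φ b c m + κ))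
    e₃ : det a b * Φ m m m + - det m b * Φ m m a + det m a * Φ m m b ≡ + 0
    e₃ = trans (cong₂ (λ u v → det a b * Φ m m m + - det m b * u + det m a * v) (s a) (s b)) (Φ-relation (cramer′ a b m) m m)
      where
      s : ∀ b → Φ m m b ≡ Φ b m m
      s b = trans (Φ-sym₂₃ m m b) (Φ-sym₁₂ m b m)
    e₁ : det b c * Φ m m a + - det m c * Φ a b m + det m b * Φ a c m ≡ + 0
    e₁ = trans (cong₂ _+_ (cong₂ (λ u v → det b c * u + - det m c * v) (Φ-sym₂₃ m m a) (Φ-sym₁₂ a b m)) (cong (det m b *_) (Φ-sym₁₂ a c m)))
           (trans (cong₂ _+_ (cong (λ v → det b c * Φ m a m + - det m c * v) refl) refl) (Φ-relation (cramer′ b c m) a m))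
    e₂ : det c a * Φ m m b + - det m a * Φ b c m + det m c * Φ a b m ≡ + 0
    e₂ = trans (cong₂ (λ u v → det c a * u + - det m a * v + det m c * Φ a b m) (Φ-sym₂₃ m m b) (Φ-sym₁₂ b c m)) (Φ-relation (cramer′ c a m) b m)
    lem : ∀ V₁ V₂ V₃ P₁ P₂ P₃ M A B T S R κ →
      V₁ * V₂ * V₃ * M - κ * (P₂ * (P₂ - P₃) * V₂ - P₁ * (P₃ - P₁) * V₁)
      ≡ (V₁ * V₂ * (V₃ * M + - P₂ * A + P₁ * B) + V₂ * P₂ * (V₁ * A + - P₃ * T + P₂ * S))
        + (- (V₁ * P₁) * (V₂ * B + - P₁ * R + P₃ * T)
           + ((V₂ * P₂ * P₃ * (T + κ) - V₂ * P₂ * P₂ * (S + κ)) + (V₁ * P₁ * P₃ * (T + κ) - V₁ * P₁ * P₁ * (R + κ))))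
    lem = solve-∀
    tidy : ∀ V₁ V₂ P₂ P₁ r → (V₁ * V₂ * + 0 + V₂ * P₂ * + 0) + (- (V₁ * P₁) * + 0 + r) ≡ r
    tidy = solve-∀

  record Values (a b c m : Pt) : Set where
    field
      v₀ : Null (f ε - κ)
      va : Null (f a)
      vb : Null (f b)
      vc : Null (f c)
      vm : Null (f m)
      vab : Null (f (a ⊕ b))
      vac : Null (f (a ⊕ c))
      vbc : Null (f (b ⊕ c))
      vam : Null (f (a ⊕ m))
      vbm : Null (f (b ⊕ m))
      vcm : Null (f (c ⊕ m))
      vabc : Null (f ((a ⊕ b) ⊕ c))
      vabm : Null (f ((a ⊕ b) ⊕ m))
      vacm : Null (f ((a ⊕ c) ⊕ m))
      vbcm : Null (f ((b ⊕ c) ⊕ m))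

  module _ {a b c m : Pt} (vals : Values a b c m) where
    open Values vals
    private
      P₁ = det m a
      P₂ = det m b
      P₃ = det m c
      V₁ = det b c
      V₂ = det c a
      V₃ = det a b
      zabc = Φ-value v₀ va vb vc vab vac vbc vabc
      zabm = Φ-value v₀ va vb vm vab vam vbm vabm
      zacm = Φ-value v₀ va vc vm vac vam vcm vacm
      zbcm = Φ-value v₀ vb vc vm vbc vbm vcm vbcm
      flip : ∀ x y z → Null (Φ x y z + κ) → Null (Φ y x z + κ)
      flip x y z = subst (λ u → Null (u + κ)) (Φ-sym₁₂ x y z)
      flip′ : ∀ x y z → Null (Φ x y z + κ) → Null (Φ x z y + κ)
      flip′ x y z = subst (λ u → Null (u + κ)) (Φ-sym₂₃ x y z)
      dₐ = diagonal a b c m zabc zabm zacm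
      d₂ = diagonal b c a m (flip′ b a c (flip a b c zabc)) zbcm (flip a b m zabm)
      d₃ = diagonal c a b m (flip a c b (flip′ a b c zabc)) (flip a c m zacm) (flip b c m zbcm)

    conic-null : Null (conic P₁ P₂ P₃ V₁ V₂ V₃)
    conic-null = null-cancelˡ κ _ κ≢0 (null-≡ (conic-combination P₁ P₂ P₃ V₁ V₂ V₃ (Φ a a a) (Φ b b b) (Φ c c c) κ)
      (null-- (null-+ (null-+ (null-* P₁ dₐ) (null-* P₂ d₂)) (null-* P₃ d₃))
              (null-* (P₁ * P₂ * P₃) (star v₀ (cramer a b c) va vb vc vab vac vbc zabc))))

    cubic-null : Null (cubic P₁ P₂ P₃ V₁ V₂ V₃)
    cubic-null = null-cancelˡ κ _ κ≢0 (null-≡ (cubic-combination P₁ P₂ P₃ V₁ V₂ V₃ (Φ a a a) (Φ b b b) (Φ m m m) κ)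
      (null-- (null-+ (null-- (null-* P₃ (apex a b c m zabm zacm zbcm)) (null-* V₂ dₐ)) (null-* V₁ d₂))
              (null-* (V₁ * V₂ * P₃) (star v₀ (cramer′ a b m) vm va vb (comm′ a m vam) (comm′ b m vbm) vab (flip a m b (flip′ a b m zabm))))))
      where
      comm′ : ∀ x y → Null (f (x ⊕ y)) → Null (f (y ⊕ x))
      comm′ x y = subst (λ v → Null (f v)) (⊕-comm x y)

-- Minimal zero-sum sequences of length 2p - 1

module Minimal (p : ℕ) (pr : Prime p) (U : List Pt)
  (len : suc (length U) ≡ 2 ℕ.* p) (zU : PlaneSums.ZeroSum p pr U) (ns : ¬ PlaneSums.Short p pr U) where
  open Residues p pr
  open PlaneSums p pr

  κ : ℤ
  κ = F₂ ε

  κ≢0 : ¬ Null κ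
  κ≢0 = ¬null-F₂ null-0 null-0

  -- A zero-sum subsequence of R misses i, so by `short-split` it must be empty, and the alternating
  -- sum reduces to the contribution of the empty subsequence.
  value-ε : ∀ i I R → U ↭ (i ∷ I) ++ R → Null (altSum F₂ R ε - κ)
  value-ε i I R r with find⁺ p pr F₂ R ε
  ... | inj₁ z = z
  ... | inj₂ (b , B , R′ , s , nz) = ⊥-elim (ns (short-split (b ∷ B) ((i ∷ I) ++ R′)
      (↭-trans r (↭-trans (++⁺ˡ (i ∷ I) s) (shifts (i ∷ I) (b ∷ B)))) zU
      (F₂-¬null (λ z → nz (subst (λ v → Null (F₂ v)) (sym (⊕-idˡ _)) z)))
      (s≤s z≤n) (s≤s z≤n) (≤-trans (n≤1+n _) (≤-reflexive len))))

  -- A non-zero contribution would extend j ∷ J by terms of R to a zero-sum part of U, which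
  -- contains j and misses k, contrary to `short-split`.
  value-∑ : ∀ {I R} j J k K → U ↭ I ++ R → I ↭ (j ∷ J) ++ (k ∷ K) → Null (altSum F₂ R (∑ (j ∷ J)))
  value-∑ {I} {R} j J k K r t with find p pr F₂ R (∑ (j ∷ J))
  ... | inj₁ z = z
  ... | inj₂ (B , R′ , s , nz) = ⊥-elim (ns (short-split ((j ∷ J) ++ B) ((k ∷ K) ++ R′) perm zU
      (F₂-¬null (λ z → nz (subst (λ v → Null (F₂ v)) (∑-++ (j ∷ J) B) z)))
      (s≤s z≤n) (s≤s z≤n) (≤-trans (n≤1+n _) (≤-reflexive len))))
    where
    perm : U ↭ ((j ∷ J) ++ B) ++ ((k ∷ K) ++ R′)
    perm = ↭-trans r (↭-trans (++⁺ʳ R t) (↭-trans (↭-reflexive (Listₚ.++-assoc (j ∷ J) (k ∷ K) R))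
      (↭-trans (++⁺ˡ (j ∷ J) (↭-trans (++⁺ˡ (k ∷ K) s) (shifts (k ∷ K) B))) (↭-reflexive (sym (Listₚ.++-assoc (j ∷ J) B _))))))

  -- `F₂` has degree 2p - 2 and R has 2p - 1 - n terms, so degree at most n - 1 is left.
  altSum-F₂-deg : ∀ n I R → U ↭ I ++ R → length I ≡ n → Deg< n (altSum F₂ R)
  altSum-F₂-deg n I R r e = altSum-deg n R (F₂-deg (length R ℕ.+ n)
    (trans (cong suc (trans (+-comm (length R) n) (trans (cong (ℕ._+ length R) (sym e)) (sym (trans (↭-length r) (Listₚ.length-++ I)))))) len))

  private
    at₁ : ∀ {g : Pt → ℤ} x → Null (g (∑ (x ∷ []))) → Null (g x)
    at₁ {g} x = subst (λ v → Null (g v)) (⊕-idʳ x)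
    at₂ : ∀ {g : Pt → ℤ} x y → Null (g (∑ (x ∷ y ∷ []))) → Null (g (x ⊕ y))
    at₂ {g} x y = subst (λ v → Null (g (x ⊕ v))) (⊕-idʳ y)
    at₃ : ∀ {g : Pt → ℤ} x y z → Null (g (∑ (x ∷ y ∷ z ∷ []))) → Null (g ((x ⊕ y) ⊕ z))
    at₃ {g} x y z = subst (λ v → Null (g v)) (trans (cong (λ v → x ⊕ (y ⊕ v)) (⊕-idʳ z)) (sym (⊕-assoc x y z)))

  _≈_ : Pt → Pt → Set
  x ≈ y = Null (proj₁ x - proj₁ y) × Null (proj₂ x - proj₂ y)

  module _ {a b R} (r : U ↭ a ∷ b ∷ R) where
    private
      g = altSum F₂ R
      I : List Pt
      I = a ∷ b ∷ []
      module A = Affine (altSum-F₂-deg 2 I R r refl)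
      g0 : Null (g ε - κ)
      g0 = value-ε a (b ∷ []) R r
      ga : Null (g a - g ε + κ)
      ga = null-≡ (lem (g a) (g ε) κ) (null-- (at₁ {g} a (value-∑ {I} {R} a [] b [] r ↭-refl)) g0)
        where
        lem : ∀ a b c → a - b + c ≡ a - (b - c)
        lem = solve-∀
      gb : Null (g b - g ε + κ)
      gb = null-≡ (lem (g b) (g ε) κ) (null-- (at₁ {g} b (value-∑ {I} {R} b [] a [] r (swap a b ↭-refl))) g0)
        where
        lem : ∀ a b c → a - b + c ≡ a - (b - c)
        lem = solve-∀
      ℓ : Pt → ℤ
      ℓ x = g x - g ε
      X = ℓ (+ 1 , + 0)
      Y = ℓ (+ 0 , + 1)
      cₐ : ℓ a ≡ proj₁ a * X + proj₂ a * Y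
      cₐ = additive-coordinates {ℓ} A.affine (proj₁ a) (proj₂ a)
      c_b : ℓ b ≡ proj₁ b * X + proj₂ b * Y
      c_b = additive-coordinates {ℓ} A.affine (proj₁ b) (proj₂ b)

    -- The affine function g takes the same non-zero value -κ (relative to g ε) at a and b.
    parallel⇒≈ : Null (det a b) → a ≈ b
    parallel⇒≈ z₀ =
      null-cancelˡ κ _ κ≢0 (null-≡ (lem κ (proj₁ a) (proj₂ a) (proj₁ b) (proj₂ b) X Y)
        (null-+ (null-- (null-* (proj₁ a) (null-≡ (cong (_+ κ) (sym c_b)) gb)) (null-* (proj₁ b) (null-≡ (cong (_+ κ) (sym cₐ)) ga))) (null-* (- Y) z))) ,
      null-cancelˡ κ _ κ≢0 (null-≡ (lem′ κ (proj₁ a) (proj₂ a) (proj₁ b) (proj₂ b) X Y)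
        (null-+ (null-- (null-* (proj₂ a) (null-≡ (cong (_+ κ) (sym c_b)) gb)) (null-* (proj₂ b) (null-≡ (cong (_+ κ) (sym cₐ)) ga))) (null-* X z)))
      where
      z : Null (proj₁ a * proj₂ b - proj₂ a * proj₁ b)
      z = subst Null (det-coordinates a b) z₀
      lem : ∀ κ a a′ b b′ X Y → κ * (a - b) ≡ a * (b * X + b′ * Y + κ) - b * (a * X + a′ * Y + κ) + (- Y) * (a * b′ - a′ * b)
      lem = solve-∀
      lem′ : ∀ κ a a′ b b′ X Y → κ * (a′ - b′) ≡ a′ * (b * X + b′ * Y + κ) - b′ * (a * X + a′ * Y + κ) + X * (a * b′ - a′ * b)
      lem′ = solve-∀

  module _ {a b c m R} (r : U ↭ a ∷ b ∷ c ∷ m ∷ R) where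
    private
      g = altSum F₂ R
      I : List Pt
      I = a ∷ b ∷ c ∷ m ∷ []
      open Quadruple p pr (altSum-F₂-deg 4 I R r refl) κ κ≢0
      val : ∀ j J k K → I ↭ (j ∷ J) ++ (k ∷ K) → Null (g (∑ (j ∷ J)))
      val j J k K = value-∑ {I} {R} j J k K r
      values : Values a b c m
      values = record
        { v₀ = value-ε a (b ∷ c ∷ m ∷ []) R r
        ; va = at₁ {g} a (val a [] b (c ∷ m ∷ []) ↭-refl)
        ; vb = at₁ {g} b (val b [] a (c ∷ m ∷ []) (shift b (a ∷ []) (c ∷ m ∷ [])))
        ; vc = at₁ {g} c (val c [] a (b ∷ m ∷ []) (shift c (a ∷ b ∷ []) (m ∷ [])))
        ; vm = at₁ {g} m (val m [] a (b ∷ c ∷ []) (shift m (a ∷ b ∷ c ∷ []) []))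
        ; vab = at₂ {g} a b (val a (b ∷ []) c (m ∷ []) ↭-refl)
        ; vac = at₂ {g} a c (val a (c ∷ []) b (m ∷ []) (prep a (shift c (b ∷ []) (m ∷ []))))
        ; vbc = at₂ {g} b c (val b (c ∷ []) a (m ∷ []) (shifts (a ∷ []) (b ∷ c ∷ []) {m ∷ []}))
        ; vam = at₂ {g} a m (val a (m ∷ []) b (c ∷ []) (prep a (shift m (b ∷ c ∷ []) [])))
        ; vbm = at₂ {g} b m (val b (m ∷ []) a (c ∷ []) (↭-trans (shift b (a ∷ []) (c ∷ m ∷ [])) (prep b (shift m (a ∷ c ∷ []) []))))
        ; vcm = at₂ {g} c m (val c (m ∷ []) a (b ∷ []) (++-comm (a ∷ b ∷ []) (c ∷ m ∷ [])))
        ; vabc = at₃ {g} a b c (val a (b ∷ c ∷ []) m [] ↭-refl)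
        ; vabm = at₃ {g} a b m (val a (b ∷ m ∷ []) c [] (prep a (prep b (swap c m ↭-refl))))
        ; vacm = at₃ {g} a c m (val a (c ∷ m ∷ []) b [] (prep a (++-comm (b ∷ []) (c ∷ m ∷ []))))
        ; vbcm = at₃ {g} b c m (val b (c ∷ m ∷ []) a [] (++-comm (a ∷ []) (b ∷ c ∷ m ∷ [])))
        }

    conic-eq : Null (conic (det m a) (det m b) (det m c) (det b c) (det c a) (det a b))
    conic-eq = conic-null values

    cubic-eq : Null (cubic (det m a) (det m b) (det m c) (det b c) (det c a) (det a b))
    cubic-eq = cubic-null values

-- Factoring and eliminating in the two equations

env : {A : Set} (a b c d e f : A) → Fin 6 → A
env a b c d e f zero = a
env a b c d e f (suc zero) = b
env a b c d e f (suc (suc zero)) = c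
env a b c d e f (suc (suc (suc zero))) = d
env a b c d e f (suc (suc (suc (suc zero)))) = e
env a b c d e f (suc (suc (suc (suc (suc zero))))) = f

conicᵖ cubicᵖ : Poly 6
conicᵖ = P₁ ⊠ P₂ ⊠ P₃ ⊠ (V₁ ⊞ V₂ ⊞ V₃)
  ⊟ (P₁ ⊠ (P₂ ⊟ P₃) ⊠ V₁ ⊠ (V₁ ⊞ (P₂ ⊟ P₃)) ⊞ P₂ ⊠ (P₃ ⊟ P₁) ⊠ V₂ ⊠ (V₂ ⊞ (P₃ ⊟ P₁)) ⊞ P₃ ⊠ (P₁ ⊟ P₂) ⊠ V₃ ⊠ (V₃ ⊞ (P₁ ⊟ P₂)))
  where
  P₁ = var zero
  P₂ = var (suc zero)
  P₃ = var (suc (suc zero))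
  V₁ = var (suc (suc (suc zero)))
  V₂ = var (suc (suc (suc (suc zero))))
  V₃ = var (suc (suc (suc (suc (suc zero)))))
cubicᵖ = con (+ 3) ⊠ (V₃ ⊞ (P₁ ⊟ P₂)) ⊠ V₁ ⊠ V₂ ⊠ P₃
  ⊟ (P₃ ⊠ (P₂ ⊠ (P₂ ⊟ P₃) ⊠ V₂ ⊟ P₁ ⊠ (P₃ ⊟ P₁) ⊠ V₁)
     ⊟ V₂ ⊠ (V₃ ⊠ P₃ ⊠ (V₃ ⊞ P₁) ⊟ V₂ ⊠ P₂ ⊠ (V₂ ⊟ P₁))
     ⊞ V₁ ⊠ (V₁ ⊠ P₁ ⊠ (V₁ ⊞ P₂) ⊟ V₃ ⊠ P₃ ⊠ (V₃ ⊟ P₂)))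
  where
  P₁ = var zero
  P₂ = var (suc zero)
  P₃ = var (suc (suc zero))
  V₁ = var (suc (suc (suc zero)))
  V₂ = var (suc (suc (suc (suc zero))))
  V₃ = var (suc (suc (suc (suc (suc zero)))))

opaque
  unfolding conic cubic

  conic-⟦⟧ : ∀ a b c d e f → ⟦ conicᵖ ⟧ (env a b c d e f) ≡ conic a b c d e f
  conic-⟦⟧ a b c d e f = refl

  cubic-⟦⟧ : ∀ a b c d e f → ⟦ cubicᵖ ⟧ (env a b c d e f) ≡ cubic a b c d e f
  cubic-⟦⟧ a b c d e f = refl

opaque
  -- Here m i = M + v P i. `Jp` is what a combination of `Fp` and `Gp` leaves after the factor m₁ +
  -- m₂ + m₃ is split off, and e₃ times `Yp` is the product of `Y` at P₁, P₂ and P₃.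
  Fp Gp Jp Yp : (P₁ P₂ P₃ M v : ℤ) → ℤ
  Fp P₁ P₂ P₃ M v = let d₁ = P₂ - P₃ ; d₂ = P₃ - P₁ ; d₃ = P₁ - P₂ ; m₁ = M + v * P₁ ; m₂ = M + v * P₂ ; m₃ = M + v * P₃ ; e₁ = P₁ + P₂ + P₃ ; e₂ = P₁ * P₂ + P₂ * P₃ + P₁ * P₃ ; e₃ = P₁ * P₂ * P₃ ; n = v * e₃ in
    M * M * (e₁ * e₁ - + 4 * e₂) - (M * (+ 4 + + 6 * n) + v * e₁ * (+ 1 + n))
  Gp P₁ P₂ P₃ M v = let d₁ = P₂ - P₃ ; d₂ = P₃ - P₁ ; d₃ = P₁ - P₂ ; m₁ = M + v * P₁ ; m₂ = M + v * P₂ ; m₃ = M + v * P₃ ; e₁ = P₁ + P₂ + P₃ ; e₂ = P₁ * P₂ + P₂ * P₃ + P₁ * P₃ ; e₃ = P₁ * P₂ * P₃ ; n = v * e₃ in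
    M * (P₁ * d₂ * d₃ * m₂ * m₃ + P₂ * d₁ * d₃ * m₁ * m₃ + P₃ * d₁ * d₂ * m₁ * m₂) - v + m₁ * m₂ *
        (e₁ - + 4 * P₃ + M * (P₃ * (e₁ * e₁ - + 4 * e₂) + + 3 * e₃) + v * e₃ * (e₁ - + 3 * P₃))
  Jp P₁ P₂ P₃ M v = let d₁ = P₂ - P₃ ; d₂ = P₃ - P₁ ; d₃ = P₁ - P₂ ; m₁ = M + v * P₁ ; m₂ = M + v * P₂ ; m₃ = M + v * P₃ ; e₁ = P₁ + P₂ + P₃ ; e₂ = P₁ * P₂ + P₂ * P₃ + P₁ * P₃ ; e₃ = P₁ * P₂ * P₃ ; n = v * e₃ in
    M * M * (e₁ * (+ 1 + n) + + 2 * M * e₃) - v * ((+ 1 + n) * (+ 1 + n))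
  Yp P₁ P₂ P₃ M v = let d₁ = P₂ - P₃ ; d₂ = P₃ - P₁ ; d₃ = P₁ - P₂ ; m₁ = M + v * P₁ ; m₂ = M + v * P₂ ; m₃ = M + v * P₃ ; e₁ = P₁ + P₂ + P₃ ; e₂ = P₁ * P₂ + P₂ * P₃ + P₁ * P₃ ; e₃ = P₁ * P₂ * P₃ ; n = v * e₃ in
    - (M * M * M * e₁ * (e₁ * e₁ - + 4 * e₂)) - + 8 * (M * M * M * e₃) - M * M * v * e₂ * (e₁ * e₁ - + 4 * e₂) - + 2 *
        (M * M * v * e₁ * e₃) - M * v * v * e₃ * (e₁ * e₁ - + 4 * e₂) + v * v * v * e₃ * e₃

  -- At P₃, and up to the factor - (P₁ - P₂), this is V₁ + V₂ = [c, a] - [c, b], which vanishes when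
  -- the line through a and b is parallel to c.
  Y : (P e₁ n M : ℤ) → ℤ
  Y P e₁ n M = P * M * (e₁ - + 2 * P) + n

-- Substituting V i = P j P k (P j - P k) (M + v P i) splits the conic and the cubic into monomial factors
-- and the polynomials Fp and Gp.
opaque
  unfolding conic cubic Fp Gp Jp Yp Y

  conic-factor : ∀ P₁ P₂ P₃ M v →
    conic P₁ P₂ P₃ (P₂ * P₃ * ((P₂ - P₃) * (M + v * P₁))) (P₁ * P₃ * ((P₃ - P₁) * (M + v * P₂))) (P₁ * P₂ * ((P₁ - P₂) * (M + v * P₃)))
    ≡ P₁ * P₂ * P₃ * ((P₂ - P₃) * (P₃ - P₁) * (P₁ - P₂) * Fp P₁ P₂ P₃ M v)
  conic-factor P₁ P₂ P₃ M v = trans (step₁ P₁ P₂ P₃ (M + v * P₁) (M + v * P₂) (M + v * P₃)) (cong (P₁ * P₂ * P₃ *_) (step₂ P₁ P₂ P₃ M v))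
    where
    step₁ : ∀ P₁ P₂ P₃ m₁ m₂ m₃ → let d₁ = P₂ - P₃ ; d₂ = P₃ - P₁ ; d₃ = P₁ - P₂ ; V₁ = P₂ * P₃ * (d₁ * m₁) ; V₂ = P₁ * P₃ * (d₂ * m₂) ; V₃ = P₁ * P₂ * (d₃ * m₃) in
      P₁ * P₂ * P₃ * (V₁ + V₂ + V₃) - (P₁ * d₁ * V₁ * (V₁ + d₁) + P₂ * d₂ * V₂ * (V₂ + d₂) + P₃ * d₃ * V₃ * (V₃ + d₃))
      ≡ P₁ * P₂ * P₃ * (V₁ + V₂ + V₃
          - (d₁ * d₁ * d₁ * m₁ * (P₂ * P₃ * m₁ + + 1) + d₂ * d₂ * d₂ * m₂ * (P₁ * P₃ * m₂ + + 1) + d₃ * d₃ * d₃ * m₃ * (P₁ * P₂ * m₃ + + 1)))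
    step₁ = solve-∀
    step₂ : ∀ P₁ P₂ P₃ M v → let d₁ = P₂ - P₃ ; d₂ = P₃ - P₁ ; d₃ = P₁ - P₂ ; m₁ = M + v * P₁ ; m₂ = M + v * P₂ ; m₃ = M + v * P₃ ; e₁ = P₁ + P₂ + P₃ ; e₂ = P₁ * P₂ + P₂ * P₃ + P₁ * P₃ ; e₃ = P₁ * P₂ * P₃ ; n = v * e₃ in
      P₂ * P₃ * (d₁ * m₁) + P₁ * P₃ * (d₂ * m₂) + P₁ * P₂ * (d₃ * m₃)
        - (d₁ * d₁ * d₁ * m₁ * (P₂ * P₃ * m₁ + + 1) + d₂ * d₂ * d₂ * m₂ * (P₁ * P₃ * m₂ + + 1) + d₃ * d₃ * d₃ * m₃ * (P₁ * P₂ * m₃ + + 1))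
      ≡ d₁ * d₂ * d₃ * (M * M * (e₁ * e₁ - + 4 * e₂) - (M * (+ 4 + + 6 * n) + v * e₁ * (+ 1 + n)))
    step₂ = solve-∀

  cubic-factor : ∀ P₁ P₂ P₃ M v →
    cubic P₁ P₂ P₃ (P₂ * P₃ * ((P₂ - P₃) * (M + v * P₁))) (P₁ * P₃ * ((P₃ - P₁) * (M + v * P₂))) (P₁ * P₂ * ((P₁ - P₂) * (M + v * P₃)))
    ≡ P₁ * P₂ * P₃ * P₃ * ((P₂ - P₃) * (P₃ - P₁) * (- (P₁ - P₂) * Gp P₁ P₂ P₃ M v))
  cubic-factor P₁ P₂ P₃ M v = trans (cong (cubic P₁ P₂ P₃ (P₂ * P₃ * ((P₂ - P₃) * (M + v * P₁))) (P₁ * P₃ * ((P₃ - P₁) * (M + v * P₂)))) (step₀ P₁ P₂ P₃ M v))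
    (trans (step₁ P₁ P₂ P₃ ((P₂ - P₃) * (M + v * P₁)) ((P₃ - P₁) * (M + v * P₂))) (cong (P₁ * P₂ * P₃ * P₃ *_)
    (trans (step₂ P₁ P₂ P₃ (M + v * P₁) (M + v * P₂)) (cong ((P₂ - P₃) * (P₃ - P₁) *_) (step₃ P₁ P₂ P₃ M v)))))
    where
    step₀ : ∀ P₁ P₂ P₃ M v → P₁ * P₂ * ((P₁ - P₂) * (M + v * P₃)) ≡ P₁ * P₂ * (- ((P₂ - P₃) * (M + v * P₁) + (P₃ - P₁) * (M + v * P₂)))
    step₀ = solve-∀
    step₁ : ∀ P₁ P₂ P₃ a b → let V₁ = P₂ * P₃ * a ; V₂ = P₁ * P₃ * b ; D = - (a + b) ; V₃ = P₁ * P₂ * D in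
      + 3 * (V₃ + (P₁ - P₂)) * V₁ * V₂ * P₃
        - (P₃ * (P₂ * (P₂ - P₃) * V₂ - P₁ * (P₃ - P₁) * V₁)
        - V₂ * (V₃ * P₃ * (V₃ + P₁) - V₂ * P₂ * (V₂ - P₁))
        + V₁ * (V₁ * P₁ * (V₁ + P₂) - V₃ * P₃ * (V₃ - P₂)))
      ≡ P₁ * P₂ * P₃ * P₃ * (+ 3 * P₃ * (P₁ * P₂ * D + (P₁ - P₂)) * a * b - ((P₂ - P₃) * b - (P₃ - P₁) * a)
          + P₁ * P₁ * b * (D * (P₂ * D + + 1) - b * (P₃ * b - + 1)) - P₂ * P₂ * a * (a * (P₃ * a + + 1) - D * (P₁ * D - + 1)))
    step₁ = solve-∀
    step₂ : ∀ P₁ P₂ P₃ m₁ m₂ → let d₁ = P₂ - P₃ ; d₂ = P₃ - P₁ ; a = d₁ * m₁ ; b = d₂ * m₂ ; D = - (a + b) in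
      + 3 * P₃ * (P₁ * P₂ * D + (P₁ - P₂)) * a * b - (d₁ * b - d₂ * a)
        + P₁ * P₁ * b * (D * (P₂ * D + + 1) - b * (P₃ * b - + 1)) - P₂ * P₂ * a * (a * (P₃ * a + + 1) - D * (P₁ * D - + 1))
      ≡ d₁ * d₂ * (+ 3 * P₃ * m₁ * m₂ * (P₁ * P₂ * D + (P₁ - P₂)) - (m₂ - m₁)
          + P₁ * P₁ * m₂ * (- m₁ + d₂ * d₂ * m₂ * m₂ + P₂ * m₁ * (a + + 2 * b)) - P₂ * P₂ * m₁ * (- m₂ + d₁ * d₁ * m₁ * m₁ - P₁ * m₂ * (+ 2 * a + b)))
    step₂ = solve-∀
    step₃ : ∀ P₁ P₂ P₃ M v → let d₁ = P₂ - P₃ ; d₂ = P₃ - P₁ ; d₃ = P₁ - P₂ ; m₁ = M + v * P₁ ; m₂ = M + v * P₂ ; m₃ = M + v * P₃ ; a = d₁ * m₁ ; b = d₂ * m₂ ; D = - (a + b) ; e₁ = P₁ + P₂ + P₃ ; e₂ = P₁ * P₂ + P₂ * P₃ + P₁ * P₃ ; e₃ = P₁ * P₂ * P₃ in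
      + 3 * P₃ * m₁ * m₂ * (P₁ * P₂ * D + d₃) - (m₂ - m₁)
        + P₁ * P₁ * m₂ * (- m₁ + d₂ * d₂ * m₂ * m₂ + P₂ * m₁ * (a + + 2 * b)) - P₂ * P₂ * m₁ * (- m₂ + d₁ * d₁ * m₁ * m₁ - P₁ * m₂ * (+ 2 * a + b))
      ≡ - d₃ * (M * (P₁ * d₂ * d₃ * m₂ * m₃ + P₂ * d₁ * d₃ * m₁ * m₃ + P₃ * d₁ * d₂ * m₁ * m₂) - v + m₁ * m₂ *
          (e₁ - + 4 * P₃ + M * (P₃ * (e₁ * e₁ - + 4 * e₂) + + 3 * e₃) + v * e₃ * (e₁ - + 3 * P₃)))
    step₃ = solve-∀

  -- The factor 3M + v e₁ on the left is the sum m₁ + m₂ + m₃ of the slopes. This identity is the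
  -- source of the sporadic case: on a common zero of `Fp` and `Gp` either the slopes sum to 0 or
  -- `Jp` vanishes.
  elimination : ∀ P₁ P₂ P₃ M v → let d₁ = P₂ - P₃ ; d₂ = P₃ - P₁ ; d₃ = P₁ - P₂ ; m₁ = M + v * P₁ ; m₂ = M + v * P₂ ; m₃ = M + v * P₃ ; e₁ = P₁ + P₂ + P₃ ; e₂ = P₁ * P₂ + P₂ * P₃ + P₁ * P₃ ; e₃ = P₁ * P₂ * P₃ ; n = v * e₃ in
    (+ 3 * M + v * e₁) * Jp P₁ P₂ P₃ M v
    ≡ (m₁ * m₂ * P₃ - (M * M * e₁ + M * v * e₂ + v * v * e₃) + v * (+ 1 + n)) * Fp P₁ P₂ P₃ M v - M * Gp P₁ P₂ P₃ M v
  elimination = lem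
    where
    lem : ∀ P₁ P₂ P₃ M v → let d₁ = P₂ - P₃ ; d₂ = P₃ - P₁ ; d₃ = P₁ - P₂ ; m₁ = M + v * P₁ ; m₂ = M + v * P₂ ; m₃ = M + v * P₃ ; e₁ = P₁ + P₂ + P₃ ; e₂ = P₁ * P₂ + P₂ * P₃ + P₁ * P₃ ; e₃ = P₁ * P₂ * P₃ ; n = v * e₃ in
      (+ 3 * M + v * e₁) * (M * M * (e₁ * (+ 1 + n) + + 2 * M * e₃) - v * ((+ 1 + n) * (+ 1 + n)))
      ≡ (m₁ * m₂ * P₃ - (M * M * e₁ + M * v * e₂ + v * v * e₃) + v * (+ 1 + n)) * (M * M * (e₁ * e₁ - + 4 * e₂) - (M * (+ 4 + + 6 * n) + v * e₁ * (+ 1 + n)))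
        - M * (M * (P₁ * d₂ * d₃ * m₂ * m₃ + P₂ * d₁ * d₃ * m₁ * m₃ + P₃ * d₁ * d₂ * m₁ * m₂) - v + m₁ * m₂ *
            (e₁ - + 4 * P₃ + M * (P₃ * (e₁ * e₁ - + 4 * e₂) + + 3 * e₃) + v * e₃ * (e₁ - + 3 * P₃)))
    lem = solve-∀

  Y-product : ∀ P₁ P₂ P₃ M v → let d₁ = P₂ - P₃ ; d₂ = P₃ - P₁ ; d₃ = P₁ - P₂ ; m₁ = M + v * P₁ ; m₂ = M + v * P₂ ; m₃ = M + v * P₃ ; e₁ = P₁ + P₂ + P₃ ; e₂ = P₁ * P₂ + P₂ * P₃ + P₁ * P₃ ; e₃ = P₁ * P₂ * P₃ ; n = v * e₃ in
    Y P₁ e₁ n M * Y P₂ e₁ n M * Y P₃ e₁ n M ≡ e₃ * Yp P₁ P₂ P₃ M v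
  Y-product = lem
    where
    lem : ∀ P₁ P₂ P₃ M v → let d₁ = P₂ - P₃ ; d₂ = P₃ - P₁ ; d₃ = P₁ - P₂ ; m₁ = M + v * P₁ ; m₂ = M + v * P₂ ; m₃ = M + v * P₃ ; e₁ = P₁ + P₂ + P₃ ; e₂ = P₁ * P₂ + P₂ * P₃ + P₁ * P₃ ; e₃ = P₁ * P₂ * P₃ ; n = v * e₃ in
      (P₁ * M * (e₁ - + 2 * P₁) + n) * (P₂ * M * (e₁ - + 2 * P₂) + n) * (P₃ * M * (e₁ - + 2 * P₃) + n)
      ≡ e₃ * (- (M * M * M * e₁ * (e₁ * e₁ - + 4 * e₂)) - + 8 * (M * M * M * e₃) - M * M * v * e₂ * (e₁ * e₁ - + 4 * e₂) - + 2 *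
          (M * M * v * e₁ * e₃) - M * v * v * e₃ * (e₁ * e₁ - + 4 * e₂) + v * v * v * e₃ * e₃)
    lem = solve-∀

  -- If `Fp` and `Jp` vanish while M does not, then `Yp` vanishes and with it one `Y`, which is one
  -- of the parallel configurations.
  Yp-elimination : ∀ P₁ P₂ P₃ M v → let d₁ = P₂ - P₃ ; d₂ = P₃ - P₁ ; d₃ = P₁ - P₂ ; m₁ = M + v * P₁ ; m₂ = M + v * P₂ ; m₃ = M + v * P₃ ; e₁ = P₁ + P₂ + P₃ ; e₂ = P₁ * P₂ + P₂ * P₃ + P₁ * P₃ ; e₃ = P₁ * P₂ * P₃ ; n = v * e₃ in
    + 4 * (M * M) * Yp P₁ P₂ P₃ M v ≡
    (- (+ 4 * (e₂ * M * M * v)) + e₁ * e₃ * v * v * v - + 4 * (e₁ * M * M * M) + e₁ * v * v + + 2 * (e₃ * M * v * v) + + 4 * (M * v)) * Fp P₁ P₂ P₃ M v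
    - (+ 4 * M + v * e₁) * (+ 4 * M + v * e₁) * Jp P₁ P₂ P₃ M v
  Yp-elimination P₁ P₂ P₃ M v = lem (P₁ + P₂ + P₃) (P₁ * P₂ + P₂ * P₃ + P₁ * P₃) (P₁ * P₂ * P₃) M v
    where
    lem : ∀ e₁ e₂ e₃ M v → let n = v * e₃ in
      + 4 * (M * M) * (- (M * M * M * e₁ * (e₁ * e₁ - + 4 * e₂)) - + 8 * (M * M * M * e₃) - M * M * v * e₂ * (e₁ * e₁ - + 4 * e₂) - + 2 *
          (M * M * v * e₁ * e₃) - M * v * v * e₃ * (e₁ * e₁ - + 4 * e₂) + v * v * v * e₃ * e₃)
      ≡ (- (+ 4 * (e₂ * M * M * v)) + e₁ * e₃ * v * v * v - + 4 * (e₁ * M * M * M) + e₁ * v * v + + 2 * (e₃ * M * v * v) + + 4 * (M * v))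
          * (M * M * (e₁ * e₁ - + 4 * e₂) - (M * (+ 4 + + 6 * n) + v * e₁ * (+ 1 + n)))
        - (+ 4 * M + v * e₁) * (+ 4 * M + v * e₁) * (M * M * (e₁ * (+ 1 + n) + + 2 * M * e₃) - v * ((+ 1 + n) * (+ 1 + n)))
    lem = solve-∀

  parallel-factor : ∀ P₁ P₂ P₃ M v →
    P₂ * P₃ * ((P₂ - P₃) * (M + v * P₁)) + P₁ * P₃ * ((P₃ - P₁) * (M + v * P₂)) ≡ - (P₁ - P₂) * Y P₃ (P₁ + P₂ + P₃) (v * (P₁ * P₂ * P₃)) M
  parallel-factor = lem
    where
    lem : ∀ P₁ P₂ P₃ M v → P₂ * P₃ * ((P₂ - P₃) * (M + v * P₁)) + P₁ * P₃ * ((P₃ - P₁) * (M + v * P₂))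
      ≡ - (P₁ - P₂) * (P₃ * M * (P₁ + P₂ + P₃ - + 2 * P₃) + v * (P₁ * P₂ * P₃))
    lem = solve-∀

  parallel-factor₁ : ∀ P₁ P₂ P₃ M v →
    P₁ * P₃ * ((P₃ - P₁) * (M + v * P₂)) + P₁ * P₂ * ((P₁ - P₂) * (M + v * P₃)) ≡ - (P₂ - P₃) * Y P₁ (P₁ + P₂ + P₃) (v * (P₁ * P₂ * P₃)) M
  parallel-factor₁ = lem
    where
    lem : ∀ P₁ P₂ P₃ M v → P₁ * P₃ * ((P₃ - P₁) * (M + v * P₂)) + P₁ * P₂ * ((P₁ - P₂) * (M + v * P₃))
      ≡ - (P₂ - P₃) * (P₁ * M * (P₁ + P₂ + P₃ - + 2 * P₁) + v * (P₁ * P₂ * P₃))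
    lem = solve-∀

  parallel-factor₂ : ∀ P₁ P₂ P₃ M v →
    P₂ * P₃ * ((P₂ - P₃) * (M + v * P₁)) + P₁ * P₂ * ((P₁ - P₂) * (M + v * P₃)) ≡ - (P₃ - P₁) * Y P₂ (P₁ + P₂ + P₃) (v * (P₁ * P₂ * P₃)) M
  parallel-factor₂ = lem
    where
    lem : ∀ P₁ P₂ P₃ M v → P₂ * P₃ * ((P₂ - P₃) * (M + v * P₁)) + P₁ * P₂ * ((P₁ - P₂) * (M + v * P₃))
      ≡ - (P₃ - P₁) * (P₂ * M * (P₁ + P₂ + P₃ - + 2 * P₂) + v * (P₁ * P₂ * P₃))
    lem = solve-∀

  -- Serves the case M = 0, where `Fp` forces v e₁ (1 + n) = 0: for e₁ = 0 the slopes sum to 0, and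
  -- for n = -1 the four points are collinear.
  Fp-at-0 : ∀ P₁ P₂ P₃ M v → let d₁ = P₂ - P₃ ; d₂ = P₃ - P₁ ; d₃ = P₁ - P₂ ; m₁ = M + v * P₁ ; m₂ = M + v * P₂ ; m₃ = M + v * P₃ ; e₁ = P₁ + P₂ + P₃ ; e₂ = P₁ * P₂ + P₂ * P₃ + P₁ * P₃ ; e₃ = P₁ * P₂ * P₃ ; n = v * e₃ in
    v * (e₁ * (+ 1 + n)) ≡ (M * (e₁ * e₁ - + 4 * e₂) - (+ 4 + + 6 * n)) * M - Fp P₁ P₂ P₃ M v
  Fp-at-0 P₁ P₂ P₃ M v = lem M v (P₁ + P₂ + P₃) (P₁ * P₂ + P₂ * P₃ + P₁ * P₃) (v * (P₁ * P₂ * P₃))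
    where
    lem : ∀ M v e₁ e₂ n → v * (e₁ * (+ 1 + n)) ≡ (M * (e₁ * e₁ - + 4 * e₂) - (+ 4 + + 6 * n)) * M -
        (M * M * (e₁ * e₁ - + 4 * e₂) - (M * (+ 4 + + 6 * n) + v * e₁ * (+ 1 + n)))
    lem = solve-∀

  -- For P₁ = P₂ = P the Plücker relation reads P (V₁ + V₂) + P₃ V₃ = 0. Modulo this relation the
  -- conic and, in `cubic-parallel`, the cubic acquire the factor V₁ + V₂.
  conic-parallel : ∀ P P₃ V₁ V₂ V₃ → P * ((V₁ + V₂) * ((P - P₃) * (V₁ - V₂ + + 2 * P - P₃))) ≡ P * P * (P * (V₁ + V₂) + P₃ * V₃) - conic P P P₃ V₁ V₂ V₃
  conic-parallel = lem
    where
    lem : ∀ P P₃ V₁ V₂ V₃ → P * ((V₁ + V₂) * ((P - P₃) * (V₁ - V₂ + + 2 * P - P₃))) ≡ P * P * (P * (V₁ + V₂) + P₃ * V₃)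
      - (P * P * P₃ * (V₁ + V₂ + V₃) - (P * (P - P₃) * V₁ * (V₁ + (P - P₃)) + P * (P₃ - P) * V₂ * (V₂ + (P₃ - P)) + P₃ * (P - P) * V₃ * (V₃ + (P - P))))
    lem = solve-∀

  cubic-parallel : ∀ P P₃ V₁ V₂ V₃ → P * ((V₁ + V₂) * (V₃ * (V₁ + V₂) + P₃ * (P - P₃) + (V₁ + V₂) * (V₁ + V₂)))
    ≡ (+ 3 * V₁ * V₂ + V₃ * (V₁ + V₂) + P * (V₂ - V₁)) * (P * (V₁ + V₂) + P₃ * V₃) - cubic P P P₃ V₁ V₂ V₃
  cubic-parallel = lem
    where
    lem : ∀ P P₃ V₁ V₂ V₃ → P * ((V₁ + V₂) * (V₃ * (V₁ + V₂) + P₃ * (P - P₃) + (V₁ + V₂) * (V₁ + V₂)))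
      ≡ (+ 3 * V₁ * V₂ + V₃ * (V₁ + V₂) + P * (V₂ - V₁)) * (P * (V₁ + V₂) + P₃ * V₃)
        - (+ 3 * (V₃ + (P - P)) * V₁ * V₂ * P₃
           - (P₃ * (P * (P - P₃) * V₂ - P * (P₃ - P) * V₁) - V₂ * (V₃ * P₃ * (V₃ + P) - V₂ * P * (V₂ - P)) + V₁ * (V₁ * P * (V₁ + P) - V₃ * P₃ * (V₃ - P))))
    lem = solve-∀

-- Used in place of `with`, so that goals containing large polynomials are not abstracted.
decide : ∀ {A B : Set} → Dec A → (A → B) → (¬ A → B) → B
decide (yes a) f g = f a
decide (no ¬a) f g = g ¬a

-- Solutions of the two equations

module Configurations (p : ℕ) (pr : Prime p) (5≤p : 5 ≤ p) where
  open Residues p pr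

  ¬null-2 : ¬ Null (+ 2)
  ¬null-2 = ¬null-small 2 (s≤s z≤n) (≤-trans (m≤m+n 3 2) 5≤p)

  ¬null-3 : ¬ Null (+ 3)
  ¬null-3 = ¬null-small 3 (s≤s z≤n) (≤-trans (m≤m+n 4 1) 5≤p)

  null-refl : ∀ a → Null (a - a)
  null-refl a = null-≡ (ℤₚ.+-inverseʳ a) null-0

  null-sym : ∀ {a b} → Null (a - b) → Null (b - a)
  null-sym {a} {b} z = null-≡ (lem a b) (null-neg z)
    where
    lem : ∀ a b → b - a ≡ - (a - b)
    lem = solve-∀

  private
    agree : ∀ {a b c d f g a′ b′ c′ d′ f′ g′} →
      Null (a - a′) → Null (b - b′) → Null (c - c′) → Null (d - d′) → Null (f - f′) → Null (g - g′) →
      ∀ i → Null (env a b c d f g i - env a′ b′ c′ d′ f′ g′ i)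
    agree h₁ h₂ h₃ h₄ h₅ h₆ zero = h₁
    agree h₁ h₂ h₃ h₄ h₅ h₆ (suc zero) = h₂
    agree h₁ h₂ h₃ h₄ h₅ h₆ (suc (suc zero)) = h₃
    agree h₁ h₂ h₃ h₄ h₅ h₆ (suc (suc (suc zero))) = h₄
    agree h₁ h₂ h₃ h₄ h₅ h₆ (suc (suc (suc (suc zero)))) = h₅
    agree h₁ h₂ h₃ h₄ h₅ h₆ (suc (suc (suc (suc (suc zero))))) = h₆

  conic-cong : ∀ a b c d f g a′ b′ c′ d′ f′ g′ →
    Null (a - a′) → Null (b - b′) → Null (c - c′) → Null (d - d′) → Null (f - f′) → Null (g - g′) →
    Null (conic a′ b′ c′ d′ f′ g′) → Null (conic a b c d f g)
  conic-cong a b c d f g a′ b′ c′ d′ f′ g′ h₁ h₂ h₃ h₄ h₅ h₆ z = subst Null (conic-⟦⟧ a b c d f g)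
    (⟦⟧-null conicᵖ {env a b c d f g} {env a′ b′ c′ d′ f′ g′} (agree {a} {b} {c} {d} {f} {g} {a′} {b′} {c′} {d′} {f′} {g′} h₁ h₂ h₃ h₄ h₅ h₆)
        (null-≡ (conic-⟦⟧ a′ b′ c′ d′ f′ g′) z))

  cubic-cong : ∀ a b c d f g a′ b′ c′ d′ f′ g′ →
    Null (a - a′) → Null (b - b′) → Null (c - c′) → Null (d - d′) → Null (f - f′) → Null (g - g′) →
    Null (cubic a′ b′ c′ d′ f′ g′) → Null (cubic a b c d f g)
  cubic-cong a b c d f g a′ b′ c′ d′ f′ g′ h₁ h₂ h₃ h₄ h₅ h₆ z = subst Null (cubic-⟦⟧ a b c d f g)
    (⟦⟧-null cubicᵖ {env a b c d f g} {env a′ b′ c′ d′ f′ g′} (agree {a} {b} {c} {d} {f} {g} {a′} {b′} {c′} {d′} {f′} {g′} h₁ h₂ h₃ h₄ h₅ h₆)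
        (null-≡ (cubic-⟦⟧ a′ b′ c′ d′ f′ g′) z))

  -- The Plücker relation divided by P₁P₂P₃. It expresses that the three points (P i, m i) are
  -- collinear, which is why the slopes can be written as M + v P i.
  weighted-sum : ∀ P₁ P₂ P₃ V₁ V₂ V₃ {m₁ m₂ m₃} → P₁ * V₁ + P₂ * V₂ + P₃ * V₃ ≡ + 0 → ¬ Null P₁ → ¬ Null P₂ → ¬ Null P₃ →
    Null (P₂ * P₃ * ((P₂ - P₃) * m₁) - V₁) → Null (P₁ * P₃ * ((P₃ - P₁) * m₂) - V₂) → Null (P₁ * P₂ * ((P₁ - P₂) * m₃) - V₃) →
    Null ((P₂ - P₃) * m₁ + (P₃ - P₁) * m₂ + (P₁ - P₂) * m₃)
  weighted-sum P₁ P₂ P₃ V₁ V₂ V₃ {m₁} {m₂} {m₃} plücker ¬P₁ ¬P₂ ¬P₃ h₁ h₂ h₃ =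
    null-cancelˡ (P₁ * P₂ * P₃) ((P₂ - P₃) * m₁ + (P₃ - P₁) * m₂ + (P₁ - P₂) * m₃) (¬null-* {P₁ * P₂} {P₃} (¬null-* {P₁} {P₂} ¬P₁ ¬P₂) ¬P₃)
        (null-≡ (trans (lem P₁ P₂ P₃ V₁ V₂ V₃ ((P₂ - P₃) * m₁) ((P₃ - P₁) * m₂) ((P₁ - P₂) * m₃))
        (cong (λ u → P₁ * (P₂ * P₃ * ((P₂ - P₃) * m₁) - V₁) + P₂ * (P₁ * P₃ * ((P₃ - P₁) * m₂) - V₂) + P₃ * (P₁ * P₂ * ((P₁ - P₂) * m₃) - V₃) + u) plücker))
      (null-+ (null-+ (null-+ (null-* P₁ h₁) (null-* P₂ h₂)) (null-* P₃ h₃)) null-0))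
    where
    lem : ∀ P₁ P₂ P₃ V₁ V₂ V₃ a b c → P₁ * P₂ * P₃ * (a + b + c) ≡
      P₁ * (P₂ * P₃ * a - V₁) + P₂ * (P₁ * P₃ * b - V₂) + P₃ * (P₁ * P₂ * c - V₃) + (P₁ * V₁ + P₂ * V₂ + P₃ * V₃)
    lem = solve-∀

  module _ (P₁ P₂ P₃ V₁ V₂ V₃ : ℤ)
    (plücker : P₁ * V₁ + P₂ * V₂ + P₃ * V₃ ≡ + 0)
    (¬P₁ : ¬ Null P₁) (¬P₂ : ¬ Null P₂) (¬P₃ : ¬ Null P₃) (¬V₁ : ¬ Null V₁) (¬V₂ : ¬ Null V₂) (¬V₃ : ¬ Null V₃)
    (conic≡0 : Null (conic P₁ P₂ P₃ V₁ V₂ V₃)) (cubic≡0 : Null (cubic P₁ P₂ P₃ V₁ V₂ V₃)) where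

    -- V₁ + V₂ is non-zero because P₃V₃ is, so it can be cancelled. If P₁ and P₃ differ, the conic
    -- then fixes V₁ - V₂, while the cubic together with the Plücker relation gives (V₁ + V₂)² =
    -- P₃²; the two signs are the last two alternatives.
    parallel-case : Null (P₁ - P₂) →
      Null (P₁ - P₃) ⊎ (Null (V₁ - (P₃ - P₁)) × Null (V₂ - P₁)) ⊎ (Null (V₁ + P₁) × Null (V₂ - (P₁ - P₃)))
    parallel-case z = result
      where
      pl : Null (P₁ * (V₁ + V₂) + P₃ * V₃)
      pl = null-≡ (trans (lem P₁ P₂ P₃ V₁ V₂ V₃) (cong (_+ V₂ * (P₁ - P₂)) plücker)) (null-+ null-0 (null-* V₂ z))
        where
        lem : ∀ P₁ P₂ P₃ V₁ V₂ V₃ → P₁ * (V₁ + V₂) + P₃ * V₃ ≡ (P₁ * V₁ + P₂ * V₂ + P₃ * V₃) + V₂ * (P₁ - P₂)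
        lem = solve-∀
      ¬σ : ¬ Null (V₁ + V₂)
      ¬σ zσ = ¬null-* {P₃} {V₃} ¬P₃ ¬V₃ (null-≡ (lem P₁ (V₁ + V₂) (P₃ * V₃)) (null-- pl (null-* P₁ zσ)))
        where
        lem : ∀ a b c → c ≡ (a * b + c) - a * b
        lem = solve-∀
      c₁ : Null (conic P₁ P₁ P₃ V₁ V₂ V₃)
      c₁ = conic-cong P₁ P₁ P₃ V₁ V₂ V₃ P₁ P₂ P₃ V₁ V₂ V₃ (null-refl P₁) z (null-refl P₃) (null-refl V₁) (null-refl V₂) (null-refl V₃) conic≡0
      c₂ : Null (cubic P₁ P₁ P₃ V₁ V₂ V₃)
      c₂ = cubic-cong P₁ P₁ P₃ V₁ V₂ V₃ P₁ P₂ P₃ V₁ V₂ V₃ (null-refl P₁) z (null-refl P₃) (null-refl V₁) (null-refl V₂) (null-refl V₃) cubic≡0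
      f₁ : Null ((P₁ - P₃) * (V₁ - V₂ + + 2 * P₁ - P₃))
      f₁ = null-cancelˡ (V₁ + V₂) ((P₁ - P₃) * (V₁ - V₂ + + 2 * P₁ - P₃)) ¬σ
          (null-cancelˡ P₁ ((V₁ + V₂) * ((P₁ - P₃) * (V₁ - V₂ + + 2 * P₁ - P₃))) ¬P₁ (null-≡ (conic-parallel P₁ P₃ V₁ V₂ V₃) (null-- (null-* (P₁ * P₁) pl) c₁)))
      f₂ : Null (V₃ * (V₁ + V₂) + P₃ * (P₁ - P₃) + (V₁ + V₂) * (V₁ + V₂))
      f₂ = null-cancelˡ (V₁ + V₂) (V₃ * (V₁ + V₂) + P₃ * (P₁ - P₃) + (V₁ + V₂) * (V₁ + V₂)) ¬σ
          (null-cancelˡ P₁ ((V₁ + V₂) * (V₃ * (V₁ + V₂) + P₃ * (P₁ - P₃) + (V₁ + V₂) * (V₁ + V₂))) ¬P₁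
          (null-≡ (cubic-parallel P₁ P₃ V₁ V₂ V₃) (null-- (null-* (+ 3 * V₁ * V₂ + V₃ * (V₁ + V₂) + P₁ * (V₂ - V₁)) pl) c₂)))
      f₃ : Null ((P₁ - P₃) * ((P₃ - (V₁ + V₂)) * (P₃ + (V₁ + V₂))))
      f₃ = null-≡ (lem P₁ P₃ (V₁ + V₂) V₃) (null-- (null-* P₃ f₂) (null-* (V₁ + V₂) pl))
        where
        lem : ∀ P P₃ σ V₃ → (P - P₃) * ((P₃ - σ) * (P₃ + σ)) ≡ P₃ * (V₃ * σ + P₃ * (P - P₃) + σ * σ) - σ * (P * σ + P₃ * V₃)
        lem = solve-∀
      half : ∀ a → Null (+ 2 * a) → Null a
      half a = null-cancelˡ (+ 2) a ¬null-2
      result : Null (P₁ - P₃) ⊎ (Null (V₁ - (P₃ - P₁)) × Null (V₂ - P₁)) ⊎ (Null (V₁ + P₁) × Null (V₂ - (P₁ - P₃)))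
      result = decide (null? (P₁ - P₃)) inj₁ (λ ¬δ →
        let e = null-cancelˡ (P₁ - P₃) (V₁ - V₂ + + 2 * P₁ - P₃) ¬δ f₁ in
        [ (λ s → inj₂ (inj₁ (half (V₁ - (P₃ - P₁)) (null-≡ (l₁ P₁ P₃ V₁ V₂) (null-- e s)) , half (V₂ - P₁) (null-≡ (l₂ P₁ P₃ V₁ V₂) (null-neg (null-+ e s))))))
        , (λ s → inj₂ (inj₂ (half (V₁ + P₁) (null-≡ (l₃ P₁ P₃ V₁ V₂) (null-+ e s)) , half (V₂ - (P₁ - P₃)) (null-≡ (l₄ P₁ P₃ V₁ V₂) (null-- s e))))) ]′
        (null-product (P₃ - (V₁ + V₂)) (P₃ + (V₁ + V₂)) (null-cancelˡ (P₁ - P₃) ((P₃ - (V₁ + V₂)) * (P₃ + (V₁ + V₂))) ¬δ f₃)))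
        where
        l₁ : ∀ P P₃ V₁ V₂ → + 2 * (V₁ - (P₃ - P)) ≡ (V₁ - V₂ + + 2 * P - P₃) - (P₃ - (V₁ + V₂))
        l₁ = solve-∀
        l₂ : ∀ P P₃ V₁ V₂ → + 2 * (V₂ - P) ≡ - ((V₁ - V₂ + + 2 * P - P₃) + (P₃ - (V₁ + V₂)))
        l₂ = solve-∀
        l₃ : ∀ P P₃ V₁ V₂ → + 2 * (V₁ + P) ≡ (V₁ - V₂ + + 2 * P - P₃) + (P₃ + (V₁ + V₂))
        l₃ = solve-∀
        l₄ : ∀ P P₃ V₁ V₂ → + 2 * (V₂ - (P - P₃)) ≡ (P₃ + (V₁ + V₂)) - (V₁ - V₂ + + 2 * P - P₃)
        l₄ = solve-∀

    module _ (¬d₁ : ¬ Null (P₂ - P₃)) (¬d₂ : ¬ Null (P₃ - P₁)) (¬d₃ : ¬ Null (P₁ - P₂))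
      (¬V₁₂ : ¬ Null (V₁ + V₂)) (¬V₂₃ : ¬ Null (V₂ + V₃)) (¬V₁₃ : ¬ Null (V₁ + V₃)) where

      Line : Set
      Line = Null (V₁ + (P₂ - P₃)) × Null (V₂ + (P₃ - P₁)) × Null (V₃ + (P₁ - P₂))

      private
        ¬e₃ : ¬ Null (P₁ * P₂ * P₃)
        ¬e₃ = ¬null-* {P₁ * P₂} {P₃} (¬null-* {P₁} {P₂} ¬P₁ ¬P₂) ¬P₃

        transfer : ∀ a b c d → Null (a - b) → Null (c - d) → Null (a + c) → Null (b + d)
        transfer a b c d x y z = null-≡ (lem a b c d) (null-- (null-- z x) y)
          where
          lem : ∀ a b c d → b + d ≡ (a + c) - (a - b) - (c - d)
          lem = solve-∀

        module Core (M v : ℤ)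
          (w₁ : Null (P₂ * P₃ * ((P₂ - P₃) * (M + v * P₁)) - V₁))
          (w₂ : Null (P₁ * P₃ * ((P₃ - P₁) * (M + v * P₂)) - V₂))
          (w₃ : Null (P₁ * P₂ * ((P₁ - P₂) * (M + v * P₃)) - V₃)) where

          e₁ e₂ e₃ n : ℤ
          e₁ = P₁ + P₂ + P₃
          e₂ = P₁ * P₂ + P₂ * P₃ + P₁ * P₃
          e₃ = P₁ * P₂ * P₃
          n = v * e₃

          zF : Null (Fp P₁ P₂ P₃ M v)
          zF = null-cancelˡ ((P₂ - P₃) * (P₃ - P₁) * (P₁ - P₂)) (Fp P₁ P₂ P₃ M v)
              (¬null-* {(P₂ - P₃) * (P₃ - P₁)} {P₁ - P₂} (¬null-* {P₂ - P₃} {P₃ - P₁} ¬d₁ ¬d₂) ¬d₃)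
            (null-cancelˡ (P₁ * P₂ * P₃) ((P₂ - P₃) * (P₃ - P₁) * (P₁ - P₂) * Fp P₁ P₂ P₃ M v) ¬e₃ (subst Null (conic-factor P₁ P₂ P₃ M v)
              (conic-cong P₁ P₂ P₃ (P₂ * P₃ * ((P₂ - P₃) * (M + v * P₁))) (P₁ * P₃ * ((P₃ - P₁) * (M + v * P₂)))
                  (P₁ * P₂ * ((P₁ - P₂) * (M + v * P₃))) P₁ P₂ P₃ V₁ V₂ V₃ (null-refl P₁) (null-refl P₂) (null-refl P₃) w₁ w₂ w₃ conic≡0)))

          zG : Null (Gp P₁ P₂ P₃ M v)
          zG = null-cancelˡ (- (P₁ - P₂)) (Gp P₁ P₂ P₃ M v) ¬-d₃
              (null-cancelˡ ((P₂ - P₃) * (P₃ - P₁)) (- (P₁ - P₂) * Gp P₁ P₂ P₃ M v) (¬null-* {P₂ - P₃} {P₃ - P₁} ¬d₁ ¬d₂)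
            (null-cancelˡ (P₁ * P₂ * P₃ * P₃) ((P₂ - P₃) * (P₃ - P₁) * (- (P₁ - P₂) * Gp P₁ P₂ P₃ M v)) (¬null-* {P₁ * P₂ * P₃} {P₃} ¬e₃ ¬P₃)
                (subst Null (cubic-factor P₁ P₂ P₃ M v)
              (cubic-cong P₁ P₂ P₃ (P₂ * P₃ * ((P₂ - P₃) * (M + v * P₁))) (P₁ * P₃ * ((P₃ - P₁) * (M + v * P₂)))
                  (P₁ * P₂ * ((P₁ - P₂) * (M + v * P₃))) P₁ P₂ P₃ V₁ V₂ V₃ (null-refl P₁) (null-refl P₂) (null-refl P₃) w₁ w₂ w₃ cubic≡0))))
            where
            ¬-d₃ : ¬ Null (- (P₁ - P₂))
            ¬-d₃ z = ¬d₃ (null-≡ (lem (P₁ - P₂)) (null-neg z))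
              where
              lem : ∀ a → a ≡ - - a
              lem = solve-∀

          zJ : Null ((+ 3 * M + v * e₁) * Jp P₁ P₂ P₃ M v)
          zJ = null-≡ (elimination P₁ P₂ P₃ M v)
            (null-- (null-* ((M + v * P₁) * (M + v * P₂) * P₃ - (M * M * e₁ + M * v * e₂ + v * v * e₃) + v * (+ 1 + n)) zF) (null-* M zG))

          ¬Y₃ : ¬ Null (Y P₃ e₁ n M)
          ¬Y₃ z = ¬V₁₂ (transfer (P₂ * P₃ * ((P₂ - P₃) * (M + v * P₁))) V₁ (P₁ * P₃ * ((P₃ - P₁) * (M + v * P₂))) V₂ w₁ w₂
              (null-≡ (parallel-factor P₁ P₂ P₃ M v) (null-* (- (P₁ - P₂)) z)))

          ¬Y₁ : ¬ Null (Y P₁ e₁ n M)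
          ¬Y₁ z = ¬V₂₃ (transfer (P₁ * P₃ * ((P₃ - P₁) * (M + v * P₂))) V₂ (P₁ * P₂ * ((P₁ - P₂) * (M + v * P₃))) V₃ w₂ w₃
              (null-≡ (parallel-factor₁ P₁ P₂ P₃ M v) (null-* (- (P₂ - P₃)) z)))

          ¬Y₂ : ¬ Null (Y P₂ e₁ n M)
          ¬Y₂ z = ¬V₁₃ (transfer (P₂ * P₃ * ((P₂ - P₃) * (M + v * P₁))) V₁ (P₁ * P₂ * ((P₁ - P₂) * (M + v * P₃))) V₃ w₁ w₃
              (null-≡ (parallel-factor₂ P₁ P₂ P₃ M v) (null-* (- (P₃ - P₁)) z)))

          ¬J : ¬ Null M → ¬ Null (Jp P₁ P₂ P₃ M v)
          ¬J ¬M z = ¬null-* {Y P₁ e₁ n M * Y P₂ e₁ n M} {Y P₃ e₁ n M} (¬null-* {Y P₁ e₁ n M} {Y P₂ e₁ n M} ¬Y₁ ¬Y₂) ¬Y₃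
            (null-≡ (Y-product P₁ P₂ P₃ M v) (null-* e₃
              (null-cancelˡ (+ 4 * (M * M)) (Yp P₁ P₂ P₃ M v) (¬null-* {+ 4} {M * M} (¬null-* {+ 2} {+ 2} ¬null-2 ¬null-2) (¬null-* {M} {M} ¬M ¬M))
                (null-≡ (Yp-elimination P₁ P₂ P₃ M v)
                  (null-- (null-* (- (+ 4 * (e₂ * M * M * v)) + e₁ * e₃ * v * v * v - + 4 * (e₁ * M * M * M) + e₁ * v * v + + 2 * (e₃ * M * v * v) + + 4 *
                      (M * v)) zF)
                          (null-* ((+ 4 * M + v * e₁) * (+ 4 * M + v * e₁)) z))))))

          line : Null M → Null (+ 1 + n) → Line
          line zM zn =
            null-≡ (l₁ P₁ P₂ P₃ M v V₁) (null-- (null-+ (null-* (P₂ * P₃ * (P₂ - P₃)) zM) (null-* (P₂ - P₃) zn)) w₁) ,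
            null-≡ (l₂ P₁ P₂ P₃ M v V₂) (null-- (null-+ (null-* (P₁ * P₃ * (P₃ - P₁)) zM) (null-* (P₃ - P₁) zn)) w₂) ,
            null-≡ (l₃ P₁ P₂ P₃ M v V₃) (null-- (null-+ (null-* (P₁ * P₂ * (P₁ - P₂)) zM) (null-* (P₁ - P₂) zn)) w₃)
            where
            l₁ : ∀ P₁ P₂ P₃ M v V → V + (P₂ - P₃) ≡ P₂ * P₃ * (P₂ - P₃) * M + (P₂ - P₃) * (+ 1 + v * (P₁ * P₂ * P₃)) - (P₂ * P₃ * ((P₂ - P₃) * (M + v * P₁)) - V)
            l₁ = solve-∀
            l₂ : ∀ P₁ P₂ P₃ M v V → V + (P₃ - P₁) ≡ P₁ * P₃ * (P₃ - P₁) * M + (P₃ - P₁) * (+ 1 + v * (P₁ * P₂ * P₃)) - (P₁ * P₃ * ((P₃ - P₁) * (M + v * P₂)) - V)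
            l₂ = solve-∀
            l₃ : ∀ P₁ P₂ P₃ M v V → V + (P₁ - P₂) ≡ P₁ * P₂ * (P₁ - P₂) * M + (P₁ - P₂) * (+ 1 + v * (P₁ * P₂ * P₃)) - (P₁ * P₂ * ((P₁ - P₂) * (M + v * P₃)) - V)
            l₃ = solve-∀

          ¬v : Null M → ¬ Null v
          ¬v zM zv = ¬V₁ (null-≡ (lem P₁ P₂ P₃ M v V₁) (null-- (null-+ (null-* (P₂ * P₃ * (P₂ - P₃)) zM) (null-* (P₂ * P₃ * (P₂ - P₃) * P₁) zv)) w₁))
            where
            lem : ∀ P₁ P₂ P₃ M v V₁ → V₁ ≡ P₂ * P₃ * (P₂ - P₃) * M + P₂ * P₃ * (P₂ - P₃) * P₁ * v - (P₂ * P₃ * ((P₂ - P₃) * (M + v * P₁)) - V₁)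
            lem = solve-∀

          core : Line ⊎ Null (+ 3 * M + v * e₁)
          core = decide (null? M)
            (λ zM → [ (λ ze → inj₂ (null-+ (null-* (+ 3) zM) (null-* v ze))) , (λ zn → inj₁ (line zM zn)) ]′
              (null-product e₁ (+ 1 + n) (null-cancelˡ v (e₁ * (+ 1 + n)) (¬v zM)
                (null-≡ (Fp-at-0 P₁ P₂ P₃ M v) (null-- (null-* (M * (e₁ * e₁ - + 4 * e₂) - (+ 4 + + 6 * n)) zM) zF)))))
            (λ ¬M → inj₂ (null-cancelˡ (Jp P₁ P₂ P₃ M v) (+ 3 * M + v * e₁) (¬J ¬M) (null-≡ (ℤₚ.*-comm (Jp P₁ P₂ P₃ M v) (+ 3 * M + v * e₁)) zJ)))

      main-case : ∀ m₁ m₂ m₃ →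
        Null (P₂ * P₃ * ((P₂ - P₃) * m₁) - V₁) → Null (P₁ * P₃ * ((P₃ - P₁) * m₂) - V₂) → Null (P₁ * P₂ * ((P₁ - P₂) * m₃) - V₃) →
        Line ⊎ Null (m₁ + m₂ + m₃)
      main-case m₁ m₂ m₃ h₁ h₂ h₃ = [ inj₁ , (λ z → inj₂ (null-≡ (l₃ m₁ m₂ m₃ (m₁ - v * P₁) v P₁ P₂ P₃) (null-- z (null-+ (null-+ r₁ r₂) r₃)))) ]′
                       (Core.core (m₁ - v * P₁) v (change-slope (P₂ * P₃) (P₂ - P₃) m₁ (m₁ - v * P₁ + v * P₁) V₁ r₁ h₁)
                         (change-slope (P₁ * P₃) (P₃ - P₁) m₂ (m₁ - v * P₁ + v * P₂) V₂ r₂ h₂) (change-slope (P₁ * P₂) (P₁ - P₂) m₃ (m₁ - v * P₁ + v * P₃) V₃ r₃ h₃))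
        where
        -- The affine function of P with slope v takes the values m₁ at P₁ and m₂ at P₂; by
        -- `weighted-sum` its value at P₃ is m₃.
        v = proj₁ (divide (P₁ - P₂) (m₁ - m₂) ¬d₃)
        hv = proj₂ (divide (P₁ - P₂) (m₁ - m₂) ¬d₃)
        change-slope : ∀ a d m m′ V → Null (m′ - m) → Null (a * (d * m) - V) → Null (a * (d * m′) - V)
        change-slope a d m m′ V r h = null-≡ (lem a d m m′ V) (null-+ h (null-* (a * d) r))
          where
          lem : ∀ a d m m′ V → a * (d * m′) - V ≡ (a * (d * m) - V) + a * d * (m′ - m)
          lem = solve-∀
        r₁ : Null (m₁ - v * P₁ + v * P₁ - m₁)
        r₁ = null-≡ (lem m₁ v P₁) null-0
          where
          lem : ∀ m v P → m - v * P + v * P - m ≡ + 0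
          lem = solve-∀
        r₂ : Null (m₁ - v * P₁ + v * P₂ - m₂)
        r₂ = null-≡ (lem m₁ m₂ v P₁ P₂) (null-neg hv)
          where
          lem : ∀ m₁ m₂ v P₁ P₂ → m₁ - v * P₁ + v * P₂ - m₂ ≡ - ((P₁ - P₂) * v - (m₁ - m₂))
          lem = solve-∀
        r₃ : Null (m₁ - v * P₁ + v * P₃ - m₃)
        r₃ = null-cancelˡ (P₁ - P₂) (m₁ - v * P₁ + v * P₃ - m₃) ¬d₃ (null-≡ (lem P₁ P₂ P₃ m₁ m₂ m₃ v)
               (null-neg (null-+ (weighted-sum P₁ P₂ P₃ V₁ V₂ V₃ plücker ¬P₁ ¬P₂ ¬P₃ h₁ h₂ h₃) (null-* (P₃ - P₁) r₂))))
          where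
          lem : ∀ P₁ P₂ P₃ m₁ m₂ m₃ v → (P₁ - P₂) * (m₁ - v * P₁ + v * P₃ - m₃)
            ≡ - (((P₂ - P₃) * m₁ + (P₃ - P₁) * m₂ + (P₁ - P₂) * m₃) + (P₃ - P₁) * (m₁ - v * P₁ + v * P₂ - m₂))
          lem = solve-∀
        l₃ : ∀ m₁ m₂ m₃ M v P₁ P₂ P₃ → m₁ + m₂ + m₃ ≡ (+ 3 * M + v * (P₁ + P₂ + P₃)) - ((M + v * P₁ - m₁) + (M + v * P₂ - m₂) + (M + v * P₃ - m₃))
        l₃ = solve-∀

  module _ (P₁ P₂ P₃ P₄ m₁₂ m₁₃ m₁₄ m₂₃ m₂₄ m₃₄ : ℤ)
    (¬d₁₂ : ¬ Null (P₁ - P₂)) (¬d₂₃ : ¬ Null (P₂ - P₃)) (¬d₂₄ : ¬ Null (P₂ - P₄)) (¬m : ¬ Null m₁₂)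
    (t₁₂₃ : Null (m₁₂ + m₂₃ + m₁₃)) (t₁₂₄ : Null (m₁₂ + m₂₄ + m₁₄)) (t₁₃₄ : Null (m₁₃ + m₃₄ + m₁₄)) (t₂₃₄ : Null (m₂₃ + m₃₄ + m₂₄))
    (w₁₂₃ : Null ((P₁ - P₂) * m₁₂ + (P₂ - P₃) * m₂₃ + (P₃ - P₁) * m₁₃))
    (w₁₂₄ : Null ((P₁ - P₂) * m₁₂ + (P₂ - P₄) * m₂₄ + (P₄ - P₁) * m₁₄))
    (w₁₃₄ : Null ((P₁ - P₃) * m₁₃ + (P₃ - P₄) * m₃₄ + (P₄ - P₁) * m₁₄))
    (w₂₃₄ : Null ((P₂ - P₃) * m₂₃ + (P₃ - P₄) * m₃₄ + (P₄ - P₂) * m₂₄)) where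

    private
      half : ∀ a → Null (+ 2 * a) → Null a
      half a = null-cancelˡ (+ 2) a ¬null-2
      u : Null (m₃₄ - m₁₂)
      u = half (m₃₄ - m₁₂) (null-≡ (lem m₁₂ m₁₃ m₁₄ m₂₃ m₂₄ m₃₄) (null-- (null-- (null-+ t₁₃₄ t₂₃₄) t₁₂₃) t₁₂₄))
        where
        lem : ∀ a b c d e f → + 2 * (f - a) ≡ (b + f + c) + (d + f + e) - (a + d + b) - (a + e + c)
        lem = solve-∀
      v : Null (m₂₄ - m₁₃)
      v = half (m₂₄ - m₁₃) (null-≡ (lem m₁₂ m₁₃ m₁₄ m₂₃ m₂₄ m₃₄) (null-- (null-- (null-+ t₁₂₄ t₂₃₄) t₁₂₃) t₁₃₄))
        where
        lem : ∀ a b c d e f → + 2 * (e - b) ≡ (a + e + c) + (d + f + e) - (a + d + b) - (b + f + c)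
        lem = solve-∀
      w : Null (m₂₃ - m₁₄)
      w = half (m₂₃ - m₁₄) (null-≡ (lem m₁₂ m₁₃ m₁₄ m₂₃ m₂₄ m₃₄) (null-- (null-- (null-+ t₁₂₃ t₂₃₄) t₁₂₄) t₁₃₄))
        where
        lem : ∀ a b c d e f → + 2 * (d - c) ≡ (a + d + b) + (d + f + e) - (a + e + c) - (b + f + c)
        lem = solve-∀
      A = m₁₂
      B = m₁₃
      C = m₁₄
      s : Null (A + B + C)
      s = null-≡ (lem m₁₂ m₁₃ m₁₄ m₂₃) (null-- t₁₂₃ w)
        where
        lem : ∀ a b c d → a + b + c ≡ (a + d + b) - (d - c)
        lem = solve-∀
      -- Modulo u, v, w and s the weighted relations add up in pairs to 3A (P₁ - P₂) + (B - C) (P₃ -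
      -- P₄) = 0 and (B - C) (P₁ - P₂) + 3A (P₃ - P₄) = 0. The determinant of this system is the
      -- product here.
      product : Null ((+ 3 * A - B + C) * (+ 3 * A + B - C))
      product = null-cancelˡ (P₁ - P₂) ((+ 3 * A - B + C) * (+ 3 * A + B - C)) ¬d₁₂ (null-≡ (lem P₁ P₂ P₃ P₄ A B C m₂₃ m₂₄ m₃₄)
        (null-- (null-* (+ 3 * A) (null-+ (null-- (null-- (null-+ w₁₂₃ w₁₂₄) (null-* (P₂ - P₃) w)) (null-* (P₂ - P₄) v)) (null-* (P₁ - P₂) s)))
                (null-* (B - C) (null-+ (null-- (null-- (null-- (null-+ w₁₃₄ w₂₃₄) (null-* (+ 2 * (P₃ - P₄)) u)) (null-* (P₂ - P₃) w))
                    (null-* (P₄ - P₂) v)) (null-* (P₃ - P₄) s)))))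
        where
        lem : ∀ P₁ P₂ P₃ P₄ A B C m₂₃ m₂₄ m₃₄ → (P₁ - P₂) * ((+ 3 * A - B + C) * (+ 3 * A + B - C)) ≡
          + 3 * A * (((P₁ - P₂) * A + (P₂ - P₃) * m₂₃ + (P₃ - P₁) * B) + ((P₁ - P₂) * A + (P₂ - P₄) * m₂₄ + (P₄ - P₁) * C)
            - (P₂ - P₃) * (m₂₃ - C) - (P₂ - P₄) * (m₂₄ - B) + (P₁ - P₂) * (A + B + C))
          - (B - C) * (((P₁ - P₃) * B + (P₃ - P₄) * m₃₄ + (P₄ - P₁) * C) + ((P₂ - P₃) * m₂₃ + (P₃ - P₄) * m₃₄ + (P₄ - P₂) * m₂₄)
            - + 2 * (P₃ - P₄) * (m₃₄ - A) - (P₂ - P₃) * (m₂₃ - C) - (P₄ - P₂) * (m₂₄ - B) + (P₃ - P₄) * (A + B + C))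
        lem = solve-∀
      all-equal : Null (A - B) → Null (A - C) → ⊥
      all-equal x y = ¬m (null-cancelˡ (+ 3) A ¬null-3 (null-≡ (lem A B C) (null-+ (null-+ s x) y)))
        where
        lem : ∀ A B C → + 3 * A ≡ (A + B + C) + (A - B) + (A - C)
        lem = solve-∀

    no-five : ⊥
    no-five = [ case₁ , case₂ ]′ (null-product (+ 3 * A - B + C) (+ 3 * A + B - C) product)
      where
      case₁ : Null (+ 3 * A - B + C) → ⊥
      case₁ z = all-equal A≈B (null-cancelˡ (P₂ - P₃) (A - C) ¬d₂₃ (null-≡ (lem′ P₁ P₂ P₃ A B C m₂₃)
                      (null-- (null-+ (null-* (P₁ - P₃) A≈B) (null-* (P₂ - P₃) w)) w₁₂₃)))
        where
        lem : ∀ A B C → + 2 * (A - B) ≡ (+ 3 * A - B + C) - (A + B + C)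
        lem = solve-∀
        A≈B : Null (A - B)
        A≈B = half (A - B) (null-≡ (lem A B C) (null-- z s))
        lem′ : ∀ P₁ P₂ P₃ A B C m₂₃ → (P₂ - P₃) * (A - C) ≡ (P₁ - P₃) * (A - B) + (P₂ - P₃) * (m₂₃ - C) - ((P₁ - P₂) * A + (P₂ - P₃) * m₂₃ + (P₃ - P₁) * B)
        lem′ = solve-∀
      case₂ : Null (+ 3 * A + B - C) → ⊥
      case₂ z = all-equal (null-cancelˡ (P₂ - P₄) (A - B) ¬d₂₄ (null-≡ (lem′ P₁ P₂ P₄ A B C m₂₄)
                      (null-- (null-+ (null-* (P₁ - P₄) A≈C) (null-* (P₂ - P₄) v)) w₁₂₄))) A≈C
        where
        lem : ∀ A B C → + 2 * (A - C) ≡ (+ 3 * A + B - C) - (A + B + C)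
        lem = solve-∀
        A≈C : Null (A - C)
        A≈C = half (A - C) (null-≡ (lem A B C) (null-- z s))
        lem′ : ∀ P₁ P₂ P₄ A B C m₂₄ → (P₂ - P₄) * (A - B) ≡ (P₁ - P₄) * (A - C) + (P₂ - P₄) * (m₂₄ - B) - ((P₁ - P₂) * A + (P₂ - P₄) * m₂₄ + (P₄ - P₁) * C)
        lem′ = solve-∀

-- Configurations of four and five terms of U

module Structure (p : ℕ) (pr : Prime p) (7≤p : 7 ≤ p) (U : List Pt)
  (len : suc (length U) ≡ 2 ℕ.* p) (zU : PlaneSums.ZeroSum p pr U) (ns : ¬ PlaneSums.Short p pr U) where
  open Residues p pr
  open PlaneSums p pr
  open Minimal p pr U len zU ns
  open Configurations p pr (≤-trans (m≤m+n 5 2) 7≤p)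

  ¬null-anti : ∀ x y → ¬ Null (det x y) → ¬ Null (det y x)
  ¬null-anti x y h z = h (null-≡ (det-anti y x) (null-neg z))

  -- The difference of a and b is parallel to n. This converts statements about [x, a] and [x, b]
  -- into statements about [n, x], and back.
  exchange : ∀ n x a b → Null (det n a - det n b) → Null (det n x * det a b - det n a * (det x b - det x a))
  exchange n x a b z = null-≡ (trans (cong (_- det n a * (det x b - det x a)) (plücker-identity n x a b)) (lem (det n a) (det n b) (det x a) (det x b)))
    (null-* (det x a) z)
    where
    lem : ∀ na nb xa xb → na * xb - nb * xa - na * (xb - xa) ≡ xa * (na - nb)
    lem = solve-∀

  record Quad (a b c d : Pt) : Set where
    constructor quad
    field
      {rest} : List Pt
      perm : U ↭ a ∷ b ∷ c ∷ d ∷ rest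
      ab : ¬ Null (det a b)
      ac : ¬ Null (det a c)
      ad : ¬ Null (det a d)
      bc : ¬ Null (det b c)
      bd : ¬ Null (det b d)
      cd : ¬ Null (det c d)

  swap₁₂ : ∀ {a b c d} → Quad a b c d → Quad b a c d
  swap₁₂ {a} {b} (quad r ab ac ad bc bd cd) = quad (↭-trans r (swap a b ↭-refl)) (¬null-anti a b ab) bc bd ac ad cd

  swap₂₃ : ∀ {a b c d} → Quad a b c d → Quad a c b d
  swap₂₃ {a} {b} {c} (quad r ab ac ad bc bd cd) = quad (↭-trans r (prep a (swap b c ↭-refl))) ac ab ad (¬null-anti b c bc) cd bd

  swap₃₄ : ∀ {a b c d} → Quad a b c d → Quad a b d c
  swap₃₄ {a} {b} {c} {d} (quad r ab ac ad bc bd cd) = quad (↭-trans r (prep a (prep b (swap c d ↭-refl)))) ab ad ac bd bc (¬null-anti c d cd)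

  -- x, y, z are on the line det n = δ, and w is on this line or on its parallel through 0.
  record Flat : Set where
    field
      n x y z w : Pt
      points : Quad x y z w
      δ : ℤ
      δ≢0 : ¬ Null δ
      nx : Null (det n x - δ)
      ny : Null (det n y - δ)
      nz : Null (det n z - δ)
      nw : Null (det n w - δ) ⊎ Null (det n w)

  -- The direction of the line is n = x - y, and δ = [x, y] is non-zero because x and y lie on
  -- different lines through 0.
  flat : ∀ {x y z w} → Quad x y z w → Null (det x y + det y z + det z x) →
    Null (det w x - det w y) ⊎ Null (det x y + det y w + det w x) → Flat
  flat {x} {y} {z} {w} q col h = record
    { n = x ⊖ y ; points = q ; δ = det x y ; δ≢0 = Quad.ab q
    ; nx = null-≡ (trans (cong₂ _-_ (trans (det-⊖ˡ x y x) (cong₂ _-_ (det-self x) (det-anti x y))) refl) (l₁ (det x y))) null-0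
    ; ny = null-≡ (trans (cong (_- det x y) (trans (det-⊖ˡ x y y) (cong (λ u → det x y - u) (det-self y)))) (l₂ (det x y))) null-0
    ; nz = on z col
    ; nw = [ (λ par → inj₂ (null-≡ (trans (det-⊖ˡ x y w) (trans (cong₂ _-_ (det-anti w x) (det-anti w y)) (l₄ (det w x) (det w y)))) (null-neg par))) ,
        (λ c → inj₁ (on w c)) ]′ h }
    where
    l₁ : ∀ d → + 0 - - d - d ≡ + 0
    l₁ = solve-∀
    l₂ : ∀ d → d - + 0 - d ≡ + 0
    l₂ = solve-∀
    l₃ : ∀ xy yz zx → - zx - yz - xy ≡ - (xy + yz + zx)
    l₃ = solve-∀
    l₄ : ∀ a b → - a - - b ≡ - (a - b)
    l₄ = solve-∀
    on : ∀ z → Null (det x y + det y z + det z x) → Null (det (x ⊖ y) z - det x y)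
    on z c = null-≡ (trans (cong (_- det x y) (trans (det-⊖ˡ x y z) (cong (_- det y z) (det-anti z x)))) (l₃ (det x y) (det y z) (det z x))) (null-neg c)

  private
    ¬null-P : ∀ {a b c m} → Quad a b c m → ¬ Null (det m a) × ¬ Null (det m b) × ¬ Null (det m c)
    ¬null-P {a} {b} {c} {m} q = ¬null-anti a m (Quad.ad q) , ¬null-anti b m (Quad.bd q) , ¬null-anti c m (Quad.cd q)

    quad-parallel : ∀ {a b c m} → Quad a b c m → Null (det m a - det m b) →
      Null (det m a - det m c) ⊎ (Null (det b c - (det m c - det m a)) × Null (det c a - det m a))
        ⊎ (Null (det b c + det m a) × Null (det c a - (det m a - det m c)))
    quad-parallel {a} {b} {c} {m} q = parallel-case (det m a) (det m b) (det m c) (det b c) (det c a) (det a b) (plücker-sum m a b c)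
      (proj₁ (¬null-P q)) (proj₁ (proj₂ (¬null-P q))) (proj₂ (proj₂ (¬null-P q)))
      (Quad.bc q) (¬null-anti a c (Quad.ac q)) (Quad.ab q) (conic-eq (Quad.perm q)) (cubic-eq (Quad.perm q))

  -- In the last two alternatives of `parallel-case`, c and m are collinear with one of a and b, on
  -- a line parallel to the other one.
  parallel⇒flat : ∀ {a b c m} → Quad a b c m → Null (det m a - det m b) → Flat
  parallel⇒flat {a} {b} {c} {m} q z = [ case₁ , [ case₂ , case₃ ]′ ]′ (quad-parallel q z)
    where
    case₁ : Null (det m a - det m c) → Flat
    case₁ z′ = flat q (null-cancelˡ (det m a) (det a b + det b c + det c a) (proj₁ (¬null-P q))
      (null-≡ (trans (lem (det m a) (det m b) (det m c) (det b c) (det c a) (det a b))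
                 (cong (λ u → u + det c a * (det m a - det m b) + det a b * (det m a - det m c)) (plücker-sum m a b c)))
              (null-+ (null-+ null-0 (null-* (det c a) z)) (null-* (det a b) z′)))) (inj₁ z)
      where
      lem : ∀ P₁ P₂ P₃ V₁ V₂ V₃ → P₁ * (V₃ + V₁ + V₂) ≡ (P₁ * V₁ + P₂ * V₂ + P₃ * V₃) + V₂ * (P₁ - P₂) + V₃ * (P₁ - P₃)
      lem = solve-∀
    case₂ : Null (det b c - (det m c - det m a)) × Null (det c a - det m a) → Flat
    case₂ (e , e′) = flat (swap₂₃ (swap₃₄ (swap₁₂ (swap₂₃ (swap₁₂ q)))))
      (null-≡ (trans (cong (λ u → u + det m b + det b c) (det-anti m c)) (l₁ (det m a) (det m b) (det m c) (det b c))) (null-- e z))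
      (inj₁ (null-≡ (trans (cong₂ _-_ (det-anti c a) (det-anti m a)) (l₂ (det c a) (det m a))) (null-neg e′)))
      where
      l₁ : ∀ P₁ P₂ P₃ V₁ → - P₃ + P₂ + V₁ ≡ (V₁ - (P₃ - P₁)) - (P₁ - P₂)
      l₁ = solve-∀
      l₂ : ∀ a b → - a - - b ≡ - (a - b)
      l₂ = solve-∀
    case₃ : Null (det b c + det m a) × Null (det c a - (det m a - det m c)) → Flat
    case₃ (e , e′) = flat (swap₂₃ (swap₃₄ (swap₁₂ (swap₂₃ q))))
      (null-≡ (trans (cong₂ (λ u v → u + det m a + v) (det-anti m c) (det-anti c a)) (l₁ (det m a) (det m c) (det c a))) (null-neg e′))
      (inj₁ (null-≡ (trans (cong (λ u → det b c - u) (det-anti m b)) (l₂ (det m a) (det m b) (det b c))) (null-- e z)))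
      where
      l₁ : ∀ P₁ P₃ V₂ → - P₃ + P₁ + - V₂ ≡ - (V₂ - (P₁ - P₃))
      l₁ = solve-∀
      l₂ : ∀ P₁ P₂ V₁ → V₁ - - P₂ ≡ (V₁ + P₁) - (P₁ - P₂)
      l₂ = solve-∀

  -- The slopes enter as arbitrary solutions of their defining congruences, so no choice of a
  -- quotient modulo p is built in, and quadruples with a common pair can share its slope.
  record Sporadic (a b c m : Pt) : Set where
    field
      mab : ¬ Null (det m a - det m b)
      mbc : ¬ Null (det m b - det m c)
      mca : ¬ Null (det m c - det m a)
      slopes : ∀ m₁ m₂ m₃ →
        Null (det m b * det m c * ((det m b - det m c) * m₁) - det b c) →
        Null (det m a * det m c * ((det m c - det m a) * m₂) - det c a) →
        Null (det m a * det m b * ((det m a - det m b) * m₃) - det a b) → Null (m₁ + m₂ + m₃)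

  sporadic : ∀ {a b c m} → Quad a b c m →
    ¬ Null (det m a - det m b) → ¬ Null (det m b - det m c) → ¬ Null (det m c - det m a) →
    ¬ Null (det c a - det c b) → ¬ Null (det a b - det a c) → ¬ Null (det b c - det b a) →
    ¬ (Null (det b c + (det m b - det m c)) × Null (det c a + (det m c - det m a)) × Null (det a b + (det m a - det m b))) →
    Sporadic a b c m
  sporadic {a} {b} {c} {m} q mab mbc mca cab abc bca ¬line = record
    { mab = mab ; mbc = mbc ; mca = mca
    ; slopes = λ m₁ m₂ m₃ h₁ h₂ h₃ → [ (λ l → ⊥-elim (¬line l)) , (λ s → s) ]′
        (main-case (det m a) (det m b) (det m c) (det b c) (det c a) (det a b) (plücker-sum m a b c)
          (proj₁ (¬null-P q)) (proj₁ (proj₂ (¬null-P q))) (proj₂ (proj₂ (¬null-P q)))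
          (Quad.bc q) (¬null-anti a c (Quad.ac q)) (Quad.ab q) (conic-eq (Quad.perm q)) (cubic-eq (Quad.perm q))
          mbc mca mab
          (λ z → cab (null-≡ (trans (cong (λ u → det c a - u) (det-anti b c)) (l₁ (det c a) (det b c))) z))
          (λ z → abc (null-≡ (trans (cong (λ u → det a b - u) (det-anti c a)) (l₁ (det a b) (det c a))) z))
          (λ z → bca (null-≡ (trans (cong (λ u → det b c - u) (det-anti a b)) (l₂ (det b c) (det a b))) z))
          m₁ m₂ m₃ h₁ h₂ h₃) }
    where
    l₁ : ∀ a b → a - - b ≡ b + a
    l₁ = solve-∀
    l₂ : ∀ a b → a - - b ≡ a + b
    l₂ = solve-∀

  line⇒flat : ∀ {a b c m} → Quad a b c m →
    Null (det b c + (det m b - det m c)) → Null (det c a + (det m c - det m a)) → Null (det a b + (det m a - det m b)) → Flat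
  line⇒flat {a} {b} {c} {m} q z₁ z₂ z₃ = flat q (null-≡ (l (det a b) (det b c) (det c a) (det m a) (det m b) (det m c)) (null-+ (null-+ z₁ z₂) z₃))
    (inj₂ (null-≡ (trans (cong (λ u → det a b + u + det m a) (det-anti m b)) (l′ (det a b) (det m a) (det m b))) z₃))
    where
    l : ∀ x y z P₁ P₂ P₃ → x + y + z ≡ (y + (P₂ - P₃)) + (z + (P₃ - P₁)) + (x + (P₁ - P₂))
    l = solve-∀
    l′ : ∀ x P₁ P₂ → x + - P₂ + P₁ ≡ x + (P₁ - P₂)
    l′ = solve-∀

  dichotomy : ∀ {a b c m} → Quad a b c m → Flat ⊎ Sporadic a b c m
  dichotomy {a} {b} {c} {m} q =
    decide (null? (det m a - det m b)) (λ z → inj₁ (parallel⇒flat q z)) λ n₁ →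
    decide (null? (det m b - det m c)) (λ z → inj₁ (parallel⇒flat (swap₂₃ (swap₁₂ q)) z)) λ n₂ →
    decide (null? (det m c - det m a)) (λ z → inj₁ (parallel⇒flat (swap₁₂ (swap₂₃ q)) z)) λ n₃ →
    decide (null? (det c a - det c b)) (λ z → inj₁ (parallel⇒flat (swap₃₄ q) z)) λ n₄ →
    decide (null? (det a b - det a c)) (λ z → inj₁ (parallel⇒flat (swap₃₄ (swap₂₃ (swap₁₂ q))) z)) λ n₅ →
    decide (null? (det b c - det b a)) (λ z → inj₁ (parallel⇒flat (swap₃₄ (swap₁₂ (swap₂₃ q))) z)) λ n₆ →
    decide (null? (det b c + (det m b - det m c)) ×-dec null? (det c a + (det m c - det m a)) ×-dec null? (det a b + (det m a - det m b)))
      (λ { (z₁ , z₂ , z₃) → inj₁ (line⇒flat q z₁ z₂ z₃) })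
      (λ ¬line → inj₂ (sporadic q n₁ n₂ n₃ n₄ n₅ n₆ ¬line))

  -- The slope of a pair with respect to m does not depend on the third point. Hence six slopes
  -- satisfy four sum relations and four weighted relations simultaneously, as `no-five` requires.
  four-sporadic : ∀ {a b c d m} → Quad a b c m → Quad a b d m → Quad a c d m → Quad b c d m →
    Sporadic a b c m → Sporadic a b d m → Sporadic a c d m → Sporadic b c d m → ⊥
  four-sporadic {a} {b} {c} {d} {m} q₁ q₂ q₃ q₄ s₁ s₂ s₃ s₄ =
    no-five Pa Pb Pc Pd mab mac mad mbc mbd mcd (Sporadic.mab s₁) (Sporadic.mbc s₁) (Sporadic.mbc s₂) ¬mab
      (reorder mbc mac mab (Sporadic.slopes s₁ mbc mac mab hbc (back a c mac hac) hab))
      (reorder mbd mad mab (Sporadic.slopes s₂ mbd mad mab hbd (back a d mad had) hab))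
      (reorder mcd mad mac (Sporadic.slopes s₃ mcd mad mac hcd (back a d mad had) hac))
      (reorder mcd mbd mbc (Sporadic.slopes s₄ mcd mbd mbc hcd (back b d mbd hbd) hbc))
      (weigh a b c mbc mac mab hbc (back a c mac hac) hab ¬a ¬b ¬c) (weigh a b d mbd mad mab hbd (back a d mad had) hab ¬a ¬b ¬d)
      (weigh a c d mcd mad mac hcd (back a d mad had) hac ¬a ¬c ¬d) (weigh b c d mcd mbd mbc hcd (back b d mbd hbd) hbc ¬b ¬c ¬d)
    where
    Pa = det m a
    Pb = det m b
    Pc = det m c
    Pd = det m d
    ¬a = proj₁ (¬null-P q₁)
    ¬b = proj₁ (proj₂ (¬null-P q₁))
    ¬c = proj₂ (proj₂ (¬null-P q₁))
    ¬d = proj₂ (proj₂ (¬null-P q₂))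
    slope : ∀ x y → ¬ Null (det m x) → ¬ Null (det m y) → ¬ Null (det m x - det m y) → ∃ λ s → Null (det m x * det m y * ((det m x - det m y) * s) - det x y)
    slope x y ¬x ¬y ¬xy = proj₁ s , null-≡ (lem (det m x) (det m y) (proj₁ s) (det x y)) (proj₂ s)
      where
      s = divide (det m x * det m y * (det m x - det m y)) (det x y) (¬null-* {det m x * det m y} {det m x - det m y} (¬null-* {det m x} {det m y} ¬x ¬y) ¬xy)
      lem : ∀ P Q s V → P * Q * ((P - Q) * s) - V ≡ P * Q * (P - Q) * s - V
      lem = solve-∀
    flip : ∀ u v → ¬ Null (u - v) → ¬ Null (v - u)
    flip u v n z = n (null-sym {v} {u} z)
    sab = slope a b ¬a ¬b (Sporadic.mab s₁)
    sac = slope a c ¬a ¬c (flip (det m c) (det m a) (Sporadic.mca s₁))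
    sad = slope a d ¬a ¬d (flip (det m d) (det m a) (Sporadic.mca s₂))
    sbc = slope b c ¬b ¬c (Sporadic.mbc s₁)
    sbd = slope b d ¬b ¬d (Sporadic.mbc s₂)
    scd = slope c d ¬c ¬d (Sporadic.mbc s₃)
    mab = proj₁ sab
    mac = proj₁ sac
    mad = proj₁ sad
    mbc = proj₁ sbc
    mbd = proj₁ sbd
    mcd = proj₁ scd
    hab = proj₂ sab
    hac = proj₂ sac
    had = proj₂ sad
    hbc = proj₂ sbc
    hbd = proj₂ sbd
    hcd = proj₂ scd
    ¬mab : ¬ Null mab
    ¬mab z = Quad.ab q₁ (null-≡ (lem (Pa * Pb) (Pa - Pb) mab (det a b)) (null-- (null-* (Pa * Pb * (Pa - Pb)) z) hab))
      where
      lem : ∀ P Q s V → V ≡ P * Q * s - (P * (Q * s) - V)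
      lem = solve-∀
    back : ∀ x y s → Null (det m x * det m y * ((det m x - det m y) * s) - det x y) → Null (det m x * det m y * ((det m y - det m x) * s) - det y x)
    back x y s z = null-≡ (trans (cong (λ u → det m x * det m y * ((det m y - det m x) * s) - u) (det-anti x y)) (lem (det m x) (det m y) s (det x y))) (null-neg z)
      where
      lem : ∀ P Q s V → P * Q * ((Q - P) * s) - - V ≡ - (P * Q * ((P - Q) * s) - V)
      lem = solve-∀
    reorder : ∀ u v w → Null (u + v + w) → Null (w + u + v)
    reorder u v w = null-≡ (lem u v w)
      where
      lem : ∀ u v w → w + u + v ≡ u + v + w
      lem = solve-∀
    weigh : ∀ x y z u v w → Null (det m y * det m z * ((det m y - det m z) * u) - det y z) →
      Null (det m x * det m z * ((det m z - det m x) * v) - det z x) →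
      Null (det m x * det m y * ((det m x - det m y) * w) - det x y) →
      ¬ Null (det m x) → ¬ Null (det m y) → ¬ Null (det m z) →
      Null ((det m x - det m y) * w + (det m y - det m z) * u + (det m z - det m x) * v)
    weigh x y z u v w h₁ h₂ h₃ ¬x ¬y ¬z = reorder ((det m y - det m z) * u) ((det m z - det m x) * v) ((det m x - det m y) * w)
        (weighted-sum (det m x) (det m y) (det m z) (det y z) (det z x) (det x y) {u} {v} {w} (plücker-sum m x y z) ¬x ¬y ¬z h₁ h₂ h₃)

  record Quint (a b c d e : Pt) : Set where
    field
      abcd : Quad a b c d
      abce : Quad a b c e
      abde : Quad a b d e
      acde : Quad a c d e
      bcde : Quad b c d e

  five⇒flat : ∀ {a b c d e} → Quint a b c d e → Flat
  five⇒flat q =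
    [ (λ f → f) , (λ s₁ → [ (λ f → f) , (λ s₂ → [ (λ f → f) , (λ s₃ → [ (λ f → f) ,
      (λ s₄ → ⊥-elim (four-sporadic (Quint.abce q) (Quint.abde q) (Quint.acde q) (Quint.bcde q) s₁ s₂ s₃ s₄)) ]′
      (dichotomy (Quint.bcde q))) ]′ (dichotomy (Quint.acde q))) ]′ (dichotomy (Quint.abde q))) ]′ (dichotomy (Quint.abce q))

  module OnFlat (n : Pt) (δ : ℤ) (δ≢0 : ¬ Null δ) where

    On : Pt → Set
    On x = Null (det n x - δ)

    on⇒≡ : ∀ x y → On x → On y → Null (det n x - det n y)
    on⇒≡ x y hx hy = null-≡ (lem (det n x) (det n y) δ) (null-- hx hy)
      where
      lem : ∀ a b d → a - b ≡ (a - d) - (b - d)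
      lem = solve-∀

    on⇒¬null : ∀ x → On x → ¬ Null (det n x)
    on⇒¬null x hx z = δ≢0 (null-≡ (lem (det n x) δ) (null-- z hx))
      where
      lem : ∀ a d → d ≡ a - (a - d)
      lem = solve-∀

    parallel⇒null : ∀ a b x → On a → On b → ¬ Null (det a b) → Null (det x a - det x b) → Null (det n x)
    parallel⇒null a b x ha hb ¬ab z = null-cancelˡ (det a b) (det n x) ¬ab (null-≡ (lem (det a b) (det n x) (det n a) (det x a) (det x b))
      (null-- (exchange n x a b (on⇒≡ a b ha hb)) (null-* (det n a) z)))
      where
      lem : ∀ ab nx na xa xb → ab * nx ≡ (nx * ab - na * (xb - xa)) - na * (xa - xb)
      lem = solve-∀

    null⇒parallel : ∀ a b x → On a → On b → Null (det n x) → Null (det x a - det x b)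
    null⇒parallel a b x ha hb z = null-cancelˡ (det n a) (det x a - det x b) (on⇒¬null a ha) (null-≡ (lem (det a b) (det n x) (det n a) (det x a) (det x b))
      (null-- (exchange n x a b (on⇒≡ a b ha hb)) (null-* (det a b) z)))
      where
      lem : ∀ ab nx na xa xb → na * (xa - xb) ≡ (nx * ab - na * (xb - xa)) - ab * nx
      lem = solve-∀

    collinear⇒on : ∀ a b x → On a → On b → ¬ Null (det a b) → Null (det a b + (det x a - det x b)) → On x
    collinear⇒on a b x ha hb ¬ab z = null-cancelˡ (det a b) (det n x - δ) ¬ab (null-≡ (lem (det a b) (det n x) (det n a) (det x a) (det x b) δ)
      (null-+ (null-- (exchange n x a b (on⇒≡ a b ha hb)) (null-* (det n a) z)) (null-* (det a b) ha)))
      where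
      lem : ∀ ab nx na xa xb d → ab * (nx - d) ≡ (nx * ab - na * (xb - xa)) - na * (ab + (xa - xb)) + ab * (na - d)
      lem = solve-∀

    private
      Col : Pt → Pt → Pt → Set
      Col a b c = Null (det a b + det b c + det c a)

    through-two : ∀ a b e w → On a → On b → ¬ Null (det a b) → Col a e w → Col b e w → Null (det n e - det n w)
    through-two a b e w ha hb ¬ab ca cb = null-cancelˡ (det a b) (det n e - det n w) ¬ab (null-≡
      (lem (det a b) (det n e) (det n w) (det n a) (det a e) (det b e) (det e a) (det e b) (det w a) (det w b) (det e w) (det-anti a e) (det-anti b e))
      (null-+ (null-- (exchange n e a b (on⇒≡ a b ha hb)) (exchange n w a b (on⇒≡ a b ha hb))) (null-* (det n a) (null-- ca cb))))
      where
      lem : ∀ ab ne nw na ae be ea eb wa wb ew → ea ≡ - ae → eb ≡ - be →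
        ab * (ne - nw) ≡ ((ne * ab - na * (eb - ea)) - (nw * ab - na * (wb - wa))) + na * ((ae + ew + wa) - (be + ew + wb))
      lem ab ne nw na ae be _ _ wa wb ew refl refl = l ab ne nw na ae be wa wb ew
        where
        l : ∀ ab ne nw na ae be wa wb ew →
          ab * (ne - nw) ≡ ((ne * ab - na * (- be - - ae)) - (nw * ab - na * (wb - wa))) + na * ((ae + ew + wa) - (be + ew + wb))
        l = solve-∀

    module _ {e : Pt} (¬on : ¬ On e) (¬par : ¬ Null (det n e)) where

      -- Each alternative that `sporadic` excludes would put e on the line or on its parallel
      -- through 0, or one of a, b, c on that parallel.
      on-sporadic : ∀ a b c → On a → On b → On c → Quad a b c e → Sporadic a b c e
      on-sporadic a b c ha hb hc q = sporadic q
        (λ z → ¬par (parallel⇒null a b e ha hb (Quad.ab q) z)) (λ z → ¬par (parallel⇒null b c e hb hc (Quad.bc q) z))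
        (λ z → ¬par (parallel⇒null c a e hc ha (¬null-anti a c (Quad.ac q)) z))
        (λ z → on⇒¬null c hc (parallel⇒null a b c ha hb (Quad.ab q) z)) (λ z → on⇒¬null a ha (parallel⇒null b c a hb hc (Quad.bc q) z))
        (λ z → on⇒¬null b hb (parallel⇒null c a b hc ha (¬null-anti a c (Quad.ac q)) z))
        (λ l → ¬on (collinear⇒on a b e ha hb (Quad.ab q) (proj₂ (proj₂ l))))

      -- Since w is parallel to the line through a and b, `parallel-case` applies with apex w. Its
      -- first alternative would put e on that line; the other two are the collinearities claimed.
      line-through : ∀ a b w → On a → On b → Null (det n w) → Quad a b e w → Col a e w ⊎ Col b e w
      line-through a b w ha hb zw q = [ (λ z → ⊥-elim (case₁ z)) , [ (λ h → inj₂ (case₂ (proj₁ h))) , (λ h → inj₁ (case₃ (proj₂ h))) ]′ ]′ (quad-parallel q par)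
        where
        par : Null (det w a - det w b)
        par = null⇒parallel a b w ha hb zw
        case₁ : Null (det w a - det w e) → ⊥
        case₁ z = ¬on (null-cancelˡ (det w a) (det n e - δ) (¬null-anti a w (Quad.ad q))
              (null-≡ (lem (det n w) (det a e) (det n a) (det n e) (det w a) (det w e) δ (plücker-identity n w a e))
                (null-- (null-- (null-* (det w e) ha) (null-* δ z)) (null-* (det a e) zw))))
          where
          lem : ∀ nw ae na ne wa we d → nw * ae ≡ na * we - ne * wa → wa * (ne - d) ≡ (we * (na - d) - d * (wa - we)) - ae * nw
          lem nw ae na ne wa we d h = trans (l na ne wa we d)
              (trans (cong (λ u → (we * (na - d) - d * (wa - we)) - u) (sym h)) (l′ nw ae (we * (na - d) - d * (wa - we))))
            where
            l : ∀ na ne wa we d → wa * (ne - d) ≡ (we * (na - d) - d * (wa - we)) - (na * we - ne * wa)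
            l = solve-∀
            l′ : ∀ nw ae u → u - nw * ae ≡ u - ae * nw
            l′ = solve-∀
        case₂ : Null (det b e - (det w e - det w a)) → Col b e w
        case₂ z = null-≡ (trans (cong (λ u → det b e + u + det w b) (det-anti w e)) (l (det b e) (det w a) (det w b) (det w e))) (null-- z par)
          where
          l : ∀ V₁ P₁ P₂ P₃ → V₁ + - P₃ + P₂ ≡ (V₁ - (P₃ - P₁)) - (P₁ - P₂)
          l = solve-∀
        case₃ : Null (det e a - (det w a - det w e)) → Col a e w
        case₃ z = null-≡ (trans (cong₂ (λ u v → u + v + det w a) (det-anti e a) (det-anti w e)) (l (det e a) (det w a) (det w e))) (null-neg z)
          where
          l : ∀ V₂ P₁ P₃ → - V₂ + - P₃ + P₁ ≡ - (V₂ - (P₁ - P₃))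
          l = solve-∀

      -- If w is on the line, all triples of x, y, z, w are sporadic with e, contrary to
      -- `four-sporadic`. If w is on the parallel, each pair among x, y, z has a member collinear
      -- with e and w, so two of the three are, and this forces [n, e] = [n, w] = 0.
      exclude : ∀ x y z w → On x → On y → On z → On w ⊎ Null (det n w) → Quint x y z w e → ⊥
      exclude x y z w hx hy hz (inj₁ hw) q =
        four-sporadic (Quint.abce q) (Quint.abde q) (Quint.acde q) (Quint.bcde q)
          (on-sporadic x y z hx hy hz (Quint.abce q)) (on-sporadic x y w hx hy hw (Quint.abde q))
          (on-sporadic x z w hx hz hw (Quint.acde q)) (on-sporadic y z w hy hz hw (Quint.bcde q))
      exclude x y z w hx hy hz (inj₂ zw) q =
        [ (λ cx → [ (λ _ → [ (λ cy → meet x y hx hy (Quad.ab (Quint.abcd q)) cx cy) , (λ cz → meet x z hx hz (Quad.ac (Quint.abcd q)) cx cz) ]′ through-yz)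
                  , (λ cz → meet x z hx hz (Quad.ac (Quint.abcd q)) cx cz) ]′ through-xz)
        , (λ cy → [ (λ cx → meet x y hx hy (Quad.ab (Quint.abcd q)) cx cy) , (λ cz → meet y z hy hz (Quad.bc (Quint.abcd q)) cy cz) ]′ through-xz) ]′ through-xy
        where
        through-xy : Col x e w ⊎ Col y e w
        through-xy = line-through x y w hx hy zw (swap₃₄ (Quint.abde q))
        through-xz : Col x e w ⊎ Col z e w
        through-xz = line-through x z w hx hz zw (swap₃₄ (Quint.acde q))
        through-yz : Col y e w ⊎ Col z e w
        through-yz = line-through y z w hy hz zw (swap₃₄ (Quint.bcde q))
        meet : ∀ a b → On a → On b → ¬ Null (det a b) → Col a e w → Col b e w → ⊥
        meet a b ha hb ¬ab ca cb = ¬par (null-≡ (l (det n e) (det n w)) (null-+ (through-two a b e w ha hb ¬ab ca cb) zw))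
          where
          l : ∀ a b → a ≡ (a - b) + b
          l = solve-∀

-- Sequences contained in a line and its parallel through 0

split : ∀ {X : Set} {P : X → Set} (P? : Decidable P) (xs : List X) → ∃₂ λ ys zs → xs ↭ ys ++ zs × All P ys × All (λ x → ¬ P x) zs
split P? [] = [] , [] , ↭-refl , [] , []
split P? (x ∷ xs) with P? x | split P? xs
... | yes px | ys , zs , r , py , pz = x ∷ ys , zs , prep x r , px ∷ py , pz
... | no ¬px | ys , zs , r , py , pz = ys , x ∷ zs , ↭-trans (prep x r) (↭-sym (shift x ys zs)) , py , ¬px ∷ pz

∈⇒↭ : ∀ {X : Set} {x : X} {xs} → x ∈ xs → ∃ λ ys → xs ↭ x ∷ ys
∈⇒↭ {x = x} x∈ with ∈-∃++ x∈
... | ys , zs , refl = ys ++ zs , shift x ys zs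

module Rigidity (p : ℕ) (pr : Prime p) (7≤p : 7 ≤ p) where
  open Residues p pr
  open PlaneSums p pr

  NonNull : Pt → Set
  NonNull n = ¬ (Null (proj₁ n) × Null (proj₂ n))

  LineBound : List Pt → Set
  LineBound T = ∀ n → NonNull n → ∀ B R → T ↭ B ++ R → All (λ x → Null (det n x)) B → length B ≤ 4

  lineBound-⊑ : ∀ {T B R} → T ↭ B ++ R → LineBound T → LineBound B
  lineBound-⊑ {R = R} r lb n nn C R′ s = lb n nn C (R′ ++ R) (⊑-trans R C R′ r s)

  det-null : ∀ n x → Null (proj₁ n) → Null (proj₂ n) → Null (det n x)
  det-null n x z z′ = null-≡ (trans (det-coordinates n x) (lem (proj₁ n) (proj₂ n) (proj₁ x) (proj₂ x)))
    (null-- (null-* (proj₂ x) z) (null-* (proj₁ x) z′))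
    where
    lem : ∀ a b c d → a * d - b * c ≡ d * a - c * b
    lem = solve-∀

  det-cong : ∀ n x y → Null (proj₁ x - proj₁ y) → Null (proj₂ x - proj₂ y) → Null (det n x - det n y)
  det-cong n x y z z′ = null-≡ (trans (cong₂ _-_ (det-coordinates n x) (det-coordinates n y)) (lem (proj₁ n) (proj₂ n) (proj₁ x) (proj₂ x) (proj₁ y) (proj₂ y)))
    (null-- (null-* (proj₁ n) z′) (null-* (proj₂ n) z))
    where
    lem : ∀ a b x x′ y y′ → (a * x′ - b * x) - (a * y′ - b * y) ≡ a * (x′ - y′) - b * (x - y)
    lem = solve-∀

  ∑-det : ∀ n δ B → All (λ x → Null (det n x - δ)) B → Null (det n (∑ B) - + length B * δ)
  ∑-det n δ [] [] = null-≡ (cong (_- + 0 * δ) (det-ε n)) (null-≡ (lem δ) null-0)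
    where
    lem : ∀ δ → + 0 - + 0 * δ ≡ + 0
    lem = solve-∀
  ∑-det n δ (x ∷ B) (z ∷ zs) = null-≡ (trans (cong (_- + suc (length B) * δ) (det-⊕ n x (∑ B))) (lem (det n x) (det n (∑ B)) (+ length B) δ))
      (null-+ z (∑-det n δ B zs))
    where
    lem : ∀ a b l δ → a + b - (+ 1 + l) * δ ≡ (a - δ) + (b - l * δ)
    lem = solve-∀

  module _ (U : List Pt) (len : suc (length U) ≡ 2 ℕ.* p) (zU : ZeroSum U) (ns : ¬ Short U) where
    open Minimal p pr U len zU ns
    open Structure p pr 7≤p U len zU ns

    quint : ∀ {a b c d e R} → U ↭ a ∷ b ∷ c ∷ d ∷ e ∷ R →
      ¬ Null (det a b) → ¬ Null (det a c) → ¬ Null (det a d) → ¬ Null (det a e) → ¬ Null (det b c) → ¬ Null (det b d) → ¬ Null (det b e) →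
      ¬ Null (det c d) → ¬ Null (det c e) → ¬ Null (det d e) → Quint a b c d e
    quint {a} {b} {c} {d} {e} {R} r ab ac ad ae bc bd be cd ce de = record
      { abcd = quad r ab ac ad bc bd cd
      ; abce = quad (↭-trans r (prep a (prep b (prep c (swap d e ↭-refl))))) ab ac ae bc be ce
      ; abde = quad (↭-trans r (prep a (prep b (shifts (c ∷ []) (d ∷ e ∷ [])))))  ab ad ae bd be de
      ; acde = quad (↭-trans r (prep a (shifts (b ∷ []) (c ∷ d ∷ e ∷ [])))) ac ad ae cd ce de
      ; bcde = quad (↭-trans r (shifts (a ∷ []) (b ∷ c ∷ d ∷ e ∷ []))) bc bd be cd ce de
      }

    near : ∀ n {a e R} → U ↭ a ∷ e ∷ R → Null (det a e) → Null (det n e - det n a)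
    near n {a} {e} r z = null-≡ (lem (det n a) (det n e)) (null-neg (det-cong n a e (proj₁ (parallel⇒≈ r z)) (proj₂ (parallel⇒≈ r z))))
      where
      lem : ∀ a b → b - a ≡ - (a - b)
      lem = solve-∀

    module _ (F : Flat) where
      open Flat F
      open OnFlat n δ δ≢0

      private
        Good : Pt → Set
        Good e = On e ⊎ Null (det n e)

        on-near : ∀ a e → On a → Null (det n e - det n a) → On e
        on-near a e ha z = null-≡ (lem (det n a) (det n e) δ) (null-+ z ha)
          where
          lem : ∀ a e d → e - d ≡ (e - a) + (a - d)
          lem = solve-∀

        null-near : ∀ a e → Null (det n a) → Null (det n e - det n a) → Null (det n e)
        null-near a e ha z = null-≡ (lem (det n a) (det n e)) (null-+ z ha)
          where
          lem : ∀ a e → e ≡ (e - a) + a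
          lem = solve-∀

        -- If e lies on the line through 0 of one of the four points, then by `parallel⇒≈` it is
        -- congruent to that point and inherits its position. Otherwise the five terms form a
        -- `Quint`, and `exclude` applies.
        rest-good : ∀ e R → U ↭ x ∷ y ∷ z ∷ w ∷ e ∷ R → Good e
        rest-good e R r =
          decide (null? (det n e - δ)) inj₁ λ ¬on →
          decide (null? (det n e)) inj₂ λ ¬par →
          decide (null? (det x e)) (λ h → inj₁ (on-near x e nx (near n (↭-trans r (prep x (shift e (y ∷ z ∷ w ∷ []) R))) h))) λ xe →
          decide (null? (det y e)) (λ h → inj₁ (on-near y e ny (near n (↭-trans r (↭-trans (shift y (x ∷ []) _) (prep y (shift e (x ∷ z ∷ w ∷ []) R)))) h))) λ ye →
          decide (null? (det z e)) (λ h → inj₁ (on-near z e nz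
              (near n (↭-trans r (↭-trans (shift z (x ∷ y ∷ []) _) (prep z (shift e (x ∷ y ∷ w ∷ []) R)))) h))) λ ze →
          decide (null? (det w e)) (λ h → [ (λ hw → inj₁ (on-near w e hw (nearw h))) , (λ hw → inj₂ (null-near w e hw (nearw h))) ]′ nw) λ we →
          ⊥-elim (exclude {e} ¬on ¬par x y z w nx ny nz nw
            (quint r (Quad.ab points) (Quad.ac points) (Quad.ad points) xe (Quad.bc points) (Quad.bd points) ye (Quad.cd points) ze we))
          where
          nearw : Null (det w e) → Null (det n e - det n w)
          nearw = near n (↭-trans r (↭-trans (shift w (x ∷ y ∷ z ∷ []) _) (prep w (shift e (x ∷ y ∷ z ∷ []) R))))

      all-good : ∀ {e} → e ∈ U → Good e
      all-good e∈U with ∈-resp-↭ (Quad.perm points) e∈U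
      ... | here refl = inj₁ nx
      ... | there (here refl) = inj₁ ny
      ... | there (there (here refl)) = inj₁ nz
      ... | there (there (there (here refl))) = nw
      ... | there (there (there (there e∈R))) = rest-good _ (proj₁ (∈⇒↭ e∈R)) (↭-trans (Quad.perm points) (prep x (prep y (prep z (prep w (proj₂ (∈⇒↭ e∈R)))))))

      flat⇒⊥ : LineBound U → ⊥
      flat⇒⊥ lb = conclude (split (λ e → null? (det n e)) U)
        where
        nonNull : NonNull n
        nonNull (h , h′) = on⇒¬null x nx (det-null n x h h′)
        conclude : (∃₂ λ N O → U ↭ N ++ O × All (λ e → Null (det n e)) N × All (λ e → ¬ Null (det n e)) O) → ⊥
        conclude (N , O , r , hN , hO) = count (lb n nonNull N O r hN) (null-cancelˡ δ (+ length O) δ≢0 zero-count)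
          where
          good : All Good (N ++ O)
          good = All-resp-↭ r (All.tabulate all-good)
          onO : ∀ N O → All Good (N ++ O) → All (λ e → ¬ Null (det n e)) O → All On O
          onO (_ ∷ N) O (_ ∷ g) h = onO N O g h
          onO [] [] _ _ = []
          onO [] (o ∷ O) (inj₁ on ∷ g) (_ ∷ h) = on ∷ onO [] O g h
          onO [] (o ∷ O) (inj₂ z ∷ g) (nz ∷ h) = ⊥-elim (nz z)
          zeroN : Null (det n (∑ N))
          zeroN = null-≡ (lem (det n (∑ N)) (+ length N)) (∑-det n (+ 0) N (All.map (λ {e} z → null-≡ (ℤₚ.+-identityʳ (det n e)) z) hN))
            where
            lem : ∀ a l → a ≡ a - l * + 0
            lem = solve-∀
          total : Null (det n (∑ U))
          total = null-≡ (det-coordinates n (∑ U)) (null-- (null-* (proj₁ n) (proj₂ zU)) (null-* (proj₂ n) (proj₁ zU)))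
          zero-count : Null (δ * + length O)
          zero-count = null-≡ (lem (det n (∑ O)) (+ length O) δ)
            (null-- (null-≡ (lem′ (det n (∑ N)) (det n (∑ O)) (det n (∑ U)) (trans (cong (det n) (trans (∑-↭ r) (∑-++ N O))) (det-⊕ n (∑ N) (∑ O))))
                (null-- total zeroN)) (∑-det n δ O (onO N O good hO)))
            where
            lem : ∀ s l δ → δ * l ≡ s - (s - l * δ)
            lem = solve-∀
            lem′ : ∀ a b c → c ≡ a + b → b ≡ c - a
            lem′ a b _ refl = l a b
              where
              l : ∀ a b → b ≡ a + b - a
              l = solve-∀
          count : length N ≤ 4 → Null (+ length O) → ⊥
          count N≤4 z = impossible (∣⇒∣ᵤ z)
            where
            total-length : suc (length N ℕ.+ length O) ≡ 2 ℕ.* p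
            total-length = trans (cong suc (sym (trans (↭-length r) (Listₚ.length-++ N)))) len
            -- O has 0, p or at least 2p terms. Out of 2p - 1 terms this leaves 2p - 1 or p - 1 for
            -- N, both more than 4, or a negative number.
            impossible : p ℕᵈ.∣ length O → ⊥
            impossible (ℕᵈ.divides zero e) = <⇒≱ (≤-trans (m≤m+n 6 8) (*-monoʳ-≤ 2 7≤p))
              (≤-trans (≤-reflexive (sym total-length)) (s≤s (≤-trans (≤-reflexive (trans (cong (length N ℕ.+_) e) (+-identityʳ _))) N≤4)))
            impossible (ℕᵈ.divides (suc zero) e) = <⇒≱ (≤-trans (m≤m+n 6 1) 7≤p)
              (+-cancelʳ-≤ p p 5 (≤-trans (≤-reflexive (trans (cong (p ℕ.+_) (sym (+-identityʳ p))) (sym total-length)))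
                (s≤s (+-mono-≤ N≤4 (≤-reflexive (trans e (+-identityʳ p)))))))
            impossible (ℕᵈ.divides (suc (suc k)) e) = <⇒≱ (≤-reflexive total-length)
              (≤-trans (*-monoˡ-≤ p (m≤m+n 2 k)) (≤-trans (≤-reflexive (sym e)) (m≤n+m (length O) (length N))))

-- Enumeration of the solutions modulo 7

evalMod7 : ∀ {n} → Poly n → (Fin n → ℕ) → ℕ
evalMod7 (var i) σ = σ i
evalMod7 (con k) σ = k %ℕ 7
evalMod7 (a ⊞ b) σ = (evalMod7 a σ ℕ.+ evalMod7 b σ) ℕ.% 7
-- 6 stands for -1; reducing after every operation keeps the numbers of the enumeration small.
evalMod7 (a ⊟ b) σ = (evalMod7 a σ ℕ.+ 6 ℕ.* evalMod7 b σ) ℕ.% 7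
evalMod7 (a ⊠ b) σ = (evalMod7 a σ ℕ.* evalMod7 b σ) ℕ.% 7

vanishes : ∀ {n} → (Fin n → ℕ) → Poly n → Bool
vanishes σ e = evalMod7 e σ ℕ.% 7 ≡ᵇ 0

allVanish : ∀ {n} → (Fin n → ℕ) → List (Poly n) → Bool
allVanish σ [] = true
allVanish σ (e ∷ es) = vanishes σ e ∧ allVanish σ es

someVanish : ∀ {n} → (Fin n → ℕ) → List (List (Poly n)) → Bool
someVanish σ [] = false
someVanish σ (es ∷ ess) = allVanish σ es ∨ someVanish σ ess

private
  P₁ P₂ P₃ V₁ V₂ V₃ : Poly 6
  P₁ = var zero
  P₂ = var (suc zero)
  P₃ = var (suc (suc zero))
  V₁ = var (suc (suc (suc zero)))
  V₂ = var (suc (suc (suc (suc zero))))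
  V₃ = var (suc (suc (suc (suc (suc zero)))))
  3* : Poly 6 → Poly 6
  3* e = con (+ 3) ⊠ e

hypotheses : List (Poly 6)
hypotheses = P₁ ⊠ V₁ ⊞ P₂ ⊠ V₂ ⊞ P₃ ⊠ V₃ ∷ conicᵖ ∷ cubicᵖ ∷ []

-- Degenerate configurations, and the relations 3 x i + y + z = 0 with y, z among the other three points.
conclusions : List (List (Poly 6))
conclusions =
  (P₁ ⊟ P₂ ∷ []) ∷ (P₂ ⊟ P₃ ∷ []) ∷ (P₃ ⊟ P₁ ∷ []) ∷
  (V₁ ⊞ V₂ ∷ []) ∷ (V₂ ⊞ V₃ ∷ []) ∷ (V₁ ⊞ V₃ ∷ []) ∷
  (V₁ ⊞ (P₂ ⊟ P₃) ∷ V₂ ⊞ (P₃ ⊟ P₁) ∷ V₃ ⊞ (P₁ ⊟ P₂) ∷ []) ∷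
  (3* P₁ ⊞ P₂ ⊞ P₃ ∷ V₃ ⊟ V₂ ∷ []) ∷ (3* P₁ ⊞ P₂ ∷ V₃ ⊟ P₁ ∷ []) ∷ (3* P₁ ⊞ P₃ ∷ V₂ ⊞ P₁ ∷ []) ∷
  (3* P₂ ⊞ P₁ ⊞ P₃ ∷ V₁ ⊟ V₃ ∷ []) ∷ (3* P₂ ⊞ P₁ ∷ V₃ ⊞ P₂ ∷ []) ∷ (3* P₂ ⊞ P₃ ∷ V₁ ⊟ P₂ ∷ []) ∷
  (3* P₃ ⊞ P₁ ⊞ P₂ ∷ V₂ ⊟ V₁ ∷ []) ∷ (3* P₃ ⊞ P₁ ∷ V₂ ⊟ P₃ ∷ []) ∷ (3* P₃ ⊞ P₂ ∷ V₁ ⊞ P₃ ∷ []) ∷ []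

test : (Fin 6 → ℕ) → Bool
test σ = not (allVanish σ hypotheses) ∨ someVanish σ conclusions

all₆ : (ℕ → Bool) → Bool
all₆ f = f 1 ∧ f 2 ∧ f 3 ∧ f 4 ∧ f 5 ∧ f 6

check₁ : ℕ → Bool
check₂ : ℕ → ℕ → Bool
check₃ : ℕ → ℕ → ℕ → Bool
check₄ : ℕ → ℕ → ℕ → ℕ → Bool
check₅ : ℕ → ℕ → ℕ → ℕ → ℕ → Bool
check₁ a = all₆ (check₂ a)
check₂ a b = all₆ (check₃ a b)
check₃ a b c = all₆ (check₄ a b c)
check₄ a b c d = all₆ (check₅ a b c d)
check₅ a b c d e = all₆ (λ f → test (env a b c d e f))

-- The type checker runs through all 6^6 tuples of non-zero residues. These suffice because the four
-- terms lie on different lines through 0, so that none of their six determinants vanishes.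
check : all₆ check₁ ≡ true
check = refl

private
  ∧-left : ∀ {a b} → a ∧ b ≡ true → a ≡ true
  ∧-left {true} _ = refl

  ∧-right : ∀ {a b} → a ∧ b ≡ true → b ≡ true
  ∧-right {true} h = h

all₆-sound : ∀ f → all₆ f ≡ true → ∀ k → 1 ≤ k → k < 7 → f k ≡ true
all₆-sound f h 1 _ _ = ∧-left h
all₆-sound f h 2 _ _ = ∧-left (∧-right {f 1} h)
all₆-sound f h 3 _ _ = ∧-left (∧-right {f 2} (∧-right {f 1} h))
all₆-sound f h 4 _ _ = ∧-left (∧-right {f 3} (∧-right {f 2} (∧-right {f 1} h)))
all₆-sound f h 5 _ _ = ∧-left (∧-right {f 4} (∧-right {f 3} (∧-right {f 2} (∧-right {f 1} h))))
all₆-sound f h 6 _ _ = ∧-right {f 5} (∧-right {f 4} (∧-right {f 3} (∧-right {f 2} (∧-right {f 1} h))))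
all₆-sound f h (suc (suc (suc (suc (suc (suc (suc k))))))) _ (s≤s (s≤s (s≤s (s≤s (s≤s (s≤s (s≤s ())))))))

test-true : ∀ a b c d e f → 1 ≤ a → a < 7 → 1 ≤ b → b < 7 → 1 ≤ c → c < 7 → 1 ≤ d → d < 7 → 1 ≤ e → e < 7 → 1 ≤ f → f < 7 →
  test (env a b c d e f) ≡ true
test-true a b c d e f a₁ a₂ b₁ b₂ c₁ c₂ d₁ d₂ e₁ e₂ f₁ f₂ =
  all₆-sound (λ f → test (env a b c d e f)) (all₆-sound (check₅ a b c d)
      (all₆-sound (check₄ a b c) (all₆-sound (check₃ a b) (all₆-sound (check₂ a) (all₆-sound check₁ check a a₁ a₂) b b₁ b₂) c c₁ c₂) d d₁ d₂) e e₁ e₂) f f₁ f₂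

module Vanishing (p : ℕ) (pr : Prime p) where
  open Residues p pr

  AllNull : ∀ {n} → (Fin n → ℤ) → List (Poly n) → Set
  AllNull ρ [] = ⊤
  AllNull ρ (e ∷ es) = Null (⟦ e ⟧ ρ) × AllNull ρ es

  SomeNull : ∀ {n} → (Fin n → ℤ) → List (List (Poly n)) → Set
  SomeNull ρ [] = ⊥
  SomeNull ρ (es ∷ ess) = AllNull ρ es ⊎ SomeNull ρ ess

module Seven (pr : Prime 7) where
  open Residues 7 pr
  open Vanishing 7 pr

  private
    mod-null : ∀ n → Null (+ n - + (n ℕ.% 7))
    mod-null n = residue-null (+ n)

    via : ∀ a b c → Null (a - b) → Null (b - c) → Null (a - c)
    via a b c z z′ = null-≡ (lem a b c) (null-+ z z′)
      where
      lem : ∀ a b c → a - c ≡ (a - b) + (b - c)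
      lem = solve-∀

  module _ {n} {ρ : Fin n → ℤ} {σ : Fin n → ℕ} (h : ∀ i → Null (ρ i - + σ i)) where

    evalMod7-null : ∀ e → Null (⟦ e ⟧ ρ - + evalMod7 e σ)
    evalMod7-null (var i) = h i
    evalMod7-null (con k) = residue-null k
    evalMod7-null (a ⊞ b) = via (⟦ a ⟧ ρ + ⟦ b ⟧ ρ) (+ (x ℕ.+ y)) (+ ((x ℕ.+ y) ℕ.% 7))
      (null-≡ (trans (cong (λ u → ⟦ a ⟧ ρ + ⟦ b ⟧ ρ - u) (ℤₚ.pos-+ x y)) (lem (⟦ a ⟧ ρ) (⟦ b ⟧ ρ) (+ x) (+ y)))
          (null-+ (evalMod7-null a) (evalMod7-null b))) (mod-null (x ℕ.+ y))
      where
      x = evalMod7 a σ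
      y = evalMod7 b σ
      lem : ∀ a b x y → a + b - (x + y) ≡ (a - x) + (b - y)
      lem = solve-∀
    evalMod7-null (a ⊟ b) = via (⟦ a ⟧ ρ - ⟦ b ⟧ ρ) (+ (x ℕ.+ 6 ℕ.* y)) (+ ((x ℕ.+ 6 ℕ.* y) ℕ.% 7))
      (null-≡ (trans (cong (λ u → ⟦ a ⟧ ρ - ⟦ b ⟧ ρ - u) (trans (ℤₚ.pos-+ x (6 ℕ.* y)) (cong (λ u → + x + u) (ℤₚ.pos-* 6 y)))) (lem (⟦ a ⟧ ρ) (⟦ b ⟧ ρ) (+ x) (+ y)))
        (null-- (null-- (evalMod7-null a) (evalMod7-null b)) (null-* (+ y) null-p))) (mod-null (x ℕ.+ 6 ℕ.* y))
      where
      x = evalMod7 a σ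
      y = evalMod7 b σ
      lem : ∀ a b x y → a - b - (x + + 6 * y) ≡ (a - x) - (b - y) - y * + 7
      lem = solve-∀
    evalMod7-null (a ⊠ b) = via (⟦ a ⟧ ρ * ⟦ b ⟧ ρ) (+ (x ℕ.* y)) (+ ((x ℕ.* y) ℕ.% 7))
      (null-≡ (trans (cong (λ u → ⟦ a ⟧ ρ * ⟦ b ⟧ ρ - u) (ℤₚ.pos-* x y)) (lem (⟦ a ⟧ ρ) (⟦ b ⟧ ρ) (+ x) (+ y)))
          (null-+ (null-* (⟦ b ⟧ ρ) (evalMod7-null a)) (null-* (+ x) (evalMod7-null b)))) (mod-null (x ℕ.* y))
      where
      x = evalMod7 a σ
      y = evalMod7 b σ
      lem : ∀ a b x y → a * b - x * y ≡ b * (a - x) + x * (b - y)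
      lem = solve-∀

    vanishes⇒null : ∀ e → vanishes σ e ≡ true → Null (⟦ e ⟧ ρ)
    vanishes⇒null e v = null-≡ (lem (⟦ e ⟧ ρ) (+ x)) (null-+ (evalMod7-null e) (null-≡ (lem′ (+ x) (+ (x ℕ.% 7)) (cong +_ zero′)) (mod-null x)))
      where
      x = evalMod7 e σ
      zero′ : x ℕ.% 7 ≡ 0
      zero′ = ≡ᵇ⇒≡ (x ℕ.% 7) 0 (subst T (sym v) tt)
      lem : ∀ a b → a ≡ (a - b) + b
      lem = solve-∀
      lem′ : ∀ a b → b ≡ + 0 → a ≡ a - b
      lem′ a _ refl = sym (ℤₚ.+-identityʳ a)

    null⇒vanishes : ∀ e → Null (⟦ e ⟧ ρ) → vanishes σ e ≡ true
    null⇒vanishes e z = cong (_≡ᵇ 0) zero′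
      where
      lem : ∀ a b → b ≡ a - (a - b)
      lem = solve-∀
      zero′ : evalMod7 e σ ℕ.% 7 ≡ 0
      zero′ = n∣m⇒m%n≡0 _ 7 (∣⇒∣ᵤ (null-≡ (lem (⟦ e ⟧ ρ) (+ evalMod7 e σ)) (null-- z (evalMod7-null e))))

    allVanish⇐ : ∀ es → AllNull ρ es → allVanish σ es ≡ true
    allVanish⇐ [] _ = refl
    allVanish⇐ (e ∷ es) (z , zs) = cong₂ _∧_ (null⇒vanishes e z) (allVanish⇐ es zs)

    allVanish⇒ : ∀ es → allVanish σ es ≡ true → AllNull ρ es
    allVanish⇒ [] _ = _
    allVanish⇒ (e ∷ es) v = vanishes⇒null e (∧-left v) , allVanish⇒ es (∧-right {vanishes σ e} v)

    someVanish⇒ : ∀ ess → someVanish σ ess ≡ true → SomeNull ρ ess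
    someVanish⇒ (es ∷ ess) v = go (allVanish σ es) refl v
      where
      go : ∀ b → allVanish σ es ≡ b → b ∨ someVanish σ ess ≡ true → SomeNull ρ (es ∷ ess)
      go true  e v = inj₁ (allVanish⇒ es e)
      go false e v = inj₂ (someVanish⇒ ess v)

  residue : ∀ a → ¬ Null a → 1 ≤ a %ℕ 7 × a %ℕ 7 < 7
  residue a na = positive (a %ℕ 7) (residue-null a) , n%ℕd<d a 7
    where
    positive : ∀ r → Null (a - + r) → 1 ≤ r
    positive zero    z = ⊥-elim (na (null-≡ (sym (ℤₚ.+-identityʳ a)) z))
    positive (suc r) z = s≤s z≤n

  seven : ∀ P₁ P₂ P₃ V₁ V₂ V₃ → ¬ Null P₁ → ¬ Null P₂ → ¬ Null P₃ → ¬ Null V₁ → ¬ Null V₂ → ¬ Null V₃ →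
    AllNull (env P₁ P₂ P₃ V₁ V₂ V₃) hypotheses → SomeNull (env P₁ P₂ P₃ V₁ V₂ V₃) conclusions
  seven P₁ P₂ P₃ V₁ V₂ V₃ p₁ p₂ p₃ v₁ v₂ v₃ hyps = someVanish⇒ {ρ = ρ} {σ} near conclusions
    (subst (λ b → not b ∨ someVanish σ conclusions ≡ true) (allVanish⇐ {ρ = ρ} {σ} near hypotheses hyps)
      (test-true _ _ _ _ _ _ (proj₁ (residue P₁ p₁)) (proj₂ (residue P₁ p₁)) (proj₁ (residue P₂ p₂)) (proj₂ (residue P₂ p₂)) (proj₁ (residue P₃ p₃))
          (proj₂ (residue P₃ p₃))
        (proj₁ (residue V₁ v₁)) (proj₂ (residue V₁ v₁)) (proj₁ (residue V₂ v₂)) (proj₂ (residue V₂ v₂)) (proj₁ (residue V₃ v₃)) (proj₂ (residue V₃ v₃))))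
    where
    ρ = env P₁ P₂ P₃ V₁ V₂ V₃
    σ = env (P₁ %ℕ 7) (P₂ %ℕ 7) (P₃ %ℕ 7) (V₁ %ℕ 7) (V₂ %ℕ 7) (V₃ %ℕ 7)
    near : ∀ i → Null (ρ i - + σ i)
    near zero = residue-null P₁
    near (suc zero) = residue-null P₂
    near (suc (suc zero)) = residue-null P₃
    near (suc (suc (suc zero))) = residue-null V₁
    near (suc (suc (suc (suc zero)))) = residue-null V₂
    near (suc (suc (suc (suc (suc zero))))) = residue-null V₃

-- Stated for a variable p with p ≡ 7, because p is a module parameter where the enumeration is
-- applied.
seven : ∀ {p} (pr : Prime p) → p ≡ 7 → let open Residues p pr in let open Vanishing p pr in
  ∀ P₁ P₂ P₃ V₁ V₂ V₃ → ¬ Null P₁ → ¬ Null P₂ → ¬ Null P₃ → ¬ Null V₁ → ¬ Null V₂ → ¬ Null V₃ →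
  AllNull (env P₁ P₂ P₃ V₁ V₂ V₃) hypotheses → SomeNull (env P₁ P₂ P₃ V₁ V₂ V₃) conclusions
seven pr refl = Seven.seven pr

-- Four distinct terms for p = 7

module PlaneBound (p : ℕ) (pr : Prime p) (7≤p : 7 ≤ p) where
  open Residues p pr
  open PlaneSums p pr
  open Rigidity p pr 7≤p

  null-vector : ∀ r x s → ¬ Null (det r x) → Null (det r s) → Null (det x s) → Null (proj₁ s) × Null (proj₂ s)
  null-vector r x s ¬rx zr zx =
    null-cancelˡ (det r x) (proj₁ s) ¬rx (null-≡ (lem (det r x) (det x s) (det s r) (det r s) (proj₁ s) (proj₁ r) (proj₁ x) (det-anti r s)
        (Relation₃.first (cramer r x s)))
      (null-- (null-* (proj₁ x) zr) (null-* (proj₁ r) zx))) ,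
    null-cancelˡ (det r x) (proj₂ s) ¬rx (null-≡ (lem (det r x) (det x s) (det s r) (det r s) (proj₂ s) (proj₂ r) (proj₂ x) (det-anti r s)
        (Relation₃.second (cramer r x s)))
      (null-- (null-* (proj₂ x) zr) (null-* (proj₂ r) zx)))
    where
    lem : ∀ rx xs sr rs s r x → sr ≡ - rs → xs * r + sr * x + rx * s ≡ + 0 → rx * s ≡ x * rs - r * xs
    lem rx xs _ rs s r x refl h = trans (l rx xs rs s r x) (trans (cong (_+ (x * rs - r * xs)) h) (ℤₚ.+-identityˡ _))
      where
      l : ∀ rx xs rs s r x → rx * s ≡ (xs * r + - rs * x + rx * s) + (x * rs - r * xs)
      l = solve-∀

  module _ (U : List Pt) (len : suc (length U) ≡ 2 ℕ.* p) (zU : ZeroSum U) (ns : ¬ Short U) where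
    open Minimal p pr U len zU ns
    open Structure p pr 7≤p U len zU ns

    -- Together with x these are three congruent terms, so that 3x + y + z can be realised by terms
    -- of U.
    Heavy : Pt → List Pt → Set
    Heavy x R = ∃₂ λ n n′ → ∃ λ R′ → R ↭ n ∷ n′ ∷ R′ × x ≈ n × x ≈ n′

    -- A vector is determined by its determinants with r and x, as [r, x] is non-zero. Both vanish
    -- at 3x + y + z, which is therefore zero: a zero-sum subsequence of 5 terms, fewer than p.
    relation⇒⊥ : ∀ {x y z w} (q : Quad x y z w) → Heavy x (Quad.rest q) → ∀ r → ¬ Null (det r x) →
      Null (+ 3 * det r x + det r y + det r z) → Null (det x y + det x z) → ⊥
    relation⇒⊥ {x} {y} {z} {w} q (n , n′ , R′ , s , (xn , xn₂) , (xn′ , xn′₂)) r ¬rx zr zx =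
      ns (x ∷ n ∷ n′ ∷ y ∷ z ∷ [] , w ∷ R′ ,
          ↭-trans (Quad.perm q) (prep x (↭-trans (prep y (prep z (prep w s))) (shifts (y ∷ z ∷ w ∷ []) (n ∷ n′ ∷ []) {R′}))) ,
          s≤s z≤n , ≤-trans (m≤m+n 5 2) 7≤p ,
          null-≡ (lem (proj₁ x) (proj₁ n) (proj₁ n′) (proj₁ y) (proj₁ z)) (null-- (null-- (proj₁ zs) xn) xn′) ,
          null-≡ (lem (proj₂ x) (proj₂ n) (proj₂ n′) (proj₂ y) (proj₂ z)) (null-- (null-- (proj₂ zs) xn₂) xn′₂))
      where
      lem : ∀ x n n′ y z → x + (n + (n′ + (y + (z + + 0)))) ≡ (x + (x + (x + (y + z)))) - (x - n) - (x - n′)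
      lem = solve-∀
      v : Pt
      v = x ⊕ (x ⊕ (x ⊕ (y ⊕ z)))
      det-v : ∀ r → det r v ≡ det r x + (det r x + (det r x + (det r y + det r z)))
      det-v r = trans (det-⊕ r x _) (cong (λ u → det r x + u)
          (trans (det-⊕ r x _) (cong (λ u → det r x + u) (trans (det-⊕ r x _) (cong (λ u → det r x + u) (det-⊕ r y z))))))
      zs : Null (proj₁ v) × Null (proj₂ v)
      zs = null-vector r x v ¬rx
        (null-≡ (trans (det-v r) (l (det r x) (det r y) (det r z))) zr)
        (null-≡ (trans (det-v x) (trans (cong (λ u → u + (u + (u + (det x y + det x z)))) (det-self x)) (l′ (det x y) (det x z)))) zx)
        where
        l : ∀ a b c → a + (a + (a + (b + c))) ≡ + 3 * a + b + c
        l = solve-∀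
        l′ : ∀ b c → + 0 + (+ 0 + (+ 0 + (b + c))) ≡ b + c
        l′ = solve-∀

    open Vanishing p pr using (SomeNull)

    seven-flat : p ≡ 7 → ∀ {a b c m} (q : Quad a b c m) → Heavy a (Quad.rest q) → Heavy b (Quad.rest q) → Heavy c (Quad.rest q) → Flat
    seven-flat p≡7 {a} {b} {c} {m} q ha hb hc =
      cases (seven pr p≡7 (det m a) (det m b) (det m c) (det b c) (det c a) (det a b) ¬ma ¬mb ¬mc (Quad.bc q) (¬null-anti a c (Quad.ac q)) (Quad.ab q)
        (null-≡ (plücker-sum m a b c) null-0 , null-≡ (conic-⟦⟧ _ _ _ _ _ _) (conic-eq (Quad.perm q)) , null-≡ (cubic-⟦⟧ _ _ _ _ _ _) (cubic-eq (Quad.perm q)) , tt))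
      where
      ¬ma = ¬null-anti a m (Quad.ad q)
      ¬mb = ¬null-anti b m (Quad.bd q)
      ¬mc = ¬null-anti c m (Quad.cd q)
      sum⇒par : ∀ x y z → Null (det y z + det z x) → Null (det z x - det z y)
      sum⇒par x y z = null-≡ (trans (cong (λ u → det z x - u) (det-anti y z)) (l (det z x) (det y z)))
        where
        l : ∀ a b → a - - b ≡ b + a
        l = solve-∀
      with-m : ∀ x y → Null (+ 3 * det m x + det m y) → Null (+ 3 * det m x + det m y + det m m)
      with-m x y = null-≡ (trans (cong (λ u → + 3 * det m x + det m y + u) (det-self m)) (ℤₚ.+-identityʳ _))
      plus : ∀ x y z → Null (det x y - det z x) → Null (det x y + det x z)
      plus x y z = null-≡ (trans (cong (λ u → det x y + u) (det-anti z x)) refl)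
      minus : ∀ x y z → Null (det y x + det z x) → Null (det x y + det x z)
      minus x y z h = null-≡ (trans (cong₂ _+_ (det-anti y x) (det-anti z x)) (l (det y x) (det z x))) (null-neg h)
        where
        l : ∀ a b → - a + - b ≡ - (a + b)
        l = solve-∀
      swap+ : ∀ u v → Null (u + v) → Null (v + u)
      swap+ u v = null-≡ (ℤₚ.+-comm v u)
      cases : _ → Flat
      cases (inj₁ (z , _)) = parallel⇒flat q z
      cases (inj₂ (inj₁ (z , _))) = parallel⇒flat (swap₂₃ (swap₁₂ q)) z
      cases (inj₂ (inj₂ (inj₁ (z , _)))) = parallel⇒flat (swap₁₂ (swap₂₃ q)) z
      cases (inj₂ (inj₂ (inj₂ (inj₁ (z , _))))) = parallel⇒flat (swap₃₄ q) (sum⇒par a b c z)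
      cases (inj₂ (inj₂ (inj₂ (inj₂ (inj₁ (z , _)))))) = parallel⇒flat (swap₃₄ (swap₂₃ (swap₁₂ q))) (sum⇒par b c a z)
      cases (inj₂ (inj₂ (inj₂ (inj₂ (inj₂ (inj₁ (z , _))))))) = parallel⇒flat (swap₃₄ (swap₁₂ (swap₂₃ q))) (sum⇒par c a b (swap+ (det b c) (det a b) z))
      cases (inj₂ (inj₂ (inj₂ (inj₂ (inj₂ (inj₂ (inj₁ (z₁ , z₂ , z₃ , _)))))))) = line⇒flat q z₁ z₂ z₃
      cases (inj₂ (inj₂ (inj₂ (inj₂ (inj₂ (inj₂ (inj₂ (inj₁ (z , z′ , _))))))))) =
        ⊥-elim (relation⇒⊥ q ha m ¬ma z (plus a b c z′))
      cases (inj₂ (inj₂ (inj₂ (inj₂ (inj₂ (inj₂ (inj₂ (inj₂ (inj₁ (z , z′ , _)))))))))) =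
        ⊥-elim (relation⇒⊥ (swap₃₄ q) ha m ¬ma (with-m a b z) (plus a b m z′))
      cases (inj₂ (inj₂ (inj₂ (inj₂ (inj₂ (inj₂ (inj₂ (inj₂ (inj₂ (inj₁ (z , z′ , _))))))))))) =
        ⊥-elim (relation⇒⊥ (swap₃₄ (swap₂₃ q)) ha m ¬ma (with-m a c z) (minus a c m z′))
      cases (inj₂ (inj₂ (inj₂ (inj₂ (inj₂ (inj₂ (inj₂ (inj₂ (inj₂ (inj₂ (inj₁ (z , z′ , _)))))))))))) =
        ⊥-elim (relation⇒⊥ (swap₁₂ q) hb m ¬mb z (swap+ (det b c) (det b a) (plus b c a z′)))
      cases (inj₂ (inj₂ (inj₂ (inj₂ (inj₂ (inj₂ (inj₂ (inj₂ (inj₂ (inj₂ (inj₂ (inj₁ (z , z′ , _))))))))))))) =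
        ⊥-elim (relation⇒⊥ (swap₃₄ (swap₁₂ q)) hb m ¬mb (with-m b a z) (minus b a m z′))
      cases (inj₂ (inj₂ (inj₂ (inj₂ (inj₂ (inj₂ (inj₂ (inj₂ (inj₂ (inj₂ (inj₂ (inj₂ (inj₁ (z , z′ , _)))))))))))))) =
        ⊥-elim (relation⇒⊥ (swap₃₄ (swap₂₃ (swap₁₂ q))) hb m ¬mb (with-m b c z) (plus b c m z′))
      cases (inj₂ (inj₂ (inj₂ (inj₂ (inj₂ (inj₂ (inj₂ (inj₂ (inj₂ (inj₂ (inj₂ (inj₂ (inj₂ (inj₁ (z , z′ , _))))))))))))))) =
        ⊥-elim (relation⇒⊥ (swap₁₂ (swap₂₃ q)) hc m ¬mc z (plus c a b z′))
      cases (inj₂ (inj₂ (inj₂ (inj₂ (inj₂ (inj₂ (inj₂ (inj₂ (inj₂ (inj₂ (inj₂ (inj₂ (inj₂ (inj₂ (inj₁ (z , z′ , _)))))))))))))))) =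
        ⊥-elim (relation⇒⊥ (swap₃₄ (swap₁₂ (swap₂₃ q))) hc m ¬mc (with-m c a z) (plus c a m z′))
      cases (inj₂ (inj₂ (inj₂ (inj₂ (inj₂ (inj₂ (inj₂ (inj₂ (inj₂ (inj₂ (inj₂ (inj₂ (inj₂ (inj₂ (inj₂ (inj₁ (z , z′ , _))))))))))))))))) =
        ⊥-elim (relation⇒⊥ (swap₃₄ (swap₂₃ (swap₁₂ (swap₂₃ q)))) hc m ¬mc (with-m c b z) (minus c b m z′))

-- The number of lines met by U, and the bound for planes

module PlaneRigidity (p : ℕ) (pr : Prime p) (7≤p : 7 ≤ p) where
  open Residues p pr
  open PlaneSums p pr
  open Rigidity p pr 7≤p
  open PlaneBound p pr 7≤p

  module _ (U : List Pt) (len : suc (length U) ≡ 2 ℕ.* p) (zU : ZeroSum U) (ns : ¬ Short U) (lb : LineBound U) where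
    open Minimal p pr U len zU ns
    open Structure p pr 7≤p U len zU ns

    private
      nonNull : ∀ a R → U ↭ a ∷ R → NonNull a
      nonNull a R r (z , z′) = ns (a ∷ [] , R , r , ≤-refl , ≤-trans (m≤m+n 1 6) 7≤p ,
        null-≡ (ℤₚ.+-identityʳ (proj₁ a)) z , null-≡ (ℤₚ.+-identityʳ (proj₂ a)) z′)

      -- D collects representatives of distinct lines and N the remaining elements of these lines.
      record Class (D N O : List Pt) : Set where
        field
          a : Pt
          N′ O′ : List Pt
          perm : U ↭ (a ∷ D) ++ ((N′ ++ N) ++ O′)
          splits : O ↭ a ∷ (N′ ++ O′)
          near-a : All (a ≈_) N′
          far : All (λ x → ¬ Null (det a x)) O′
          small : length N′ ≤ 3

      class : ∀ D N o O → U ↭ D ++ (N ++ (o ∷ O)) → Class D N (o ∷ O)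
      class D N o O r = build (split (λ x → null? (det o x)) O)
        where
        build : (∃₂ λ N′ O′ → O ↭ N′ ++ O′ × All (λ x → Null (det o x)) N′ × All (λ x → ¬ Null (det o x)) O′) → Class D N (o ∷ O)
        build (N′ , O′ , s , hN , hO) = record
          { a = o ; N′ = N′ ; O′ = O′ ; perm = perm′ ; splits = prep o s ; near-a = near′ N′ ↭-refl hN ; far = hO
          -- o is itself one of the at most four terms on its line, so three remain.
          ; small = s≤s⁻¹ (lb o (nonNull o _ perm′) (o ∷ N′) (D ++ (N ++ O′)) perm″ (null-≡ (det-self o) null-0 ∷ hN)) }
          where
          perm′ : U ↭ (o ∷ D) ++ ((N′ ++ N) ++ O′)
          perm′ = ↭-trans r (↭-trans (++⁺ˡ D (↭-trans (shift o N O)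
              (prep o (↭-trans (++⁺ˡ N s) (↭-trans (shifts N N′) (↭-reflexive (sym (Listₚ.++-assoc N′ N O′))))))))
                    (shift o D _))
          perm″ : U ↭ (o ∷ N′) ++ (D ++ (N ++ O′))
          perm″ = ↭-trans perm′ (prep o (↭-trans (++⁺ˡ D (↭-reflexive (Listₚ.++-assoc N′ N O′))) (shifts D N′)))
          near′ : ∀ M {K} → N′ ↭ K ++ M → All (λ x → Null (det o x)) M → All (o ≈_) M
          near′ [] t [] = []
          near′ (x ∷ M) {K} t (z ∷ zs) =
            parallel⇒≈ {o} {x} {(K ++ M) ++ (D ++ (N ++ O′))} (↭-trans perm″ (prep o (++⁺ʳ _ (↭-trans t (shift x K M))))) z
            ∷ near′ M {x ∷ K} (↭-trans t (shift x K M)) zs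

      heavy : ∀ x N R → All (x ≈_) N → 2 ≤ length N → ∀ {rest} → rest ↭ N ++ R → Heavy U len zU ns x rest
      heavy x (n ∷ n′ ∷ N) R (h ∷ h′ ∷ _) _ r = n , n′ , N ++ R , r , h , h′
      heavy x (n ∷ []) R _ (s≤s ()) r

      view : ∀ (L : List Pt) → (L ≡ [] → ⊥) → (∀ x xs → L ≡ x ∷ xs → ⊥) → ⊥
      view [] f g = f refl
      view (x ∷ xs) f g = g x xs refl

      too-short : ∀ k → length U ≤ k ℕ.* 4 → k ≤ 3 → ⊥
      too-short k h k≤3 = <⇒≱ (≤-trans (*-monoʳ-≤ 2 7≤p) (≤-reflexive (sym len))) (s≤s (≤-trans h (*-monoˡ-≤ 4 k≤3)))

      only-seven : ∀ p → Prime p → 7 ≤ p → p ≤ 8 → p ≡ 7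
      only-seven p pr 7≤p p≤8 with m≤n⇒m<n∨m≡n p≤8
      ... | inj₁ (s≤s p≤7) = ≤-antisym p≤7 7≤p
      ... | inj₂ refl = contradiction pr (from-no (prime? 8))

      -- 9 - 1 - 3 - 3 = 2: once one class has at most one further element, each of the other three
      -- has at least two.
      large : ∀ x y z w → x ℕ.+ (y ℕ.+ (z ℕ.+ w)) ≡ 9 → ¬ (2 ≤ x) → z ≤ 3 → w ≤ 3 → 2 ≤ y
      large x y z w e ¬x z≤3 w≤3 = decide (2 ≤? y) (λ l → l) (λ ¬y → contradiction
        (≤-trans (≤-reflexive (sym e)) (+-mono-≤ (s≤s⁻¹ (≰⇒> ¬x)) (+-mono-≤ (s≤s⁻¹ (≰⇒> ¬y)) (+-mono-≤ z≤3 w≤3)))) (<⇒≱ ≤-refl))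

      head-far : ∀ {P : Pt → Set} {O x N O′} → All P O → O ↭ x ∷ (N ++ O′) → P x × All P O′
      head-far {N = N} h s with All-resp-↭ s h
      ... | px ∷ ps = px , Allₚ.++⁻ʳ N ps

      -- Each nested module splits off the terms on one more line through 0. Up to three lines hold
      -- at most 12 terms, fewer than 2p - 1; a fifth line yields a `Quint`; exactly four lines are
      -- possible only for p = 7.
      module Classes (o : Pt) (O : List Pt) (r : U ↭ o ∷ O) where

        c₁ : Class [] [] (o ∷ O)
        c₁ = class [] [] o O r
        module C₁ = Class c₁

        module Second (b : Pt) (O₁ : List Pt) (e₁ : C₁.O′ ≡ b ∷ O₁) where
          c₂ : Class (C₁.a ∷ []) (C₁.N′ ++ []) (b ∷ O₁)
          c₂ = class _ _ b O₁ (subst (λ X → U ↭ (C₁.a ∷ []) ++ ((C₁.N′ ++ []) ++ X)) e₁ C₁.perm)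
          module C₂ = Class c₂
          far₁ : ¬ Null (det C₁.a C₂.a) × All (λ x → ¬ Null (det C₁.a x)) C₂.O′
          far₁ = head-far (subst (All _) e₁ C₁.far) C₂.splits

          module Third (c : Pt) (O₂ : List Pt) (e₂ : C₂.O′ ≡ c ∷ O₂) where
            c₃ : Class (C₂.a ∷ C₁.a ∷ []) (C₂.N′ ++ (C₁.N′ ++ [])) (c ∷ O₂)
            c₃ = class _ _ c O₂ (subst (λ X → U ↭ (C₂.a ∷ C₁.a ∷ []) ++ ((C₂.N′ ++ (C₁.N′ ++ [])) ++ X)) e₂ C₂.perm)
            module C₃ = Class c₃
            far₁₃ : ¬ Null (det C₁.a C₃.a) × All (λ x → ¬ Null (det C₁.a x)) C₃.O′
            far₁₃ = head-far (subst (All _) e₂ (proj₂ far₁)) C₃.splits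
            far₂₃ : ¬ Null (det C₂.a C₃.a) × All (λ x → ¬ Null (det C₂.a x)) C₃.O′
            far₂₃ = head-far (subst (All _) e₂ C₂.far) C₃.splits

            module Fourth (d : Pt) (O₃ : List Pt) (e₃ : C₃.O′ ≡ d ∷ O₃) where
              c₄ : Class (C₃.a ∷ C₂.a ∷ C₁.a ∷ []) (C₃.N′ ++ (C₂.N′ ++ (C₁.N′ ++ []))) (d ∷ O₃)
              c₄ = class _ _ d O₃ (subst (λ X → U ↭ (C₃.a ∷ C₂.a ∷ C₁.a ∷ []) ++ ((C₃.N′ ++ (C₂.N′ ++ (C₁.N′ ++ []))) ++ X)) e₃ C₃.perm)
              module C₄ = Class c₄
              far₁₄ : ¬ Null (det C₁.a C₄.a) × All (λ x → ¬ Null (det C₁.a x)) C₄.O′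
              far₁₄ = head-far (subst (All _) e₃ (proj₂ far₁₃)) C₄.splits
              far₂₄ : ¬ Null (det C₂.a C₄.a) × All (λ x → ¬ Null (det C₂.a x)) C₄.O′
              far₂₄ = head-far (subst (All _) e₃ (proj₂ far₂₃)) C₄.splits
              far₃₄ : ¬ Null (det C₃.a C₄.a) × All (λ x → ¬ Null (det C₃.a x)) C₄.O′
              far₃₄ = head-far (subst (All _) e₃ C₃.far) C₄.splits

              anti : ∀ x y → ¬ Null (det x y) → ¬ Null (det y x)
              anti = ¬null-anti

              fifth : ∀ e O₄ → C₄.O′ ≡ e ∷ O₄ → ⊥
              fifth e O₄ e₄ = flat⇒⊥ U len zU ns (five⇒flat (quint U len zU ns {C₄.a} {C₃.a} {C₂.a} {C₁.a} {e}
                (↭-trans (subst (λ X → U ↭ (C₄.a ∷ C₃.a ∷ C₂.a ∷ C₁.a ∷ []) ++ ((C₄.N′ ++ (C₃.N′ ++ (C₂.N′ ++ (C₁.N′ ++ [])))) ++ X)) e₄ C₄.perm)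
                  (prep _ (prep _ (prep _ (prep _ (shift e (C₄.N′ ++ (C₃.N′ ++ (C₂.N′ ++ (C₁.N′ ++ [])))) O₄))))))
                (anti C₃.a C₄.a (proj₁ far₃₄)) (anti C₂.a C₄.a (proj₁ far₂₄)) (anti C₁.a C₄.a (proj₁ far₁₄)) (hd C₄.far)
                (anti C₂.a C₃.a (proj₁ far₂₃)) (anti C₁.a C₃.a (proj₁ far₁₃)) (hd (proj₂ far₃₄))
                (anti C₁.a C₂.a (proj₁ far₁)) (hd (proj₂ far₂₄)) (hd (proj₂ far₁₄)))) lb
                where
                hd : ∀ {P : Pt → Set} → All P C₄.O′ → P e
                hd h with subst (All _) e₄ h
                ... | px ∷ _ = px

              module Few (none : C₄.O′ ≡ []) where
                n₁ = length C₁.N′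
                n₂ = length C₂.N′
                n₃ = length C₃.N′
                n₄ = length C₄.N′

                total : length U ≡ 4 ℕ.+ (n₄ ℕ.+ (n₃ ℕ.+ (n₂ ℕ.+ n₁)))
                total = trans (↭-length (subst (λ X → U ↭ (C₄.a ∷ C₃.a ∷ C₂.a ∷ C₁.a ∷ []) ++ ((C₄.N′ ++ (C₃.N′ ++ (C₂.N′ ++ (C₁.N′ ++ [])))) ++ X)) none C₄.perm))
                  (cong (4 ℕ.+_) (trans (cong length (Listₚ.++-identityʳ (C₄.N′ ++ (C₃.N′ ++ (C₂.N′ ++ (C₁.N′ ++ []))))))
                    (trans (Listₚ.length-++ C₄.N′) (cong (n₄ ℕ.+_) (trans (Listₚ.length-++ C₃.N′) (cong (n₃ ℕ.+_)
                      (trans (Listₚ.length-++ C₂.N′) (cong (λ X → n₂ ℕ.+ length X) (Listₚ.++-identityʳ C₁.N′)))))))))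

                bound : length U ≤ 16
                bound = ≤-trans (≤-reflexive total) (+-monoʳ-≤ 4 (+-mono-≤ C₄.small (+-mono-≤ C₃.small (+-mono-≤ C₂.small C₁.small))))

                -- Four lines with at most four terms each give 2p - 1 ≤ 16, so p ≤ 8, and 8 is not
                -- prime.
                p≡7 : p ≡ 7
                p≡7 = only-seven p pr 7≤p (s≤s⁻¹ (*-cancelˡ-< 2 p 9 (s≤s (≤-trans (≤-reflexive (sym len)) (s≤s bound)))))

                nine : n₄ ℕ.+ (n₃ ℕ.+ (n₂ ℕ.+ n₁)) ≡ 9
                nine = +-cancelˡ-≡ 5 _ _ (trans (cong suc (sym total)) (trans len (cong (2 ℕ.*_) p≡7)))

                q : Quad C₄.a C₃.a C₂.a C₁.a
                q = quad C₄.perm (anti C₃.a C₄.a (proj₁ far₃₄)) (anti C₂.a C₄.a (proj₁ far₂₄)) (anti C₁.a C₄.a (proj₁ far₁₄))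
                  (anti C₂.a C₃.a (proj₁ far₂₃)) (anti C₁.a C₃.a (proj₁ far₁₃)) (anti C₁.a C₂.a (proj₁ far₁))

                rest↭ : Quad.rest q ↭ C₄.N′ ++ (C₃.N′ ++ (C₂.N′ ++ (C₁.N′ ++ C₄.O′)))
                rest↭ = ↭-reflexive (trans (Listₚ.++-assoc C₄.N′ _ C₄.O′) (cong (C₄.N′ ++_) (trans (Listₚ.++-assoc C₃.N′ _ C₄.O′) (cong (C₃.N′ ++_)
                  (trans (Listₚ.++-assoc C₂.N′ _ C₄.O′) (cong (C₂.N′ ++_) (Listₚ.++-assoc C₁.N′ [] C₄.O′)))))))

                h₄ : 2 ≤ n₄ → Heavy U len zU ns C₄.a (Quad.rest q)
                h₄ l = heavy C₄.a C₄.N′ _ C₄.near-a l rest↭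
                h₃ : 2 ≤ n₃ → Heavy U len zU ns C₃.a (Quad.rest q)
                h₃ l = heavy C₃.a C₃.N′ _ C₃.near-a l (↭-trans rest↭ (shifts C₄.N′ C₃.N′))
                h₂ : 2 ≤ n₂ → Heavy U len zU ns C₂.a (Quad.rest q)
                h₂ l = heavy C₂.a C₂.N′ _ C₂.near-a l (↭-trans rest↭ (↭-trans (++⁺ˡ C₄.N′ (shifts C₃.N′ C₂.N′)) (shifts C₄.N′ C₂.N′)))
                h₁ : 2 ≤ n₁ → Heavy U len zU ns C₁.a (Quad.rest q)
                h₁ l = heavy C₁.a C₁.N′ _ C₁.near-a l (↭-trans rest↭
                    (↭-trans (++⁺ˡ C₄.N′ (↭-trans (++⁺ˡ C₃.N′ (shifts C₂.N′ C₁.N′)) (shifts C₃.N′ C₁.N′))) (shifts C₄.N′ C₁.N′)))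

                -- By `large` at most one class is not heavy. If there is one, its representative is
                -- put in the place of m, so that every relation of `conclusions` triples a heavy
                -- point.
                flat-seven : Flat
                flat-seven =
                  decide (2 ≤? n₄) (λ l₄ → decide (2 ≤? n₃) (λ l₃ → decide (2 ≤? n₂)
                    (λ l₂ → seven-flat U len zU ns p≡7 q (h₄ l₄) (h₃ l₃) (h₂ l₂))
                    (λ s → seven-flat U len zU ns p≡7 (swap₃₄ q) (h₄ l₄) (h₃ l₃)
                             (h₁ (large n₂ n₁ n₄ n₃ (trans (s₁ n₁ n₂ n₃ n₄) nine) s C₄.small C₃.small))))
                    (λ s → seven-flat U len zU ns p≡7 (swap₃₄ (swap₂₃ q)) (h₄ l₄)
                             (h₂ (large n₃ n₂ n₄ n₁ (trans (s₂ n₁ n₂ n₃ n₄) nine) s C₄.small C₁.small))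
                             (h₁ (large n₃ n₁ n₄ n₂ (trans (s₃ n₁ n₂ n₃ n₄) nine) s C₄.small C₂.small))))
                    (λ s → seven-flat U len zU ns p≡7 (swap₃₄ (swap₂₃ (swap₁₂ q)))
                             (h₃ (large n₄ n₃ n₂ n₁ nine s C₂.small C₁.small))
                             (h₂ (large n₄ n₂ n₃ n₁ (trans (s₄ n₁ n₂ n₃ n₄) nine) s C₃.small C₁.small))
                             (h₁ (large n₄ n₁ n₃ n₂ (trans (s₅ n₁ n₂ n₃ n₄) nine) s C₃.small C₂.small)))
                  where
                  s₁ : ∀ a b c d → b ℕ.+ (a ℕ.+ (d ℕ.+ c)) ≡ d ℕ.+ (c ℕ.+ (b ℕ.+ a))
                  s₁ = solveℕ
                  s₂ : ∀ a b c d → c ℕ.+ (b ℕ.+ (d ℕ.+ a)) ≡ d ℕ.+ (c ℕ.+ (b ℕ.+ a))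
                  s₂ = solveℕ
                  s₃ : ∀ a b c d → c ℕ.+ (a ℕ.+ (d ℕ.+ b)) ≡ d ℕ.+ (c ℕ.+ (b ℕ.+ a))
                  s₃ = solveℕ
                  s₄ : ∀ a b c d → d ℕ.+ (b ℕ.+ (c ℕ.+ a)) ≡ d ℕ.+ (c ℕ.+ (b ℕ.+ a))
                  s₄ = solveℕ
                  s₅ : ∀ a b c d → d ℕ.+ (a ℕ.+ (c ℕ.+ b)) ≡ d ℕ.+ (c ℕ.+ (b ℕ.+ a))
                  s₅ = solveℕ

              fourth : ⊥
              fourth = view C₄.O′ (λ e → flat⇒⊥ U len zU ns (Few.flat-seven e) lb) fifth

            third : ⊥
            third = view C₃.O′ (λ e → too-short 3 (≤-trans (≤-reflexive
                (trans (↭-length (subst (λ X → U ↭ (C₃.a ∷ C₂.a ∷ C₁.a ∷ []) ++ ((C₃.N′ ++ (C₂.N′ ++ (C₁.N′ ++ []))) ++ X)) e C₃.perm))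
                (cong (3 ℕ.+_) (trans (cong length (Listₚ.++-identityʳ (C₃.N′ ++ (C₂.N′ ++ (C₁.N′ ++ [])))))
                    (trans (Listₚ.length-++ C₃.N′) (cong (length C₃.N′ ℕ.+_)
                    (trans (Listₚ.length-++ C₂.N′) (cong (λ X → length C₂.N′ ℕ.+ length X) (Listₚ.++-identityʳ C₁.N′)))))))))
                (+-monoʳ-≤ 3 (+-mono-≤ C₃.small (+-mono-≤ C₂.small C₁.small)))) ≤-refl)
              Fourth.fourth

          second : ⊥
          second = view C₂.O′ (λ e → too-short 2 (≤-trans (≤-reflexive
              (trans (↭-length (subst (λ X → U ↭ (C₂.a ∷ C₁.a ∷ []) ++ ((C₂.N′ ++ (C₁.N′ ++ [])) ++ X)) e C₂.perm))
                (cong (2 ℕ.+_) (trans (cong length (Listₚ.++-identityʳ (C₂.N′ ++ (C₁.N′ ++ []))))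
                    (trans (Listₚ.length-++ C₂.N′) (cong (λ X → length C₂.N′ ℕ.+ length X) (Listₚ.++-identityʳ C₁.N′)))))))
                (+-monoʳ-≤ 2 (+-mono-≤ C₂.small C₁.small))) (n≤1+n 2))
              Third.third

        first : ⊥
        first = view C₁.O′ (λ e → too-short 1 (≤-trans (≤-reflexive (trans (↭-length (subst (λ X → U ↭ (C₁.a ∷ []) ++ ((C₁.N′ ++ []) ++ X)) e C₁.perm))
                (cong (1 ℕ.+_) (trans (cong length (Listₚ.++-identityʳ (C₁.N′ ++ []))) (cong length (Listₚ.++-identityʳ C₁.N′))))))
                (s≤s C₁.small)) (≤-trans (n≤1+n 1) (n≤1+n 2)))
              Second.second

    rigid : ⊥
    rigid = view U (λ e → too-short 1 (≤-trans (≤-reflexive (cong length e)) z≤n) (≤-trans (n≤1+n 1) (n≤1+n 2)))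
                   (λ o O e → Classes.first o O (↭-reflexive e))

  plane-bound : ∀ T → 3 ℕ.* p ≤ 3 ℕ.+ length T → LineBound T → ¬ Short T → ⊥
  plane-bound T h lb ns = exact (take n T) (trans (cong (3 ℕ.+_) (trans (Listₚ.length-take n T) (m≤n⇒m⊓n≡m n≤T))) 3+n)
      (lineBound-⊑ (take-⊑ n T) lb) (λ s → ns (short-⊑ (take-⊑ n T) s))
    where
    n = 3 ℕ.* p ∸ 3
    3+n : 3 ℕ.+ n ≡ 3 ℕ.* p
    3+n = m+[n∸m]≡n (*-monoʳ-≤ 3 (≤-trans (m≤m+n 1 6) 7≤p))
    n≤T : n ≤ length T
    n≤T = +-cancelˡ-≤ 3 n (length T) (≤-trans (≤-reflexive 3+n) h)
    exact : ∀ T → 3 ℕ.+ length T ≡ 3 ℕ.* p → LineBound T → ¬ Short T → ⊥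
    exact T e lb ns with long-zeroSum T e ns
    ... | U , R , r , len , zU = rigid U len zU (λ s → ns (short-⊑ r s)) (lineBound-⊑ r lb)

-- Pigeonhole principles, over colours and over projective points

sum-bound : ∀ a b {m n} → m ℕ.+ n < a ℕ.+ b → m < a ⊎ n < b
sum-bound a b {m} {n} h = decide (m <? a) inj₁ (λ m≮a → inj₂ (+-cancelˡ-< a n b (≤-<-trans (+-monoˡ-≤ n (≮⇒≥ m≮a)) h)))

length-split : ∀ {X : Set} {L : List X} M R → L ↭ M ++ R → length L ≡ length M ℕ.+ length R
length-split M R r = trans (↭-length r) (Listₚ.length-++ M)

pigeonhole : ∀ {X : Set} (f : X → ℕ) n B L → All (λ x → f x < n) L → n ℕ.* B < length L →
  ∃ λ c → ∃₂ λ M R → L ↭ M ++ R × All (λ x → f x ≡ c) M × B < length M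
pigeonhole f zero B [] _ ()
pigeonhole f zero B (x ∷ L) (() ∷ _) _
pigeonhole f (suc n) B L h l with split (λ x → f x ℕ.≟ n) L
... | M , R , r , hM , hR with sum-bound (length M) (length R) (<-≤-trans l (≤-reflexive (length-split M R r)))
...   | inj₁ B<M = n , M , R , r , hM , B<M
...   | inj₂ B<R with pigeonhole f n B R (All.zipWith (λ { (f≢n , f<1+n) → ≤∧≢⇒< (s≤s⁻¹ f<1+n) f≢n }) (hR , Allₚ.++⁻ʳ M (All-resp-↭ r h))) B<R
...     | c , M′ , R′ , r′ , hM′ , B<M′ = c , M′ , R′ ++ M , ⊑-trans M M′ R′ (↭-trans r (++-comm M R)) r′ , hM′ , B<M′

-- The number (p^e - 1)/(p - 1) of points of the projective space of an e-dimensional space over the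
-- field with p elements. The recursion separates the points with non-zero first coordinate from
-- those in a hyperplane, as in `projective-pigeonhole`.
points : ℕ → ℕ → ℕ
points p zero    = 0
points p (suc e) = p ^ e ℕ.+ points p e

points-geometric : ∀ q e → points (suc q) e ℕ.* q ℕ.+ 1 ≡ suc q ^ e
points-geometric q zero    = refl
points-geometric q (suc e) = trans (lem (suc q ^ e) (points (suc q) e) q) (trans (cong (suc q ^ e ℕ.* q ℕ.+_) (points-geometric q e)) (lem′ (suc q ^ e) q))
  where
  lem : ∀ a b q → (a ℕ.+ b) ℕ.* q ℕ.+ 1 ≡ a ℕ.* q ℕ.+ (b ℕ.* q ℕ.+ 1)
  lem = solveℕ
  lem′ : ∀ a q → a ℕ.* q ℕ.+ a ≡ a ℕ.+ q ℕ.* a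
  lem′ = solveℕ

points-suc : ∀ p e → points p (suc e) ≡ 1 ℕ.+ p ℕ.* points p e
points-suc p zero    = cong (1 ℕ.+_) (sym (*-zeroʳ p))
points-suc p (suc e) = trans (cong (p ^ suc e ℕ.+_) (points-suc p e)) (lem p (p ^ e) (points p e))
  where
  lem : ∀ p a b → p ℕ.* a ℕ.+ (1 ℕ.+ p ℕ.* b) ≡ 1 ℕ.+ p ℕ.* (a ℕ.+ b)
  lem = solveℕ

module Projective (p : ℕ) (pr : Prime p) where
  open Residues p pr

  Proportional : ∀ {e} → (Fin e → ℤ) → (Fin e → ℤ) → Set
  Proportional u v = ∀ i j → Null (u i * v j - u j * v i)

  opaque
    inv : ℤ → ℤ
    inv a with null? a
    -- A default that makes `inv` total, so that it can be used in the colour of a vector without a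
    -- proof argument.
    ... | yes _ = + 0
    ... | no na = proj₁ (inverse a na)

    inv-null : ∀ a → ¬ Null a → Null (a * inv a - + 1)
    inv-null a na with null? a
    ... | yes z = ⊥-elim (na z)
    ... | no na = proj₂ (inverse a na)

  reduce : ℤ → Fin p
  reduce a = fromℕ< (n%ℕd<d a p)

  reduce-null : ∀ a b → reduce a ≡ reduce b → Null (a - b)
  reduce-null a b e = null-≡ (lem a b (+ (a %ℕ p)) (+ (b %ℕ p))
      (cong +_ (trans (sym (Finₚ.toℕ-fromℕ< (n%ℕd<d a p))) (trans (cong toℕ e) (Finₚ.toℕ-fromℕ< (n%ℕd<d b p))))))
    (null-- (residue-null a) (residue-null b))
    where
    lem : ∀ a b r s → r ≡ s → a - b ≡ (a - r) - (b - s)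
    lem a b r _ refl = l a b r
      where
      l : ∀ a b r → a - b ≡ (a - r) - (b - r)
      l = solve-∀

  private
    cancel-inverse : ∀ a b u v → ¬ Null a → ¬ Null b → Null (inv a * u - inv b * v) → Null (a * v - u * b)
    cancel-inverse a b u v na nb z = null-≡ (lem a b u v (inv a) (inv b))
      (null-- (null-- (null-* (u * b) (inv-null a na)) (null-* (a * v) (inv-null b nb))) (null-* (a * b) z))
      where
      lem : ∀ a b u v i j → a * v - u * b ≡ (u * b * (a * i - + 1) - a * v * (b * j - + 1)) - a * b * (i * u - j * v)
      lem = solve-∀

  projective-pigeonhole : ∀ {X : Set} e (y : X → Fin e → ℤ) B L → All (λ x → ¬ (∀ i → Null (y x i))) L → points p e ℕ.* B < length L →
    ∃₂ λ M R → L ↭ M ++ R × B < length M × (∀ {x x′} → Any (x ≡_) M → Any (x′ ≡_) M → Proportional (y x) (y x′))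
  projective-pigeonhole zero y B [] _ ()
  projective-pigeonhole zero y B (x ∷ L) (h ∷ _) _ = ⊥-elim (h (λ ()))
  projective-pigeonhole (suc e) y B L h l with split (λ x → null? (y x zero)) L
  ... | N , O , r , hN , hO with sum-bound (length O) (length N) {p ^ e ℕ.* B} {points p e ℕ.* B}
          (≤-<-trans (≤-reflexive (sym (*-distribʳ-+ B (p ^ e) (points p e))))
              (<-≤-trans l (≤-reflexive (trans (length-split N O r) (+-comm (length N) (length O))))))
  ...   | inj₂ l′ with projective-pigeonhole e (λ x i → y x (suc i)) B N
                    (All.zipWith (λ { (z , nz) all → nz (λ { zero → z ; (suc i) → all i }) }) (hN , Allₚ.++⁻ˡ N (All-resp-↭ r h))) l′
  ...     | M , R , s , B<M , prop = M , R ++ O , ⊑-trans O M R r s , B<M , prop′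
    where
    null₀ : ∀ {x} → Any (x ≡_) M → Null (y x zero)
    null₀ x∈M = All.lookup (Allₚ.++⁻ˡ M (All-resp-↭ s hN)) x∈M
    prop′ : ∀ {x x′} → Any (x ≡_) M → Any (x′ ≡_) M → Proportional (y x) (y x′)
    prop′ {x} {x′} m m′ zero j = null-≡ (lem (y x zero) (y x′ j) (y x j) (y x′ zero)) (null-- (null-* (y x′ j) (null₀ m)) (null-* (y x j) (null₀ m′)))
      where
      lem : ∀ a b c d → a * b - c * d ≡ b * a - c * d
      lem = solve-∀
    prop′ {x} {x′} m m′ (suc i) zero = null-≡ (lem (y x (suc i)) (y x′ zero) (y x zero) (y x′ (suc i)))
        (null-- (null-* (y x (suc i)) (null₀ m′)) (null-* (y x′ (suc i)) (null₀ m)))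
      where
      lem : ∀ a b c d → a * b - c * d ≡ a * b - d * c
      lem = solve-∀
    prop′ m m′ (suc i) (suc j) = prop m m′ i j
  projective-pigeonhole {X} (suc e) y B L h l | N , O , r , hN , hO | inj₁ l′ with pigeonhole (λ x → toℕ (code x)) (p ^ e) B O
      (All.tabulate (λ {x} _ → Finₚ.toℕ<n (code x))) l′
    where
    -- Scaled to first coordinate 1, a vector with non-zero first coordinate is given by its other e
    -- residues; equal codes therefore mean proportional vectors.
    code : X → Fin (p ^ e)
    code x = funToFin (λ i → reduce (inv (y x zero) * y x (suc i)))
  ... | c , M , R , s , hM , B<M = M , R ++ N , ⊑-trans N M R (↭-trans r (++-comm N O)) s , B<M , prop
    where
    code : X → Fin (p ^ e)
    code x = funToFin (λ i → reduce (inv (y x zero) * y x (suc i)))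
    nn : ∀ {x} → Any (x ≡_) M → ¬ Null (y x zero)
    nn x∈M = All.lookup (Allₚ.++⁻ˡ M (All-resp-↭ s hO)) x∈M
    ratio : ∀ {x x′} → Any (x ≡_) M → Any (x′ ≡_) M → ∀ i → Null (y x zero * y x′ (suc i) - y x (suc i) * y x′ zero)
    ratio {x} {x′} m m′ i = cancel-inverse (y x zero) (y x′ zero) (y x (suc i)) (y x′ (suc i)) (nn m) (nn m′)
      (reduce-null (inv (y x zero) * y x (suc i)) (inv (y x′ zero) * y x′ (suc i))
          (trans (sym (Finₚ.finToFun-funToFin _ i)) (trans (cong (λ k → finToFun k i)
          (Finₚ.toℕ-injective (trans (All.lookup hM m) (sym (All.lookup hM m′))))) (Finₚ.finToFun-funToFin _ i))))
    prop : ∀ {x x′} → Any (x ≡_) M → Any (x′ ≡_) M → Proportional (y x) (y x′)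
    prop {x} {x′} m m′ zero zero = null-≡ (ℤₚ.+-inverseʳ (y x zero * y x′ zero)) null-0
    prop {x} {x′} m m′ zero (suc j) = ratio m m′ j
    prop {x} {x′} m m′ (suc i) zero = null-≡ (lem (y x (suc i)) (y x′ zero) (y x zero) (y x′ (suc i))) (null-neg (ratio m m′ i))
      where
      lem : ∀ a b c d → a * b - c * d ≡ - (c * d - a * b)
      lem = solve-∀
    prop {x} {x′} m m′ (suc i) (suc j) = null-cancelˡ (y x zero * y x′ zero) (y x (suc i) * y x′ (suc j) - y x (suc j) * y x′ (suc i))
        (¬null-* {y x zero} {y x′ zero} (nn m) (nn m′))
      (null-≡ (lem (y x zero) (y x′ zero) (y x (suc i)) (y x (suc j)) (y x′ (suc i)) (y x′ (suc j)))
        (null-- (null-* (y x (suc i) * y x′ zero) (ratio m m′ j)) (null-* (y x (suc j) * y x′ zero) (ratio m m′ i))))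
      where
      lem : ∀ a b u v u′ v′ → a * b * (u * v′ - v * u′) ≡ u * b * (a * v′ - v * b) - v * b * (a * u′ - u * b)
      lem = solve-∀

-- From permuted sublists to sets of indices

data Choose {X : Set} : List X → List X → Set where
  done : Choose [] []
  keep : ∀ {x L B} → Choose L B → Choose (x ∷ L) (x ∷ B)
  skip : ∀ {x L B} → Choose L B → Choose (x ∷ L) B

choose-prefix : ∀ {X : Set} (B R : List X) → Choose (B ++ R) B
choose-prefix []      []      = done
choose-prefix []      (x ∷ R) = skip (choose-prefix [] R)
choose-prefix (b ∷ B) R       = keep (choose-prefix B R)

-- Subsets of indices respect positions, whereas the proof works up to permutation. Tracing the
-- sublist back through L ↭ L′ recovers positions at the price of reordering B, which leaves sums
-- and lengths intact.
choose-↭ : ∀ {X : Set} {L L′ B : List X} → L ↭ L′ → Choose L′ B → ∃ λ B′ → Choose L B′ × B′ ↭ B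
choose-↭ _↭_.refl c = _ , c , ↭-refl
choose-↭ (prep x r) (keep c) with choose-↭ r c
... | B′ , c′ , s = x ∷ B′ , keep c′ , prep x s
choose-↭ (prep x r) (skip c) with choose-↭ r c
... | B′ , c′ , s = B′ , skip c′ , s
choose-↭ (swap x y r) (keep (keep c)) with choose-↭ r c
... | B′ , c′ , s = x ∷ y ∷ B′ , keep (keep c′) , swap x y s
choose-↭ (swap x y r) (keep (skip c)) with choose-↭ r c
... | B′ , c′ , s = y ∷ B′ , skip (keep c′) , prep y s
choose-↭ (swap x y r) (skip (keep c)) with choose-↭ r c
... | B′ , c′ , s = x ∷ B′ , keep (skip c′) , prep x s
choose-↭ (swap x y r) (skip (skip c)) with choose-↭ r c
... | B′ , c′ , s = B′ , skip (skip c′) , s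
choose-↭ (_↭_.trans r t) c with choose-↭ t c
... | B₁ , c₁ , s₁ with choose-↭ r c₁
... | B₂ , c₂ , s₂ = B₂ , c₂ , ↭-trans s₂ s₁

sumℕ : ∀ {X : Set} → (X → ℕ) → List X → ℕ
sumℕ f []      = 0
sumℕ f (x ∷ L) = f x ℕ.+ sumℕ f L

choose⇒subset : ∀ {X : Set} {k} (s : Fin k → X) {B} → Choose (tabulate s) B →
  ∃ λ (S : Subset k) → ∣ S ∣ ≡ length B × (∀ f → sumOver S (λ i → f (s i)) ≡ sumℕ f B)
choose⇒subset {k = zero}  s done = Vec.[] , refl , λ _ → refl
choose⇒subset {k = suc k} s (keep c) with choose⇒subset (λ i → s (suc i)) c
... | S , size , sums = true Vec.∷ S , cong suc size , λ f → cong (f (s zero) ℕ.+_) (sums f)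
choose⇒subset {k = suc k} s (skip c) with choose⇒subset (λ i → s (suc i)) c
... | S , size , sums = false Vec.∷ S , size , sums

map-split : ∀ {X Z : Set} (f : X → Z) zs A B → A ++ B ≡ map f zs → ∃₂ λ zs₁ zs₂ → zs ≡ zs₁ ++ zs₂ × A ≡ map f zs₁ × B ≡ map f zs₂
map-split f zs       []      B e = [] , zs , refl , refl , e
map-split f (z ∷ zs) (a ∷ A) B e with map-split f zs A B (Listₚ.∷-injectiveʳ e)
... | zs₁ , zs₂ , e₁ , e₂ , e₃ = z ∷ zs₁ , zs₂ , cong (z ∷_) e₁ , cong₂ _∷_ (Listₚ.∷-injectiveˡ e) e₂ , e₃

↭-map-split : ∀ {X Z : Set} (f : X → Z) zs A B → map f zs ↭ A ++ B → ∃₂ λ zs₁ zs₂ → zs ↭ zs₁ ++ zs₂ × A ≡ map f zs₁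
↭-map-split f zs A B r with ↭-map-inv f r
... | zs′ , e , s with map-split f zs′ A B e
...   | zs₁ , zs₂ , refl , e₁ , _ = zs₁ , zs₂ , s , e₁

length-filter-⊑ : ∀ {X : Set} {P : X → Set} (P? : Decidable P) {S} M R → S ↭ M ++ R → All P M → length M ≤ length (filter P? S)
length-filter-⊑ P? {S} M R r h = ≤-trans (≤-trans (m≤m+n (length M) (length (filter P? R)))
  (≤-reflexive (trans (cong (λ L → length L ℕ.+ length (filter P? R)) (sym (Listₚ.filter-all P? h)))
      (sym (trans (cong length (Listₚ.filter-++ P? M R)) (Listₚ.length-++ (filter P? M)))))))
  (≤-reflexive (sym (↭-length (filter-↭ P? r))))

length-filter-split : ∀ {X : Set} {P : X → Set} (P? : Decidable P) {S} M R → S ↭ M ++ R → All P M → All (λ x → ¬ P x) R → length (filter P? S) ≡ length M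
length-filter-split P? {S} M R r h h′ = trans (↭-length (filter-↭ P? r)) (trans (cong length (Listₚ.filter-++ P? M R))
  (trans (cong₂ (λ A B → length (A ++ B)) (Listₚ.filter-all P? h) (Listₚ.filter-none P? h′)) (cong length (Listₚ.++-identityʳ M))))

-- Counting on lines and planes in the whole space

module Space (p : ℕ) (pr : Prime p) (7≤p : 7 ≤ p) (e : ℕ) where
  open Residues p pr
  open PlaneSums p pr using (Short; η-plane)
  open Rigidity p pr 7≤p using (LineBound; NonNull)
  open PlaneRigidity p pr 7≤p using (plane-bound)
  open Projective p pr

  X : Set
  X = ℤₚ^ p (suc e)

  co : X → Fin (suc e) → ℤ
  co x j = + toℕ (x j)

  ∑ˣ : List X → Fin (suc e) → ℤ
  ∑ˣ []      j = + 0
  ∑ˣ (x ∷ L) j = co x j + ∑ˣ L j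

  ShortX : List X → Set
  ShortX S = ∃₂ λ B R → S ↭ B ++ R × 1 ≤ length B × length B ≤ p × (∀ j → Null (∑ˣ B j))

  shortX-⊑ : ∀ {S B R} → S ↭ B ++ R → ShortX B → ShortX S
  shortX-⊑ {S} {B} {R} r (C , R′ , s , h) = C , R′ ++ R , ⊑-trans R C R′ r s , h

  Par : X → X → Set
  Par x y = Proportional (co x) (co y)

  par? : ∀ x → Decidable (Par x)
  par? x y = Finₚ.all? (λ i → Finₚ.all? (λ j → null? (co x i * co y j - co x j * co y i)))

  Zero : X → Set
  Zero x = ∀ j → Null (co x j)

  -- T lies in the span of g and h modulo p, with coefficients c. Coefficients with sum zero give
  -- terms with sum zero, and proportional coefficients give proportional terms; these two
  -- directions carry zero-sum subsequences out of the plane and the bound on lines into it.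
  record Coordinates (T : List X) : Set where
    field
      c : X → Pt
      g h : Fin (suc e) → ℤ
      spans : All (λ z → ∀ j → Null (co z j - (proj₁ (c z) * g j + proj₂ (c z) * h j))) T

    ∑-spans : ∀ L → All (λ z → ∀ j → Null (co z j - (proj₁ (c z) * g j + proj₂ (c z) * h j))) L →
      ∀ j → Null (∑ˣ L j - (proj₁ (∑ (map c L)) * g j + proj₂ (∑ (map c L)) * h j))
    ∑-spans [] [] j = null-≡ (lem (g j) (h j)) null-0
      where
      lem : ∀ g h → + 0 - (+ 0 * g + + 0 * h) ≡ + 0
      lem = solve-∀
    ∑-spans (z ∷ L) (s ∷ ss) j = null-≡ (lem (co z j) (∑ˣ L j) (proj₁ (c z)) (proj₁ (∑ (map c L))) (proj₂ (c z)) (proj₂ (∑ (map c L))) (g j) (h j))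
        (null-+ (s j) (∑-spans L ss j))
      where
      lem : ∀ z l a b a′ b′ g h → z + l - ((a + b) * g + (a′ + b′) * h) ≡ (z - (a * g + a′ * h)) + (l - (b * g + b′ * h))
      lem = solve-∀

    short⇒shortX : Short (map c T) → ShortX T
    short⇒shortX (B , R , r , 1≤B , B≤p , zB , zB′) = build (↭-map-split c T B R r) 1≤B B≤p zB zB′
      where
      lem : ∀ s a b g h → s ≡ (s - (a * g + b * h)) + (g * a + h * b)
      lem = solve-∀
      build : ∀ {B} → (∃₂ λ T₁ T₂ → T ↭ T₁ ++ T₂ × B ≡ map c T₁) → 1 ≤ length B → length B ≤ p → Null (proj₁ (∑ B)) → Null (proj₂ (∑ B)) → ShortX T
      build (T₁ , T₂ , s , refl) 1≤B B≤p zB zB′ = T₁ , T₂ , s , subst (1 ≤_) (Listₚ.length-map c T₁) 1≤B , subst (_≤ p) (Listₚ.length-map c T₁) B≤p ,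
        λ j → null-≡ (lem (∑ˣ T₁ j) (proj₁ (∑ (map c T₁))) (proj₂ (∑ (map c T₁))) (g j) (h j))
          (null-+ (∑-spans T₁ (Allₚ.++⁻ˡ T₁ (All-resp-↭ s spans)) j) (null-+ (null-* (g j) zB) (null-* (h j) zB′)))

    parallel⇒par : ∀ {z z′} → z ∈ T → z′ ∈ T → Null (det (c z) (c z′)) → Par z z′
    parallel⇒par {z} {z′} m m′ zd i j =
      null-≡ (lem (co z i) (co z j) (co z′ i) (co z′ j) (A i) (A j) (A′ i) (A′ j))
        (null-+ (null-+ (null-+ (null-* (co z′ j) (s i)) (null-* (A i) (s′ j))) (null-neg (null-+ (null-* (co z′ i) (s j)) (null-* (A j) (s′ i)))))
          (null-≡ (lem′ (proj₁ (c z)) (proj₂ (c z)) (proj₁ (c z′)) (proj₂ (c z′)) (g i) (h i) (g j) (h j))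
              (null-* (g i * h j - g j * h i) (subst Null (det-coordinates (c z) (c z′)) zd))))
      where
      A A′ : Fin (suc e) → ℤ
      A k = proj₁ (c z) * g k + proj₂ (c z) * h k
      A′ k = proj₁ (c z′) * g k + proj₂ (c z′) * h k
      s : ∀ k → Null (co z k - A k)
      s = All.lookup spans m
      s′ : ∀ k → Null (co z′ k - A′ k)
      s′ = All.lookup spans m′
      lem : ∀ zi zj wi wj ai aj bi bj → zi * wj - zj * wi ≡ ((wj * (zi - ai) + ai * (wj - bj)) + - (wi * (zj - aj) + aj * (wi - bi))) + (ai * bj - aj * bi)
      lem = solve-∀
      lem′ : ∀ a b a′ b′ g h g′ h′ → (a * g + b * h) * (a′ * g′ + b′ * h′) - (a * g′ + b * h′) * (a′ * g + b′ * h) ≡ (g * h′ - g′ * h) * (a * b′ - b * a′)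
      lem′ = solve-∀

  module _ (x : X) (r : Fin (suc e)) (¬xr : ¬ Null (co x r)) where

    private
      minor : X → Fin (suc e) → ℤ
      minor z j = co x r * co z j - co x j * co z r

      y : X → Fin e → ℤ
      y z k = minor z (punchIn r k)

      punch-cases : ∀ (Q : Fin (suc e) → Set) → Q r → (∀ k → Q (punchIn r k)) → ∀ j → Q j
      punch-cases Q qr qk j with r Fin.≟ j
      ... | yes refl = qr
      ... | no r≢j = subst Q (Finₚ.punchIn-punchOut r≢j) (qk (punchOut r≢j))

      minor-r : ∀ z → minor z r ≡ + 0
      minor-r z = ℤₚ.+-inverseʳ (co x r * co z r)

      y-null⇒par : ∀ z → (∀ k → Null (y z k)) → Par x z
      y-null⇒par z h i j = null-cancelˡ (co x r) (co x i * co z j - co x j * co z i) ¬xr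
        (null-≡ (lem (co x r) (co x i) (co x j) (co z r) (co z i) (co z j)) (null-- (null-* (co x i) (all j)) (null-* (co x j) (all i))))
        where
        all : ∀ j → Null (minor z j)
        all = punch-cases (λ j → Null (minor z j)) (null-≡ (minor-r z) null-0) h
        lem : ∀ xr xi xj zr zi zj → xr * (xi * zj - xj * zi) ≡ xi * (xr * zj - xj * zr) - xj * (xr * zi - xi * zr)
        lem = solve-∀

      module _ (h : X) (q : Fin e) (¬hq : ¬ Null (y h q)) where
        b : X → ℤ
        b z = y z q * inv (y h q)
        a : X → ℤ
        a z = (co z r - b z * co h r) * inv (co x r)

        spans′ : ∀ z → Proportional (y z) (y h) → ∀ j → Null (co z j - (a z * co x j + b z * co h j))
        spans′ z prop j = null-cancelˡ (co x r) (co z j - (a z * co x j + b z * co h j)) ¬xr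
          (null-≡ (lem (co x r) (co x j) (co z j) (co z r) (co h j) (co h r) (b z) (inv (co x r)))
            (null-- (minor-b j) (null-* (co x j * (co z r - b z * co h r)) (inv-null (co x r) ¬xr))))
          where
          minor-b : ∀ j → Null (minor z j - b z * minor h j)
          minor-b = punch-cases (λ j → Null (minor z j - b z * minor h j))
            (null-≡ (trans (cong₂ (λ u v → u - b z * v) (minor-r z) (minor-r h)) (l (b z))) null-0)
            (λ k → null-≡ (l′ (y z k) (y z q) (y h k) (y h q) (inv (y h q))) (null-- (null-* (inv (y h q)) (prop k q)) (null-* (y z k) (inv-null (y h q) ¬hq))))
            where
            l : ∀ b → + 0 - b * + 0 ≡ + 0
            l = solve-∀
            l′ : ∀ zk zq hk hq i → zk - zq * i * hk ≡ i * (zk * hq - zq * hk) - zk * (hq * i - + 1)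
            l′ = solve-∀
          lem : ∀ xr xj zj zr hj hr b i → xr * (zj - ((zr - b * hr) * i * xj + b * hj))
            ≡ ((xr * zj - xj * zr) - b * (xr * hj - xj * hr)) - xj * (zr - b * hr) * (xr * i - + 1)
          lem = solve-∀

      spanned : ∀ T h q → ¬ Null (y h q) → All (λ z → Proportional (y z) (y h)) T → Coordinates T
      spanned T h q ¬hq hT = record
        { c = λ z → a h q ¬hq z , b h q ¬hq z ; g = co x ; h = co h ; spans = All.map (λ {z} prop → spans′ h q ¬hq z prop) hT }

    line-coordinates : ∀ C → All (Par x) C → Coordinates C
    line-coordinates C hC = record
      { c = λ z → co z r * inv (co x r) , + 0 ; g = co x ; h = λ _ → + 0
      ; spans = All.map (λ {z} p j → null-cancelˡ (co x r) (co z j - (co z r * inv (co x r) * co x j + + 0 * + 0)) ¬xr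
          (null-≡ (lem (co x r) (co x j) (co z j) (co z r) (inv (co x r))) (null-- (p r j) (null-* (co z r * co x j) (inv-null (co x r) ¬xr))))) hC }
      where
      lem : ∀ xr xj zj zr i → xr * (zj - (zr * i * xj + + 0 * + 0)) ≡ (xr * zj - xj * zr) - zr * xj * (xr * i - + 1)
      lem = solve-∀

    plane-through : ∀ C O B → All (Par x) C → All (λ z → ¬ Par x z) O → points p e ℕ.* B < length O →
      ∃₂ λ M R → O ↭ M ++ R × B < length M × Coordinates (C ++ M)
    plane-through C O B hC hO l = build (projective-pigeonhole e y B O (All.map (λ {z} np all → np (y-null⇒par z all)) hO) l)
      where
      build : (∃₂ λ M R → O ↭ M ++ R × B < length M × (∀ {z z′} → Any (z ≡_) M → Any (z′ ≡_) M → Proportional (y z) (y z′))) →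
        ∃₂ λ M R → O ↭ M ++ R × B < length M × Coordinates (C ++ M)
      build ([] , R , s , () , prop)
      build (h ∷ M , R , s , B<M , prop) = h ∷ M , R , s , B<M , coords
        where
        ¬h : ¬ (∀ k → Null (y h k))
        ¬h all = All.head (Allₚ.++⁻ˡ (h ∷ M) (All-resp-↭ s hO)) (y-null⇒par h all)
        pivot : ∃ λ q → ¬ Null (y h q)
        pivot = Finₚ.¬∀⟶∃¬ e (λ k → Null (y h k)) (λ k → null? (y h k)) ¬h
        propC : ∀ z → Par x z → Proportional (y z) (y h)
        propC z p i j = null-≡ (lem (y z i) (y h j) (y z j) (y h i)) (null-- (null-* (y h j) (p r (punchIn r i))) (null-* (y h i) (p r (punchIn r j))))
          where
          lem : ∀ a b c d → a * b - c * d ≡ b * a - d * c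
          lem = solve-∀
        coords : Coordinates (C ++ (h ∷ M))
        coords = spanned (C ++ (h ∷ M)) h (proj₁ pivot) (proj₂ pivot) (Allₚ.++⁺ (All.map (λ {z} p → propC z p) hC) (All.tabulate (λ {z} m → prop m (here refl))))

  det-parallel : ∀ n u v → NonNull n → Null (det n u) → Null (det n v) → Null (det u v)
  det-parallel n u v nn zu zv =
    decide (null? (proj₁ n))
      (λ z₁ → decide (null? (proj₂ n)) (λ z₂ → ⊥-elim (nn (z₁ , z₂)))
        (λ nz → null-cancelˡ (proj₂ n) (det u v) nz (null-≡ (trans (cong (proj₂ n *_) (det-coordinates u v))
            (lem₂ (proj₁ n) (proj₂ n) (proj₁ u) (proj₂ u) (proj₁ v) (proj₂ v)))
          (null-- (null-* (proj₂ u) zv′) (null-* (proj₂ v) zu′)))))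
      (λ nz → null-cancelˡ (proj₁ n) (det u v) nz (null-≡ (trans (cong (proj₁ n *_) (det-coordinates u v))
          (lem₁ (proj₁ n) (proj₂ n) (proj₁ u) (proj₂ u) (proj₁ v) (proj₂ v)))
        (null-- (null-* (proj₁ u) zv′) (null-* (proj₁ v) zu′))))
    where
    zu′ = subst Null (det-coordinates n u) zu
    zv′ = subst Null (det-coordinates n v) zv
    lem₁ : ∀ n n′ u u′ v v′ → n * (u * v′ - u′ * v) ≡ u * (n * v′ - n′ * v) - v * (n * u′ - n′ * u)
    lem₁ = solve-∀
    lem₂ : ∀ n n′ u u′ v v′ → n′ * (u * v′ - u′ * v) ≡ u′ * (n * v′ - n′ * v) - v′ * (n * u′ - n′ * u)
    lem₂ = solve-∀

  module _ (S : List X) (ns : ¬ ShortX S) where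

    private
      N = points p e

      nonzero : ∀ {x} → x ∈ S → ¬ Zero x
      nonzero {x} x∈S z = ns (x ∷ [] , proj₁ (∈⇒↭ x∈S) , proj₂ (∈⇒↭ x∈S) , ≤-refl , ≤-trans (m≤m+n 1 6) 7≤p , λ j → null-≡ (ℤₚ.+-identityʳ (co x j)) (z j))

      count : X → ℕ
      count x = length (filter (par? x) S)

      lineBound : (∀ {x} → x ∈ S → count x ≤ 4) → ∀ T R → S ↭ T ++ R → (C : Coordinates T) → LineBound (map (Coordinates.c C) T)
      lineBound few T R r C n nn B R′ r′ hB = build (↭-map-split (Coordinates.c C) T B R′ r′) hB
        where
        build : ∀ {B} → (∃₂ λ T₁ T₂ → T ↭ T₁ ++ T₂ × B ≡ map (Coordinates.c C) T₁) → All (λ v → Null (det n v)) B → length B ≤ 4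
        build ([] , T₂ , s , refl) _ = z≤n
        build (z ∷ T₁ , T₂ , s , refl) hB = ≤-trans (≤-reflexive (Listₚ.length-map (Coordinates.c C) (z ∷ T₁)))
          (≤-trans (length-filter-⊑ (par? z) (z ∷ T₁) (T₂ ++ R) S↭ (All.tabulate (λ {z′} m → Coordinates.parallel⇒par C (∈T (here refl)) (∈T m)
              (det-parallel n _ _ nn (All.lookup hB′ (here refl)) (All.lookup hB′ m)))))
            (few (∈-resp-↭ (↭-sym S↭) (here refl))))
          where
          S↭ : S ↭ (z ∷ T₁) ++ (T₂ ++ R)
          S↭ = ⊑-trans R (z ∷ T₁) T₂ r s
          ∈T : ∀ {z′} → z′ ∈ z ∷ T₁ → z′ ∈ T
          ∈T m = ∈-resp-↭ (↭-sym s) (∈-++⁺ˡ m)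
          hB′ : All (λ v → Null (det n (Coordinates.c C v))) (z ∷ T₁)
          hB′ = Allₚ.map⁻ hB

      module Through (x : X) (x∈S : x ∈ S) where
        pivot : ∃ λ r → ¬ Null (co x r)
        pivot = Finₚ.¬∀⟶∃¬ (suc e) (λ j → Null (co x j)) (λ j → null? (co x j)) (nonzero x∈S)
        parts : ∃₂ λ C O → S ↭ C ++ O × All (Par x) C × All (λ z → ¬ Par x z) O
        parts = split (par? x) S
        C = proj₁ parts
        O = proj₁ (proj₂ parts)
        S↭ : S ↭ C ++ O
        S↭ = proj₁ (proj₂ (proj₂ parts))
        hC : All (Par x) C
        hC = proj₁ (proj₂ (proj₂ (proj₂ parts)))
        hO : All (λ z → ¬ Par x z) O
        hO = proj₂ (proj₂ (proj₂ (proj₂ parts)))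
        count≡ : count x ≡ length C
        count≡ = length-filter-split (par? x) C O S↭ hC hO
        total : length S ≡ count x ℕ.+ length O
        total = trans (length-split C O S↭) (cong (ℕ._+ length O) (sym count≡))

        long-line : 3 ℕ.* p ≤ 2 ℕ.+ count x → ⊥
        long-line h = ns (shortX-⊑ S↭ (Coordinates.short⇒shortX coords (η-plane _
            (≤-trans h (≤-reflexive (cong (2 ℕ.+_) (trans count≡ (sym (Listₚ.length-map _ C)))))))))
          where
          coords : Coordinates C
          coords = line-coordinates x (proj₁ pivot) (proj₂ pivot) C hC

        in-plane : ∀ B → N ℕ.* B < length O →
          (∀ T R → S ↭ T ++ R → count x ℕ.+ suc B ≤ length T → (C : Coordinates T) → ¬ Short (map (Coordinates.c C) T) → ⊥) → ⊥
        in-plane B l use = build (plane-through x (proj₁ pivot) (proj₂ pivot) C O B hC hO l)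
          where
          build : (∃₂ λ M R → O ↭ M ++ R × B < length M × Coordinates (C ++ M)) → ⊥
          build (M , R , s , B<M , coords) = use (C ++ M) R perm
              (≤-trans (+-mono-≤ (≤-reflexive count≡) B<M) (≤-reflexive (sym (Listₚ.length-++ C)))) coords
              (λ sh → ns (shortX-⊑ perm (Coordinates.short⇒shortX coords sh)))
            where
            perm : S ↭ (C ++ M) ++ R
            perm = ↭-trans S↭ (↭-trans (++⁺ˡ C s) (↭-reflexive (sym (Listₚ.++-assoc C M R))))

    module _ (u : ℕ) (u+7 : u ℕ.+ 7 ≡ 3 ℕ.* p) (2≤N : 2 ≤ points p e) (len : length S ≡ points p e ℕ.* u ℕ.+ 4) where

      private
        many : ∀ {x} → x ∈ S → 5 ≤ count x → ⊥
        many {x} x∈S 5≤c = decide (3 ℕ.* p ≤? 2 ℕ.+ count x) long-line λ short →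
            go (count x ∸ 5) (3 ℕ.* p ∸ (3 ℕ.+ count x)) (sym (m+[n∸m]≡n 5≤c)) (sym (m+[n∸m]≡n (≰⇒> short)))
          where
          open Through x x∈S
          go : ∀ t B → count x ≡ 5 ℕ.+ t → 3 ℕ.* p ≡ 3 ℕ.+ count x ℕ.+ B → ⊥
          go t B c≡ 3p≡ = in-plane B (≰⇒> (λ O≤ → contradiction (chain O≤) (<⇒≱ ≤-refl)))
              (λ T R r l C nsh → nsh (η-plane (map (Coordinates.c C) T) (≤-trans (≤-reflexive (trans 3p≡ (lem₁ (count x) B)))
                (+-monoʳ-≤ 2 (≤-trans l (≤-reflexive (sym (Listₚ.length-map (Coordinates.c C) T))))))))
            where
            lem₁ : ∀ c B → 3 ℕ.+ c ℕ.+ B ≡ 2 ℕ.+ (c ℕ.+ suc B)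
            lem₁ = solveℕ
            u≡ : u ≡ B ℕ.+ (1 ℕ.+ t)
            u≡ = +-cancelʳ-≡ 7 u (B ℕ.+ (1 ℕ.+ t)) (trans u+7 (trans 3p≡ (trans (cong (λ c → 3 ℕ.+ c ℕ.+ B) c≡) (lem t B))))
              where
              lem : ∀ t B → 3 ℕ.+ (5 ℕ.+ t) ℕ.+ B ≡ B ℕ.+ (1 ℕ.+ t) ℕ.+ 7
              lem = solveℕ
            -- N u + 4 = |S| = (5 + t) + |O| ≤ 5 + t + N B although N u = N B + N (1 + t) and N ≥ 2
            chain : length O ≤ N ℕ.* B → suc (5 ℕ.+ t ℕ.+ N ℕ.* B) ≤ 5 ℕ.+ t ℕ.+ N ℕ.* B
            chain O≤ = ≤-trans (≤-trans (≤-trans (m≤m+n _ t) (≤-reflexive (lem₂ t (N ℕ.* B)))) (+-monoʳ-≤ (N ℕ.* B) (+-monoˡ-≤ 4 (*-monoˡ-≤ (1 ℕ.+ t) 2≤N))))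
              (≤-trans (≤-reflexive (trans (lem₃ N B t) (trans (cong (λ w → N ℕ.* w ℕ.+ 4) (sym u≡)) (trans (sym len) (trans total (cong (ℕ._+ length O) c≡))))))
                (+-monoʳ-≤ (5 ℕ.+ t) O≤))
              where
              lem₂ : ∀ t b → suc (5 ℕ.+ t ℕ.+ b) ℕ.+ t ≡ b ℕ.+ (2 ℕ.* (1 ℕ.+ t) ℕ.+ 4)
              lem₂ = solveℕ
              lem₃ : ∀ N B t → N ℕ.* B ℕ.+ (N ℕ.* (1 ℕ.+ t) ℕ.+ 4) ≡ N ℕ.* (B ℕ.+ (1 ℕ.+ t)) ℕ.+ 4
              lem₃ = solveℕ

        few : (∀ {x} → x ∈ S → count x ≤ 4) → ∀ {x} → x ∈ S → 3 ≤ count x → ⊥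
        few ≤4 {x} x∈S 3≤c = go (count x ∸ 3) (3 ℕ.* p ∸ (4 ℕ.+ count x)) (sym (m+[n∸m]≡n 3≤c))
            (sym (m+[n∸m]≡n (≤-trans (+-monoʳ-≤ 4 (≤4 x∈S)) (≤-trans (m≤m+n 8 13) (*-monoʳ-≤ 3 7≤p)))))
          where
          open Through x x∈S
          go : ∀ t B → count x ≡ 3 ℕ.+ t → 3 ℕ.* p ≡ 4 ℕ.+ count x ℕ.+ B → ⊥
          go t B c≡ 3p≡ = in-plane B (≰⇒> (λ O≤ → contradiction (chain O≤) (<⇒≱ ≤-refl)))
              (λ T R r l C nsh → plane-bound (map (Coordinates.c C) T) (≤-trans (≤-reflexive (trans 3p≡ (lem₁ (count x) B)))
                (+-monoʳ-≤ 3 (≤-trans l (≤-reflexive (sym (Listₚ.length-map (Coordinates.c C) T)))))) (lineBound ≤4 T R r C) nsh)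
            where
            lem₁ : ∀ c B → 4 ℕ.+ c ℕ.+ B ≡ 3 ℕ.+ (c ℕ.+ suc B)
            lem₁ = solveℕ
            u≡ : u ≡ B ℕ.+ t
            u≡ = +-cancelʳ-≡ 7 u (B ℕ.+ t) (trans u+7 (trans 3p≡ (trans (cong (λ c → 4 ℕ.+ c ℕ.+ B) c≡) (lem t B))))
              where
              lem : ∀ t B → 4 ℕ.+ (3 ℕ.+ t) ℕ.+ B ≡ B ℕ.+ t ℕ.+ 7
              lem = solveℕ
            chain : length O ≤ N ℕ.* B → suc (3 ℕ.+ t ℕ.+ N ℕ.* B) ≤ 3 ℕ.+ t ℕ.+ N ℕ.* B
            chain O≤ = ≤-trans (≤-trans (≤-reflexive (lem₂ t (N ℕ.* B))) (+-monoʳ-≤ (N ℕ.* B) (+-monoˡ-≤ 4 (*-monoˡ-≤ t (≤-trans (n≤1+n 1) 2≤N)))))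
              (≤-trans (≤-reflexive (trans (lem₃ N B t) (trans (cong (λ w → N ℕ.* w ℕ.+ 4) (sym u≡)) (trans (sym len) (trans total (cong (ℕ._+ length O) c≡))))))
                (+-monoʳ-≤ (3 ℕ.+ t) O≤))
              where
              lem₂ : ∀ t b → suc (3 ℕ.+ t ℕ.+ b) ≡ b ℕ.+ (1 ℕ.* t ℕ.+ 4)
              lem₂ = solveℕ
              lem₃ : ∀ N B t → N ℕ.* B ℕ.+ (N ℕ.* t ℕ.+ 4) ≡ N ℕ.* (B ℕ.+ t) ℕ.+ 4
              lem₃ = solveℕ

        triple : ∃ λ x → x ∈ S × 3 ≤ count x
        triple = build (projective-pigeonhole (suc e) co 2 S (All.tabulate nonzero) bound)
          where
          2p≤u : 2 ℕ.* p ≤ u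
          2p≤u = +-cancelʳ-≤ 7 (2 ℕ.* p) u (≤-trans (+-monoʳ-≤ (2 ℕ.* p) 7≤p) (≤-reflexive (trans (lem p) (sym u+7))))
            where
            lem : ∀ p → 2 ℕ.* p ℕ.+ p ≡ 3 ℕ.* p
            lem = solveℕ
          bound : points p (suc e) ℕ.* 2 < length S
          bound = ≤-trans (≤-trans (≤-reflexive (trans (cong (λ w → suc (w ℕ.* 2)) (points-suc p e)) (lem p N))) (+-mono-≤ (*-monoʳ-≤ N 2p≤u) (n≤1+n 3)))
            (≤-reflexive (sym len))
            where
            lem : ∀ p N → suc ((1 ℕ.+ p ℕ.* N) ℕ.* 2) ≡ N ℕ.* (2 ℕ.* p) ℕ.+ 3
            lem = solveℕ
          build : (∃₂ λ M R → S ↭ M ++ R × 2 < length M × (∀ {x x′} → Any (x ≡_) M → Any (x′ ≡_) M → Par x x′)) → ∃ λ x → x ∈ S × 3 ≤ count x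
          build ([] , R , s , () , _)
          build (x ∷ M , R , s , l , prop) = x , ∈-resp-↭ (↭-sym s) (here refl) ,
            ≤-trans l (length-filter-⊑ (par? x) (x ∷ M) R s (All.tabulate (λ m → prop (here refl) m)))

      counting : ⊥
      counting = decide (any? (λ x → 5 ≤? count x) S)
        (λ a → let (x , x∈S , h) = find-any a in many x∈S h)
        (λ ¬a → few (λ x∈S → s≤s⁻¹ (≰⇒> (λ h → ¬a (lose x∈S h)))) (proj₁ (proj₂ triple)) (proj₂ (proj₂ triple)))

sumℕ-↭ : ∀ {X : Set} (f : X → ℕ) {L L′} → L ↭ L′ → sumℕ f L ≡ sumℕ f L′
sumℕ-↭ f _↭_.refl = refl
sumℕ-↭ f (_↭_.prep x r) = cong (f x ℕ.+_) (sumℕ-↭ f r)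
sumℕ-↭ f (_↭_.swap {xs} {ys} x y r) = trans (cong (λ w → f x ℕ.+ (f y ℕ.+ w)) (sumℕ-↭ f r)) (lem (f x) (f y) (sumℕ f ys))
  where
  lem : ∀ a b c → a ℕ.+ (b ℕ.+ c) ≡ b ℕ.+ (a ℕ.+ c)
  lem = solveℕ
sumℕ-↭ f (_↭_.trans r t) = trans (sumℕ-↭ f r) (sumℕ-↭ f t)

points-pos : ∀ q e → 2 ≤ e → 2 ≤ points (suc q) e
points-pos q (suc (suc e)) (s≤s (s≤s _)) = +-mono-≤ (pos (suc e)) (≤-trans (pos e) (m≤m+n _ _))
  where
  pos : ∀ k → 1 ≤ suc q ^ k
  pos k = m^n>0 (suc q) k

points-* : ∀ q e → points (suc q) e ℕ.* (suc q ℕ.* suc q ∸ suc q) ≡ suc q ^ suc e ∸ suc q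
points-* q e = sym (trans (cong (_∸ suc q) (trans (cong (suc q ℕ.*_) (sym (points-geometric q e))) (lem q (points (suc q) e))))
  (trans (m+n∸n≡m (points (suc q) e ℕ.* (q ℕ.* suc q)) (suc q)) (cong (points (suc q) e ℕ.*_) (sym (m+n∸m≡n (suc q) (q ℕ.* suc q))))))
  where
  lem : ∀ q N → suc q ℕ.* (N ℕ.* q ℕ.+ 1) ≡ N ℕ.* (q ℕ.* suc q) ℕ.+ suc q
  lem = solveℕ

hasShortZeroSum? : ∀ {p d k} n (s : Seq p d k) → Dec (HasShortZeroSum n s)
hasShortZeroSum? {p} n s = anySubset? λ S → (1 ≤? ∣ S ∣) ×-dec (∣ S ∣ ≤? n) ×-dec Finₚ.all? (λ j → p ℕᵈ.∣? sumOver S (λ i → toℕ (s i j)))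

module _ (p : ℕ) (pr : Prime p) (7≤p : 7 ≤ p) (e : ℕ) where
  open Residues p pr using (Null)
  open Space p pr 7≤p e

  sumℕ-∑ˣ : ∀ L j → + sumℕ (λ x → toℕ (x j)) L ≡ ∑ˣ L j
  sumℕ-∑ˣ []      j = refl
  sumℕ-∑ˣ (x ∷ L) j = trans (ℤₚ.pos-+ (toℕ (x j)) (sumℕ (λ x → toℕ (x j)) L)) (cong (λ w → + toℕ (x j) + w) (sumℕ-∑ˣ L j))

  shortX⇒hasShortZeroSum : ∀ {k} (s : Seq p (suc e) k) → ShortX (tabulate s) → HasShortZeroSum p s
  shortX⇒hasShortZeroSum s (B , R , r , 1≤B , B≤p , zB) = build (choose-↭ r (choose-prefix B R))
    where
    build : (∃ λ B′ → Choose (tabulate s) B′ × B′ ↭ B) → HasShortZeroSum p s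
    build (B′ , c , B′↭B) = build′ (choose⇒subset s c)
      where
      build′ : (∃ λ (S : Subset _) → ∣ S ∣ ≡ length B′ × (∀ f → sumOver S (λ i → f (s i)) ≡ sumℕ f B′)) → HasShortZeroSum p s
      build′ (S , size , sums) = S , subst (1 ≤_) (sym size′) 1≤B , subst (_≤ p) (sym size′) B≤p ,
        λ j → subst (p ℕᵈ.∣_) (sym (trans (sums (λ x → toℕ (x j))) (sumℕ-↭ (λ x → toℕ (x j)) B′↭B))) (∣⇒∣ᵤ (subst Null (sym (sumℕ-∑ˣ B j)) (zB j)))
        where
        size′ : ∣ S ∣ ≡ length B
        size′ = trans size (↭-length B′↭B)

  allHaveShortZeroSum : 2 ≤ points p e → AllHaveShortZeroSum p (suc e) p (points p e ℕ.* (3 ℕ.* p ∸ 7) ℕ.+ 4)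
  allHaveShortZeroSum 2≤N s = decide (hasShortZeroSum? p s) (λ h → h) λ ¬h → ⊥-elim
    (counting (tabulate s) (λ sh → ¬h (shortX⇒hasShortZeroSum s sh)) (3 ℕ.* p ∸ 7) (m∸n+n≡m (≤-trans 7≤p (m≤m+n p _))) 2≤N (Listₚ.length-tabulate s))

theorem1p2 : (p d : ℕ) → Prime p → 7 ≤ p → 3 ≤ d → (m : ℕ) → IsEta p d m →
  m ℕ.* (p ℕ.* p ∸ p) ≤ (p ^ d ∸ p) ℕ.* (3 ℕ.* p ∸ 7) ℕ.+ 4 ℕ.* (p ℕ.* p ∸ p)
theorem1p2 (suc q) (suc e) pr 7≤p (s≤s 2≤e) m (_ , minimal) =
  ≤-trans (*-monoˡ-≤ D m≤K) (≤-reflexive (trans (lem N U D) (cong (λ w → w ℕ.* U ℕ.+ 4 ℕ.* D) (points-* q e))))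
  where
  N = points (suc q) e
  U = 3 ℕ.* suc q ∸ 7
  D = suc q ℕ.* suc q ∸ suc q
  m≤K : m ≤ N ℕ.* U ℕ.+ 4
  m≤K = ≮⇒≥ (λ K<m → minimal (N ℕ.* U ℕ.+ 4) K<m (allHaveShortZeroSum (suc q) pr 7≤p e (points-pos q e 2≤e)))
  lem : ∀ N U D → (N ℕ.* U ℕ.+ 4) ℕ.* D ≡ N ℕ.* D ℕ.* U ℕ.+ 4 ℕ.* D
  lem = solveℕ
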